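{- Let $\Sigma$ be a set of generators. There is an isomorphism of PROPs $\mathbf T_\Sigma+\mathbf{CComon}\cong\mathsf{PLMCsp}_D(\mathbf{Hyp}_\Sigma)$.
   Context: A PROP is a strict symmetric monoidal category with objects $\mathbb N$ and addition as tensor on objects. A set of generators $\Sigma$ has functions $\mathrm{dom},\mathrm{cod}\colon\Sigma\to\mathbb N$. $\mathbf T_\Sigma$ is the symmetric traced PROP freely generated over $\Sigma$; $\mathbf{CComon}$ is the PROP of cocommutative comonoids (generators a comultiplication $1\to2$ and counit $1\to0$, with counitality, coassociativity and cocommutativity). $\mathbf T_\Sigma+\mathbf{CComon}$ is the symmetric traced PROP freely generated by $\Sigma$ together with the comonoid generators, modulo the comonoid equations. A hypergraph $F$ has a set of vertices $F_\star$ and, for $k,l\in\mathbb N$, a set $F_{k,l}$ of hyperedges with ordered lists of $k$ sources and $l$ targets; homomorphisms preserve ordered sources and targets. $\mathbf{Hyp}_\Sigma$ is the category of finite hypergraphs in which every hyperedge is labelled by a generator of $\Sigma$ of matching arity and coarity, with label-preserving homomorphisms. Write $n$ also for the discrete hypergraph with vertices $0,\dots,n-1$ and no edges. $\mathsf{Csp}_D(\mathbf{Hyp}_\Sigma)$ is the PROP whose morphisms $m\to n$ are isomorphism classes of cospans $m\to F\leftarrow n$ in $\mathbf{Hyp}_\Sigma$, composed by pushout, with tensor by coproduct. The degree of a vertex $v$ is $(i,o)$, with $i$ the number of hyperedge target positions and $o$ the number of hyperedge source positions occupied by $v$. A cospan $m\xrightarrow{f}F\xleftarrow{g}n$ is partial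 left-monogamous if $f$ is mono and every vertex $v$ has degree $(0,o)$ if $v$ is in the image of $f$, and $(0,o)$ or $(1,o)$ otherwise, for some $o\in\mathbb N$. $\mathsf{PLMCsp}_D(\mathbf{Hyp}_\Sigma)$ is the sub-PROP of $\mathsf{Csp}_D(\mathbf{Hyp}_\Sigma)$ containing the partial left-monogamous cospans. -}

module Defs where

open import Level using (Level; _⊔_; 0ℓ) renaming (suc to lsuc)
open import Data.Nat using (ℕ; zero; suc; _+_)
open import Data.Nat.Properties using (+-assoc; +-identityʳ)
open import Data.Fin using (Fin; zero; suc; _↑ˡ_; _↑ʳ_; splitAt; join; cast; punchIn; punchOut)
open import Data.Fin.Properties
  using (_≟_; toℕ-injective; toℕ-↑ˡ; toℕ-↑ʳ; toℕ-cast; splitAt-↑ˡ; splitAt-↑ʳ; join-splitAt;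
         splitAt-join; punchInᵢ≢i; punchOut-punchIn; punchOut-cong; punchIn-punchOut; +↔⊎; any?)
open import Data.Vec using (Vec; lookup; map)
open import Data.Vec.Properties using (map-∘; map-id; map-cong; lookup-map)
open import Data.Product using (Σ; _×_; _,_; proj₁; proj₂; Σ-syntax; ∃-syntax)
open import Data.Sum using (_⊎_; inj₁; inj₂; [_,_]′; swap)
open import Data.Sum.Properties using (inj₁-injective; inj₂-injective)
open import Data.Sum.Function.Propositional using (_⊎-↔_)
open import Data.Empty using (⊥; ⊥-elim)
open import Function using (_∘_; _↔_; Inverse; mk↔ₛ′)
open import Function.Properties.Inverse using (↔-trans; ↔-sym; ↔-refl)
open import Relation.Nullary using (¬_; Dec; yes; no)
open import Relation.Nullary.Decidable using (map′)
open import Axiom.UniquenessOfIdentityProofs using (module Decidable⇒UIP)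
open import Relation.Binary using (Rel; IsEquivalence; DecidableEquality)
open import Relation.Binary.PropositionalEquality
  using (_≡_; _≢_; _≗_; refl; sym; trans; cong; subst; subst₂)

-- The objects of a PROP are the natural numbers, and the tensor is strictly
-- associative and unital.  As `(m + n) + p` and `m + (n + p)` are equal only
-- propositionally, the strictness equations between morphisms are mediated
-- by `subst₂`.

record PROP (a ℓ : Level) : Set (lsuc (a ⊔ ℓ)) where
  infix  4 _≈_
  infixl 6 _⨾_
  infixl 7 _⊗_
  field
    Hom : ℕ → ℕ → Set a
    _≈_ : ∀ {m n} → Rel (Hom m n) ℓ
    id  : ∀ {n} → Hom n n
    -- composition in diagrammatic order
    _⨾_ : ∀ {m n p} → Hom m n → Hom n p → Hom m p
    _⊗_ : ∀ {m n p q} → Hom m n → Hom p q → Hom (m + p) (n + q)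
    σ   : ∀ m n → Hom (m + n) (n + m)

    ≈-equiv     : ∀ {m n} → IsEquivalence (_≈_ {m} {n})

    ⨾-cong      : ∀ {m n p} {f f′ : Hom m n} {g g′ : Hom n p} →
                  f ≈ f′ → g ≈ g′ → f ⨾ g ≈ f′ ⨾ g′
    ⨾-assoc     : ∀ {m n p q} (f : Hom m n) (g : Hom n p) (h : Hom p q) →
                  (f ⨾ g) ⨾ h ≈ f ⨾ (g ⨾ h)
    ⨾-identityˡ : ∀ {m n} (f : Hom m n) → id ⨾ f ≈ f
    ⨾-identityʳ : ∀ {m n} (f : Hom m n) → f ⨾ id ≈ f

    ⊗-cong      : ∀ {m n p q} {f f′ : Hom m n} {g g′ : Hom p q} →
                  f ≈ f′ → g ≈ g′ → f ⊗ g ≈ f′ ⊗ g′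
    ⊗-id        : ∀ {m n} → id {m} ⊗ id {n} ≈ id {m + n}
    ⊗-⨾         : ∀ {m n p m′ n′ p′}
                  (f : Hom m n) (g : Hom n p) (f′ : Hom m′ n′) (g′ : Hom n′ p′) →
                  (f ⨾ g) ⊗ (f′ ⨾ g′) ≈ (f ⊗ f′) ⨾ (g ⊗ g′)

    ⊗-identityˡ : ∀ {m n} (f : Hom m n) → id {0} ⊗ f ≈ f
    ⊗-identityʳ : ∀ {m n} (f : Hom m n) →
                  subst₂ Hom (+-identityʳ m) (+-identityʳ n) (f ⊗ id {0}) ≈ f
    ⊗-assoc     : ∀ {m n p m′ n′ p′} (f : Hom m m′) (g : Hom n n′) (h : Hom p p′) →
                  subst₂ Hom (+-assoc m n p) (+-assoc m′ n′ p′) ((f ⊗ g) ⊗ h)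
                    ≈ f ⊗ (g ⊗ h)

    σ-natural    : ∀ {m n m′ n′} (f : Hom m m′) (g : Hom n n′) →
                   (f ⊗ g) ⨾ σ m′ n′ ≈ σ m n ⨾ (g ⊗ f)
    σ-involutive : ∀ m n → σ m n ⨾ σ n m ≈ id
    σ-hexagon    : ∀ m n p →
                   σ m (n + p)
                     ≈ subst₂ Hom (+-assoc m n p) (+-assoc n m p) (σ m n ⊗ id {p})
                       ⨾ subst₂ Hom refl (sym (+-assoc n p m)) (id {n} ⊗ σ m p)

-- Strict symmetric monoidal functors that are the identity on objects.

record PROPMorphism {a ℓ a′ ℓ′} (P : PROP a ℓ) (Q : PROP a′ ℓ′)
       : Set (a ⊔ ℓ ⊔ a′ ⊔ ℓ′) where
  private
    module P = PROP P
    module Q = PROP Q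
  field
    F      : ∀ {m n} → P.Hom m n → Q.Hom m n
    F-cong : ∀ {m n} {f g : P.Hom m n} → f P.≈ g → F f Q.≈ F g
    F-id   : ∀ {n} → F (P.id {n}) Q.≈ Q.id
    F-⨾    : ∀ {m n p} (f : P.Hom m n) (g : P.Hom n p) → F (f P.⨾ g) Q.≈ F f Q.⨾ F g
    F-⊗    : ∀ {m n p q} (f : P.Hom m n) (g : P.Hom p q) → F (f P.⊗ g) Q.≈ F f Q.⊗ F g
    F-σ    : ∀ m n → F (P.σ m n) Q.≈ Q.σ m n

infix 3 _≅_

record _≅_ {a ℓ a′ ℓ′} (P : PROP a ℓ) (Q : PROP a′ ℓ′) : Set (a ⊔ ℓ ⊔ a′ ⊔ ℓ′) where
  private
    module P = PROP P
    module Q = PROP Q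
  field
    to   : PROPMorphism P Q
    from : PROPMorphism Q P
  private
    module to   = PROPMorphism to
    module from = PROPMorphism from
  field
    from-to : ∀ {m n} (f : P.Hom m n) → from.F (to.F f) P.≈ f
    to-from : ∀ {m n} (g : Q.Hom m n) → to.F (from.F g) Q.≈ g

record Closed {a ℓ q} (P : PROP a ℓ) (Q : ∀ {m n} → PROP.Hom P m n → Set q) : Set (a ⊔ q) where
  open PROP P
  field
    id-closed : ∀ {n} → Q (id {n})
    ⨾-closed  : ∀ {m n p} {f : Hom m n} {g : Hom n p} → Q f → Q g → Q (f ⨾ g)
    ⊗-closed  : ∀ {m n p q} {f : Hom m n} {g : Hom p q} → Q f → Q g → Q (f ⊗ g)
    σ-closed  : ∀ m n → Q (σ m n)

subPROP : ∀ {a ℓ q} (P : PROP a ℓ) (Q : ∀ {m n} → PROP.Hom P m n → Set q) →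
          Closed P Q → PROP (a ⊔ q) ℓ
subPROP {a} {ℓ} {q} P Q closed = record
  { Hom = SubHom
  ; _≈_ = λ f g → proj₁ f ≈ proj₁ g
  ; id  = id , id-closed
  ; _⨾_ = λ (f , x) (g , y) → f ⨾ g , ⨾-closed x y
  ; _⊗_ = λ (f , x) (g , y) → f ⊗ g , ⊗-closed x y
  ; σ   = λ m n → σ m n , σ-closed m n
  ; ≈-equiv = record { refl = ≈.refl ; sym = ≈.sym ; trans = ≈.trans }
  ; ⨾-cong = ⨾-cong
  ; ⨾-assoc = λ f g h → ⨾-assoc (proj₁ f) (proj₁ g) (proj₁ h)
  ; ⨾-identityˡ = λ f → ⨾-identityˡ (proj₁ f)
  ; ⨾-identityʳ = λ f → ⨾-identityʳ (proj₁ f)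
  ; ⊗-cong = ⊗-cong
  ; ⊗-id = ⊗-id
  ; ⊗-⨾ = λ f g f′ g′ → ⊗-⨾ (proj₁ f) (proj₁ g) (proj₁ f′) (proj₁ g′)
  ; ⊗-identityˡ = λ f → ⊗-identityˡ (proj₁ f)
  ; ⊗-identityʳ = λ {m} {n} f →
      ≈.trans (≈.reflexive (proj₁-subst₂ (+-identityʳ m) (+-identityʳ n))) (⊗-identityʳ (proj₁ f))
  ; ⊗-assoc = λ {m} {n} {p} {m′} {n′} {p′} f g h →
      ≈.trans (≈.reflexive (proj₁-subst₂ (+-assoc m n p) (+-assoc m′ n′ p′)))
              (⊗-assoc (proj₁ f) (proj₁ g) (proj₁ h))
  ; σ-natural = λ f g → σ-natural (proj₁ f) (proj₁ g)
  ; σ-involutive = σ-involutive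
  ; σ-hexagon = λ m n p → ≈.trans (σ-hexagon m n p)
      (⨾-cong (≈.reflexive (sym (proj₁-subst₂ (+-assoc m n p) (+-assoc n m p))))
              (≈.reflexive (sym (proj₁-subst₂ refl (sym (+-assoc n p m))))))
  }
  where
  open PROP P
  open Closed closed
  module ≈ {m n} = IsEquivalence (≈-equiv {m} {n})
  SubHom : ℕ → ℕ → Set (a ⊔ q)
  SubHom m n = Σ (Hom m n) Q
  proj₁-subst₂ : ∀ {m m′ n n′} (p : m ≡ m′) (q : n ≡ n′) {f : SubHom m n} →
                 proj₁ (subst₂ SubHom p q f) ≡ subst₂ Hom p q (proj₁ f)
  proj₁-subst₂ refl refl = refl

-- The object traced out is the leftmost one.

record TracedPROP (a ℓ : Level) : Set (lsuc (a ⊔ ℓ)) where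
  field
    prop : PROP a ℓ
  open PROP prop public
  field
    Tr : ∀ x {m n} → Hom (x + m) (x + n) → Hom m n

    Tr-cong     : ∀ x {m n} {f g : Hom (x + m) (x + n)} → f ≈ g → Tr x f ≈ Tr x g
    tightening  : ∀ x {m n m′ n′} (g : Hom m′ m) (f : Hom (x + m) (x + n)) (h : Hom n n′) →
                  Tr x ((id {x} ⊗ g) ⨾ f ⨾ (id {x} ⊗ h)) ≈ g ⨾ Tr x f ⨾ h
    sliding     : ∀ x y {m n} (f : Hom (x + m) (y + n)) (g : Hom y x) →
                  Tr x (f ⨾ (g ⊗ id {n})) ≈ Tr y ((g ⊗ id {m}) ⨾ f)
    vanishing₀  : ∀ {m n} (f : Hom m n) → Tr 0 f ≈ f
    vanishing₊  : ∀ x y {m n} (f : Hom ((x + y) + m) ((x + y) + n)) →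
                  Tr (x + y) f
                    ≈ Tr y (Tr x (subst₂ Hom (+-assoc x y m) (+-assoc x y n) f))
    superposing : ∀ x {m n p q} (f : Hom (x + m) (x + n)) (g : Hom p q) →
                  Tr x (subst₂ Hom (+-assoc x m p) (+-assoc x n q) (f ⊗ g)) ≈ Tr x f ⊗ g
    yanking     : ∀ x → Tr x (σ x x) ≈ id

record Signature (c : Level) : Set (lsuc c) where
  field
    Gen : Set c
    dom : Gen → ℕ
    cod : Gen → ℕ

open Signature

infixr 5 _⊎ₛ_

_⊎ₛ_ : ∀ {c c′} → Signature c → Signature c′ → Signature (c ⊔ c′)
S ⊎ₛ S′ = record
  { Gen = Gen S ⊎ Gen S′
  ; dom = [ dom S , dom S′ ]′
  ; cod = [ cod S , cod S′ ]′
  }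

infixl 6 _⨾_
infixl 7 _⊗_

data Term {c} (S : Signature c) : ℕ → ℕ → Set c where
  gen : (g : Gen S) → Term S (dom S g) (cod S g)
  id  : ∀ {n} → Term S n n
  _⨾_ : ∀ {m n p} → Term S m n → Term S n p → Term S m p
  _⊗_ : ∀ {m n p q} → Term S m n → Term S p q → Term S (m + p) (n + q)
  σ   : ∀ m n → Term S (m + n) (n + m)
  Tr  : ∀ x {m n} → Term S (x + m) (x + n) → Term S m n

-- The least traced-PROP congruence containing the equations R.

module Congruence {c r} (S : Signature c)
                  (R : ∀ {m n} → Term S m n → Term S m n → Set r) where

  private
    Hom : ℕ → ℕ → Set c
    Hom = Term S

  infix 4 _≈_

  data _≈_ : ∀ {m n} → Hom m n → Hom m n → Set (c ⊔ r) where
    equation : ∀ {m n} {f g : Hom m n} → R f g → f ≈ g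

    ≈-refl   : ∀ {m n} {f : Hom m n} → f ≈ f
    ≈-sym    : ∀ {m n} {f g : Hom m n} → f ≈ g → g ≈ f
    ≈-trans  : ∀ {m n} {f g h : Hom m n} → f ≈ g → g ≈ h → f ≈ h

    ⨾-cong      : ∀ {m n p} {f f′ : Hom m n} {g g′ : Hom n p} →
                  f ≈ f′ → g ≈ g′ → f ⨾ g ≈ f′ ⨾ g′
    ⨾-assoc     : ∀ {m n p q} (f : Hom m n) (g : Hom n p) (h : Hom p q) →
                  (f ⨾ g) ⨾ h ≈ f ⨾ (g ⨾ h)
    ⨾-identityˡ : ∀ {m n} (f : Hom m n) → id ⨾ f ≈ f
    ⨾-identityʳ : ∀ {m n} (f : Hom m n) → f ⨾ id ≈ f

    ⊗-cong      : ∀ {m n p q} {f f′ : Hom m n} {g g′ : Hom p q} →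
                  f ≈ f′ → g ≈ g′ → f ⊗ g ≈ f′ ⊗ g′
    ⊗-id        : ∀ {m n} → id {n = m} ⊗ id {n = n} ≈ id {n = m + n}
    ⊗-⨾         : ∀ {m n p m′ n′ p′}
                  (f : Hom m n) (g : Hom n p) (f′ : Hom m′ n′) (g′ : Hom n′ p′) →
                  (f ⨾ g) ⊗ (f′ ⨾ g′) ≈ (f ⊗ f′) ⨾ (g ⊗ g′)

    ⊗-identityˡ : ∀ {m n} (f : Hom m n) → id {n = 0} ⊗ f ≈ f
    ⊗-identityʳ : ∀ {m n} (f : Hom m n) →
                  subst₂ Hom (+-identityʳ m) (+-identityʳ n) (f ⊗ id {n = 0}) ≈ f
    ⊗-assoc     : ∀ {m n p m′ n′ p′} (f : Hom m m′) (g : Hom n n′) (h : Hom p p′) →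
                  subst₂ Hom (+-assoc m n p) (+-assoc m′ n′ p′) ((f ⊗ g) ⊗ h)
                    ≈ f ⊗ (g ⊗ h)

    σ-natural    : ∀ {m n m′ n′} (f : Hom m m′) (g : Hom n n′) →
                   (f ⊗ g) ⨾ σ m′ n′ ≈ σ m n ⨾ (g ⊗ f)
    σ-involutive : ∀ m n → σ m n ⨾ σ n m ≈ id
    σ-hexagon    : ∀ m n p →
                   σ m (n + p)
                     ≈ subst₂ Hom (+-assoc m n p) (+-assoc n m p) (σ m n ⊗ id {n = p})
                       ⨾ subst₂ Hom refl (sym (+-assoc n p m)) (id {n = n} ⊗ σ m p)

    Tr-cong     : ∀ x {m n} {f g : Hom (x + m) (x + n)} → f ≈ g → Tr x f ≈ Tr x g
    tightening  : ∀ x {m n m′ n′} (g : Hom m′ m) (f : Hom (x + m) (x + n)) (h : Hom n n′) →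
                  Tr x ((id {n = x} ⊗ g) ⨾ f ⨾ (id {n = x} ⊗ h)) ≈ g ⨾ Tr x f ⨾ h
    sliding     : ∀ x y {m n} (f : Hom (x + m) (y + n)) (g : Hom y x) →
                  Tr x (f ⨾ (g ⊗ id {n = n})) ≈ Tr y ((g ⊗ id {n = m}) ⨾ f)
    vanishing₀  : ∀ {m n} (f : Hom m n) → Tr 0 f ≈ f
    vanishing₊  : ∀ x y {m n} (f : Hom ((x + y) + m) ((x + y) + n)) →
                  Tr (x + y) f
                    ≈ Tr y (Tr x (subst₂ Hom (+-assoc x y m) (+-assoc x y n) f))
    superposing : ∀ x {m n p q} (f : Hom (x + m) (x + n)) (g : Hom p q) →
                  Tr x (subst₂ Hom (+-assoc x m p) (+-assoc x n q) (f ⊗ g)) ≈ Tr x f ⊗ g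
    yanking     : ∀ x → Tr x (σ x x) ≈ id

Free : ∀ {c r} (S : Signature c) →
       (∀ {m n} → Term S m n → Term S m n → Set r) → TracedPROP c (c ⊔ r)
Free S R = record
  { prop = record
    { Hom = Term S ; _≈_ = _≈_ ; id = id ; _⨾_ = _⨾_ ; _⊗_ = _⊗_ ; σ = σ
    ; ≈-equiv = record { refl = ≈-refl ; sym = ≈-sym ; trans = ≈-trans }
    ; ⨾-cong = ⨾-cong ; ⨾-assoc = ⨾-assoc
    ; ⨾-identityˡ = ⨾-identityˡ ; ⨾-identityʳ = ⨾-identityʳ
    ; ⊗-cong = ⊗-cong ; ⊗-id = ⊗-id ; ⊗-⨾ = ⊗-⨾
    ; ⊗-identityˡ = ⊗-identityˡ ; ⊗-identityʳ = ⊗-identityʳ ; ⊗-assoc = ⊗-assoc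
    ; σ-natural = σ-natural ; σ-involutive = σ-involutive ; σ-hexagon = σ-hexagon
    }
  ; Tr = Tr
  ; Tr-cong = Tr-cong ; tightening = tightening ; sliding = sliding
  ; vanishing₀ = vanishing₀ ; vanishing₊ = vanishing₊
  ; superposing = superposing ; yanking = yanking
  }
  where open Congruence S R

data ComonoidGen : Set where
  comul counit : ComonoidGen

comonoidSignature : Signature 0ℓ
comonoidSignature = record
  { Gen = ComonoidGen
  ; dom = λ _ → 1
  ; cod = λ { comul → 2 ; counit → 0 }
  }

module _ {c} (S : Signature c) where

  Δ : Term (S ⊎ₛ comonoidSignature) 1 2
  Δ = gen (inj₂ comul)

  ε : Term (S ⊎ₛ comonoidSignature) 1 0
  ε = gen (inj₂ counit)

  data ComonoidEquation : ∀ {m n} → Term (S ⊎ₛ comonoidSignature) m n →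
                          Term (S ⊎ₛ comonoidSignature) m n → Set where
    counitˡ : ComonoidEquation (Δ ⨾ (ε ⊗ id {n = 1})) id
    counitʳ : ComonoidEquation (Δ ⨾ (id {n = 1} ⊗ ε)) id
    coassoc : ComonoidEquation (Δ ⨾ (Δ ⊗ id {n = 1})) (Δ ⨾ (id {n = 1} ⊗ Δ))
    cocomm  : ComonoidEquation (Δ ⨾ σ 1 1) Δ

  T+CComon : TracedPROP c c
  T+CComon = Free (S ⊎ₛ comonoidSignature) ComonoidEquation

Finite : Set → Set
Finite A = ∃[ n ] A ↔ Fin n

Finite-resp : ∀ {A B : Set} → A ↔ B → Finite B → Finite A
Finite-resp A↔B (n , B↔n) = n , ↔-trans A↔B B↔n

Finite-Fin : ∀ n → Finite (Fin n)
Finite-Fin n = n , ↔-refl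

Finite-⊥ : Finite ⊥
Finite-⊥ = 0 , mk↔ₛ′ (λ ()) (λ ()) (λ ()) (λ ())

Finite-⊎ : ∀ {A B : Set} → Finite A → Finite B → Finite (A ⊎ B)
Finite-⊎ (m , A↔m) (n , B↔n) = m + n , ↔-trans (A↔m ⊎-↔ B↔n) (↔-sym +↔⊎)

Finite-Dec : ∀ {A : Set} → Dec A → (∀ (x y : A) → x ≡ y) → Finite A
Finite-Dec (yes a) prop = 1 , mk↔ₛ′ (λ _ → zero) (λ _ → a) (λ { zero → refl }) (prop a)
Finite-Dec (no ¬a) _    = 0 , mk↔ₛ′ (⊥-elim ∘ ¬a) (λ ()) (λ ()) (λ a → ⊥-elim (¬a a))

Finite-ΣFin : ∀ n {B : Fin n → Set} → (∀ i → Finite (B i)) → Finite (Σ (Fin n) B)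
Finite-ΣFin zero    _   = 0 , mk↔ₛ′ (λ ()) (λ ()) (λ ()) (λ ())
Finite-ΣFin (suc n) fin = Finite-resp
  (mk↔ₛ′ (λ { (zero , b) → inj₁ b ; (suc i , b) → inj₂ (i , b) })
         (λ { (inj₁ b) → zero , b ; (inj₂ (i , b)) → suc i , b })
         (λ { (inj₁ _) → refl ; (inj₂ _) → refl })
         (λ { (zero , _) → refl ; (suc _ , _) → refl }))
  (Finite-⊎ (fin zero) (Finite-ΣFin n (fin ∘ suc)))

Finite-≟ : ∀ {A : Set} → Finite A → DecidableEquality A
Finite-≟ (_ , A↔n) x y = map′
  (λ p → trans (sym (strictlyInverseʳ x)) (trans (cong from p) (strictlyInverseʳ y)))
  (cong to) (to x ≟ to y)
  where open Inverse A↔n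

Finite-UIP : ∀ {A : Set} → Finite A → ∀ {x y : A} (p q : x ≡ y) → p ≡ q
Finite-UIP fin = Decidable⇒UIP.≡-irrelevant (Finite-≟ fin)

Finite-Σ : ∀ {A : Set} {B : A → Set} → Finite A → (∀ a → Finite (B a)) → Finite (Σ A B)
Finite-Σ {A} {B} finA@(n , A↔n) finB = Finite-resp
  (mk↔ₛ′ (λ { (a , b) → to a , subst B (sym (strictlyInverseʳ a)) b })
         (λ { (i , b) → from i , b })
         (λ { (i , b) → Σ-≡ (strictlyInverseˡ i) (lemma i b) })
         (λ { (a , b) → Σ-≡′ (strictlyInverseʳ a) b }))
  (Finite-ΣFin n (finB ∘ from))
  where
  open Inverse A↔n
  Σ-≡ : ∀ {i j : Fin n} {b : B (from i)} {b′ : B (from j)} (p : i ≡ j) →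
        subst B (cong from p) b ≡ b′ → _≡_ {A = Σ (Fin n) (B ∘ from)} (i , b) (j , b′)
  Σ-≡ refl refl = refl
  Σ-≡′ : ∀ {a a′ : A} (p : a′ ≡ a) (b : B a) → (a′ , subst B (sym p) b) ≡ (a , b)
  Σ-≡′ refl b = refl
  subst-subst′ : ∀ {x y : A} (p : x ≡ y) (q : y ≡ x) (b : B y) → subst B p (subst B q b) ≡ b
  subst-subst′ refl q b rewrite Finite-UIP finA q refl = refl
  lemma : ∀ i (b : B (from i)) →
          subst B (cong from (strictlyInverseˡ i)) (subst B (sym (strictlyInverseʳ (from i))) b) ≡ b
  lemma i b = subst-subst′ (cong from (strictlyInverseˡ i)) (sym (strictlyInverseʳ (from i))) b

-- `proj` presents `Fin size` as the quotient of `A` by `f i ~ g i`.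

record Coequaliser {k} {A : Set} (f g : Fin k → A) : Set₁ where
  field
    size     : ℕ
    proj     : A → Fin size
    section  : Fin size → A
    proj-section : ∀ y → proj (section y) ≡ y
    proj-eq  : ∀ i → proj (f i) ≡ proj (g i)
    respects : ∀ {X : Set} (h : A → X) → (∀ i → h (f i) ≡ h (g i)) →
               ∀ a → h (section (proj a)) ≡ h a

mergePair : ∀ {n} (a b : Fin n) → Coequaliser {k = 1} (λ _ → a) (λ _ → b)
mergePair a b with a ≟ b
... | yes a≡b = record
  { size = _ ; proj = λ x → x ; section = λ x → x ; proj-section = λ _ → refl
  ; proj-eq = λ _ → a≡b ; respects = λ _ _ _ → refl }
mergePair {suc n} a b | no a≢b = record
  { size = n ; proj = q ; section = punchIn a ; proj-section = q-punchIn
  ; proj-eq = λ _ → q-eq ; respects = λ h eq x → resp h (eq zero) x }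
  where
  q : Fin (suc n) → Fin n
  q x with a ≟ x
  ... | yes _  = punchOut a≢b
  ... | no a≢x = punchOut a≢x
  q-punchIn : ∀ y → q (punchIn a y) ≡ y
  q-punchIn y with a ≟ punchIn a y
  ... | yes p = ⊥-elim (punchInᵢ≢i a y (sym p))
  ... | no p  = punchOut-punchIn a
  q-eq : q a ≡ q b
  q-eq with a ≟ a | a ≟ b
  ... | _      | yes p = ⊥-elim (a≢b p)
  ... | no p   | no _  = ⊥-elim (p refl)
  ... | yes _  | no _  = punchOut-cong a refl
  resp : ∀ {X : Set} (h : Fin (suc n) → X) → h a ≡ h b → ∀ x → h (punchIn a (q x)) ≡ h x
  resp h eq x with a ≟ x
  ... | yes refl = trans (cong h (punchIn-punchOut a≢b)) (sym eq)
  ... | no a≢x   = cong h (punchIn-punchOut a≢x)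

coequaliseFin : ∀ k {n} (f g : Fin k → Fin n) → Coequaliser f g
coequaliseFin zero    f g = record
  { size = _ ; proj = λ x → x ; section = λ x → x ; proj-section = λ _ → refl
  ; proj-eq = λ () ; respects = λ _ _ _ → refl }
coequaliseFin (suc k) f g = record
  { size = C.size
  ; proj = C.proj ∘ M.proj
  ; section = M.section ∘ C.section
  ; proj-section = λ y → trans (cong C.proj (M.proj-section _)) (C.proj-section y)
  ; proj-eq = λ { zero → cong C.proj (M.proj-eq zero) ; (suc i) → C.proj-eq i }
  ; respects = λ h eq a →
      let hM = M.respects h (λ _ → eq zero) in
      trans (C.respects (h ∘ M.section)
              (λ i → trans (hM (f (suc i))) (trans (eq (suc i)) (sym (hM (g (suc i)))))) (M.proj a))
            (hM a)
  }
  where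
  module M = Coequaliser (mergePair (f zero) (g zero))
  module C = Coequaliser (coequaliseFin k (M.proj ∘ f ∘ suc) (M.proj ∘ g ∘ suc))

coequalise : ∀ {k} {A : Set} → Finite A → (f g : Fin k → A) → Coequaliser f g
coequalise {k} (n , A↔n) f g = record
  { size = C.size
  ; proj = C.proj ∘ to
  ; section = from ∘ C.section
  ; proj-section = λ y → trans (cong C.proj (strictlyInverseˡ _)) (C.proj-section y)
  ; proj-eq = C.proj-eq
  ; respects = λ h eq a →
      trans (C.respects (h ∘ from)
              (λ i → trans (cong h (strictlyInverseʳ _))
                       (trans (eq i) (cong h (sym (strictlyInverseʳ _))))) (to a))
            (cong h (strictlyInverseʳ a))
  }
  where
  open Inverse A↔n
  module C = Coequaliser (coequaliseFin k (to ∘ f) (to ∘ g))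

record Hypergraph : Set₁ where
  field
    V   : Set
    E   : ℕ → ℕ → Set
    src : ∀ {k l} → E k l → Vec V k
    tgt : ∀ {k l} → E k l → Vec V l

  Edge : Set
  Edge = Σ[ k ∈ ℕ ] Σ[ l ∈ ℕ ] E k l

module _ {c} (S : Signature c) where

  -- The objects of Hyp_Σ.
  record LabelledHypergraph : Set (lsuc 0ℓ ⊔ c) where
    field
      hypergraph : Hypergraph
    open Hypergraph hypergraph public
    field
      V-finite    : Finite V
      Edge-finite : Finite Edge
      label       : ∀ {k l} → E k l → Gen S
      label-dom   : ∀ {k l} (e : E k l) → dom S (label e) ≡ k
      label-cod   : ∀ {k l} (e : E k l) → cod S (label e) ≡ l

  discrete : ℕ → LabelledHypergraph
  discrete n = record
    { hypergraph = record { V = Fin n ; E = λ _ _ → ⊥ ; src = λ () ; tgt = λ () }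
    ; V-finite = Finite-Fin n
    ; Edge-finite = Finite-resp (mk↔ₛ′ (proj₂ ∘ proj₂) (λ ()) (λ ()) (λ ())) Finite-⊥
    ; label = λ () ; label-dom = λ () ; label-cod = λ ()
    }

module _ {c} {S : Signature c} where

  open LabelledHypergraph

  private
    Hyp : Set (lsuc 0ℓ ⊔ c)
    Hyp = LabelledHypergraph S

  record HypHom (F G : Hyp) : Set c where
    field
      vmap     : V F → V G
      emap     : ∀ {k l} → E F k l → E G k l
      src-pres : ∀ {k l} (e : E F k l) → map vmap (src F e) ≡ src G (emap e)
      tgt-pres : ∀ {k l} (e : E F k l) → map vmap (tgt F e) ≡ tgt G (emap e)
      label-pres : ∀ {k l} (e : E F k l) → label G (emap e) ≡ label F e

  open HypHom

  infix 4 _≐_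

  record _≐_ {F G : Hyp} (f g : HypHom F G) : Set where
    constructor mk≐
    field
      V≐ : ∀ v → vmap f v ≡ vmap g v
      E≐ : ∀ {k l} (e : E F k l) → emap f e ≡ emap g e

  open _≐_

  ≐-refl : ∀ {F G} {f : HypHom F G} → f ≐ f
  ≐-refl = mk≐ (λ _ → refl) (λ _ → refl)

  ≐-sym : ∀ {F G} {f g : HypHom F G} → f ≐ g → g ≐ f
  ≐-sym p = mk≐ (λ v → sym (V≐ p v)) (λ e → sym (E≐ p e))

  ≐-trans : ∀ {F G} {f g h : HypHom F G} → f ≐ g → g ≐ h → f ≐ h
  ≐-trans p q = mk≐ (λ v → trans (V≐ p v) (V≐ q v)) (λ e → trans (E≐ p e) (E≐ q e))

  idₕ : ∀ {F} → HypHom F F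
  idₕ {F} = record
    { vmap = λ v → v ; emap = λ e → e
    ; src-pres = λ e → map-id (src F e) ; tgt-pres = λ e → map-id (tgt F e)
    ; label-pres = λ _ → refl }

  infixr 9 _∘ₕ_

  _∘ₕ_ : ∀ {F G H} → HypHom G H → HypHom F G → HypHom F H
  _∘ₕ_ {F} g f = record
    { vmap = vmap g ∘ vmap f
    ; emap = λ e → emap g (emap f e)
    ; src-pres = λ e → trans (map-∘ (vmap g) (vmap f) (src F e))
                         (trans (cong (map (vmap g)) (src-pres f e)) (src-pres g (emap f e)))
    ; tgt-pres = λ e → trans (map-∘ (vmap g) (vmap f) (tgt F e))
                         (trans (cong (map (vmap g)) (tgt-pres f e)) (tgt-pres g (emap f e)))
    ; label-pres = λ e → trans (label-pres g (emap f e)) (label-pres f e)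
    }

  ∘ₕ-congˡ : ∀ {F G H} {f f′ : HypHom F G} (g : HypHom G H) → f ≐ f′ → g ∘ₕ f ≐ g ∘ₕ f′
  ∘ₕ-congˡ g p = mk≐ (λ v → cong (vmap g) (V≐ p v)) (λ e → cong (emap g) (E≐ p e))

  ∘ₕ-congʳ : ∀ {F G H} {g g′ : HypHom G H} (f : HypHom F G) → g ≐ g′ → g ∘ₕ f ≐ g′ ∘ₕ f
  ∘ₕ-congʳ f p = mk≐ (λ v → V≐ p (vmap f v)) (λ e → E≐ p (emap f e))

  Mono : ∀ {F G} → HypHom F G → Set (lsuc 0ℓ ⊔ c)
  Mono {F} f = ∀ {X : Hyp} (g h : HypHom X F) → f ∘ₕ g ≐ f ∘ₕ h → g ≐ h

  record HypIso (F G : Hyp) : Set c where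
    field
      to      : HypHom F G
      from    : HypHom G F
      from-to : from ∘ₕ to ≐ idₕ
      to-from : to ∘ₕ from ≐ idₕ

  fromDiscrete : ∀ {n F} → (Fin n → V F) → HypHom (discrete S n) F
  fromDiscrete f = record
    { vmap = f ; emap = λ () ; src-pres = λ () ; tgt-pres = λ () ; label-pres = λ () }

  discrete-≐ : ∀ {n F} {f g : HypHom (discrete S n) F} → (∀ i → vmap f i ≡ vmap g i) → f ≐ g
  discrete-≐ p = mk≐ p (λ ())

  -- `glue q` has the edges of F and of G, and the vertices of F and of G
  -- identified along q.  It yields the coproduct for q the identity, and the
  -- pushout of F and G over a discrete hypergraph for q a coequaliser.
  glue : ∀ (F G : Hyp) {W : Set} → Finite W → (V F ⊎ V G → W) → Hyp
  glue F G {W} finW q = record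
    { hypergraph = record
      { V   = W
      ; E   = λ k l → E F k l ⊎ E G k l
      ; src = [ map (q ∘ inj₁) ∘ src F , map (q ∘ inj₂) ∘ src G ]′
      ; tgt = [ map (q ∘ inj₁) ∘ tgt F , map (q ∘ inj₂) ∘ tgt G ]′
      }
    ; V-finite = finW
    ; Edge-finite = Finite-resp
        (mk↔ₛ′ (λ { (k , l , inj₁ e) → inj₁ (k , l , e) ; (k , l , inj₂ e) → inj₂ (k , l , e) })
               (λ { (inj₁ (k , l , e)) → k , l , inj₁ e ; (inj₂ (k , l , e)) → k , l , inj₂ e })
               (λ { (inj₁ _) → refl ; (inj₂ _) → refl })
               (λ { (_ , _ , inj₁ _) → refl ; (_ , _ , inj₂ _) → refl }))
        (Finite-⊎ (Edge-finite F) (Edge-finite G))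
    ; label = [ label F , label G ]′
    ; label-dom = λ { (inj₁ e) → label-dom F e ; (inj₂ e) → label-dom G e }
    ; label-cod = λ { (inj₁ e) → label-cod F e ; (inj₂ e) → label-cod G e }
    }

  module Glue (F G : Hyp) {W : Set} (finW : Finite W) (q : V F ⊎ V G → W) where

    glue₁ : HypHom F (glue F G finW q)
    glue₁ = record { vmap = q ∘ inj₁ ; emap = inj₁ ; src-pres = λ _ → refl
                   ; tgt-pres = λ _ → refl ; label-pres = λ _ → refl }

    glue₂ : HypHom G (glue F G finW q)
    glue₂ = record { vmap = q ∘ inj₂ ; emap = inj₂ ; src-pres = λ _ → refl
                   ; tgt-pres = λ _ → refl ; label-pres = λ _ → refl }

    module _ {X : Hyp} (h : HypHom F X) (k : HypHom G X) (u : W → V X)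
             (u₁ : ∀ v → u (q (inj₁ v)) ≡ vmap h v) (u₂ : ∀ v → u (q (inj₂ v)) ≡ vmap k v) where
      private
        pres : ∀ {Y : Hyp} {n} (t : HypHom Y X) (r : V Y → W) → (∀ v → u (r v) ≡ vmap t v) →
               (xs : Vec (V Y) n) → map u (map r xs) ≡ map (vmap t) xs
        pres t r p xs = trans (sym (map-∘ u r xs)) (map-cong p xs)

      copair : HypHom (glue F G finW q) X
      copair = record
        { vmap = u
        ; emap = [ (λ e → emap h e) , (λ e → emap k e) ]′
        ; src-pres = λ { (inj₁ e) → trans (pres h (q ∘ inj₁) u₁ (src F e)) (src-pres h e)
                       ; (inj₂ e) → trans (pres k (q ∘ inj₂) u₂ (src G e)) (src-pres k e) }
        ; tgt-pres = λ { (inj₁ e) → trans (pres h (q ∘ inj₁) u₁ (tgt F e)) (tgt-pres h e)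
                       ; (inj₂ e) → trans (pres k (q ∘ inj₂) u₂ (tgt G e)) (tgt-pres k e) }
        ; label-pres = λ { (inj₁ e) → label-pres h e ; (inj₂ e) → label-pres k e }
        }

  infixr 5 _⊕_

  _⊕_ : Hyp → Hyp → Hyp
  F ⊕ G = glue F G (Finite-⊎ (V-finite F) (V-finite G)) (λ v → v)

  ι₁ : ∀ {F G} → HypHom F (F ⊕ G)
  ι₁ {F} {G} = Glue.glue₁ F G (Finite-⊎ (V-finite F) (V-finite G)) (λ v → v)

  ι₂ : ∀ {F G} → HypHom G (F ⊕ G)
  ι₂ {F} {G} = Glue.glue₂ F G (Finite-⊎ (V-finite F) (V-finite G)) (λ v → v)

  [_,_]ₕ : ∀ {F G X} → HypHom F X → HypHom G X → HypHom (F ⊕ G) X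
  [_,_]ₕ {F} {G} h k =
    Glue.copair F G (Finite-⊎ (V-finite F) (V-finite G)) (λ v → v) h k [ vmap h , vmap k ]′
      (λ _ → refl) (λ _ → refl)

  ⊕-epi : ∀ {F G X} (u v : HypHom (F ⊕ G) X) → u ∘ₕ ι₁ ≐ v ∘ₕ ι₁ → u ∘ₕ ι₂ ≐ v ∘ₕ ι₂ → u ≐ v
  ⊕-epi u v p q = mk≐ (λ { (inj₁ x) → V≐ p x ; (inj₂ y) → V≐ q y })
                  (λ { (inj₁ x) → E≐ p x ; (inj₂ y) → E≐ q y })

  record IsPushout {A F G P : Hyp} (f : HypHom A F) (g : HypHom A G)
                   (i : HypHom F P) (j : HypHom G P) : Set (lsuc 0ℓ ⊔ c) where
    field
      commute    : i ∘ₕ f ≐ j ∘ₕ g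
      universal  : ∀ {X} (h : HypHom F X) (k : HypHom G X) → h ∘ₕ f ≐ k ∘ₕ g → HypHom P X
      universal₁ : ∀ {X} (h : HypHom F X) (k : HypHom G X) (p : h ∘ₕ f ≐ k ∘ₕ g) →
                   universal h k p ∘ₕ i ≐ h
      universal₂ : ∀ {X} (h : HypHom F X) (k : HypHom G X) (p : h ∘ₕ f ≐ k ∘ₕ g) →
                   universal h k p ∘ₕ j ≐ k
      unique     : ∀ {X} (u v : HypHom P X) → u ∘ₕ i ≐ v ∘ₕ i → u ∘ₕ j ≐ v ∘ₕ j → u ≐ v

  module Pushout {n} {F G : Hyp} (f : HypHom (discrete S n) F) (g : HypHom (discrete S n) G) where

    module C = Coequaliser (coequalise (Finite-⊎ (V-finite F) (V-finite G))
                                       (inj₁ ∘ vmap f) (inj₂ ∘ vmap g))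
    open Glue F G (Finite-Fin C.size) C.proj

    P : Hyp
    P = glue F G (Finite-Fin C.size) C.proj

    i₁ : HypHom F P
    i₁ = glue₁

    i₂ : HypHom G P
    i₂ = glue₂

    isPushout : IsPushout f g i₁ i₂
    isPushout = record
      { commute    = discrete-≐ C.proj-eq
      ; universal  = λ h k p → copair h k ([ vmap h , vmap k ]′ ∘ C.section)
                       (λ v → C.respects [ vmap h , vmap k ]′ (V≐ p) (inj₁ v))
                       (λ v → C.respects [ vmap h , vmap k ]′ (V≐ p) (inj₂ v))
      ; universal₁ = λ h k p →
          mk≐ (λ v → C.respects [ vmap h , vmap k ]′ (V≐ p) (inj₁ v)) (λ _ → refl)
      ; universal₂ = λ h k p →
          mk≐ (λ v → C.respects [ vmap h , vmap k ]′ (V≐ p) (inj₂ v)) (λ _ → refl)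
      ; unique     = λ u v p q →
          mk≐ (λ w → trans (sym (cong (vmap u) (C.proj-section w)))
                       (trans (onV u v p q (C.section w)) (cong (vmap v) (C.proj-section w))))
              (λ { (inj₁ e) → E≐ p e ; (inj₂ e) → E≐ q e })
      }
      where
      onV : ∀ {X} (u v : HypHom P X) → u ∘ₕ i₁ ≐ v ∘ₕ i₁ → u ∘ₕ i₂ ≐ v ∘ₕ i₂ →
            ∀ w → vmap u (C.proj w) ≡ vmap v (C.proj w)
      onV _ _ p q (inj₁ w) = V≐ p w
      onV _ _ p q (inj₂ w) = V≐ q w

infixr 5 _⊞_

_⊞_ : ∀ {m n} {A B : Set} → (Fin m → A) → (Fin n → B) → Fin (m + n) → A ⊎ B
_⊞_ {m} a b x = [ inj₁ ∘ a , inj₂ ∘ b ]′ (splitAt m x)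

swapFin : ∀ m n → Fin (m + n) → Fin (n + m)
swapFin m n x = join n m (swap (splitAt m x))

split-ind : ∀ m {n ℓ} (P : Fin (m + n) → Set ℓ) →
            (∀ i → P (i ↑ˡ n)) → (∀ j → P (m ↑ʳ j)) → ∀ x → P x
split-ind m {n} P l r x = subst P (join-splitAt m n x) (go (splitAt m x))
  where
  go : ∀ s → P (join m n s)
  go (inj₁ i) = l i
  go (inj₂ j) = r j

module _ {m n} {A B : Set} (a : Fin m → A) (b : Fin n → B) where
  ⊞-ˡ : ∀ i → (a ⊞ b) (i ↑ˡ n) ≡ inj₁ (a i)
  ⊞-ˡ i = cong [ inj₁ ∘ a , inj₂ ∘ b ]′ (splitAt-↑ˡ m i n)
  ⊞-ʳ : ∀ j → (a ⊞ b) (m ↑ʳ j) ≡ inj₂ (b j)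
  ⊞-ʳ j = cong [ inj₁ ∘ a , inj₂ ∘ b ]′ (splitAt-↑ʳ m n j)

swap-ˡ : ∀ m n i → swapFin m n (i ↑ˡ n) ≡ n ↑ʳ i
swap-ˡ m n i = cong (join n m ∘ swap) (splitAt-↑ˡ m i n)

swap-ʳ : ∀ m n j → swapFin m n (m ↑ʳ j) ≡ j ↑ˡ m
swap-ʳ m n j = cong (join n m ∘ swap) (splitAt-↑ʳ m n j)

swap-swap : ∀ m n x → swapFin n m (swapFin m n x) ≡ x
swap-swap m n = split-ind m _
  (λ i → trans (cong (swapFin n m) (swap-ˡ m n i)) (swap-ʳ n m i))
  (λ j → trans (cong (swapFin n m) (swap-ʳ m n j)) (swap-ˡ n m j))

module _ {m n p} .(eq : m + (n + p) ≡ (m + n) + p) where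
  cast-₁ : ∀ x → cast eq (x ↑ˡ (n + p)) ≡ (x ↑ˡ n) ↑ˡ p
  cast-₁ x = toℕ-injective (trans (toℕ-cast eq _) (trans (toℕ-↑ˡ x _)
    (sym (trans (toℕ-↑ˡ (x ↑ˡ n) p) (toℕ-↑ˡ x n)))))
  cast-₂ : ∀ y → cast eq (m ↑ʳ (y ↑ˡ p)) ≡ (m ↑ʳ y) ↑ˡ p
  cast-₂ y = toℕ-injective (trans (toℕ-cast eq _) (trans (toℕ-↑ʳ m _)
    (trans (cong (m +_) (toℕ-↑ˡ y p)) (sym (trans (toℕ-↑ˡ (m ↑ʳ y) p) (toℕ-↑ʳ m y))))))
  cast-₃ : ∀ z → cast eq (m ↑ʳ (n ↑ʳ z)) ≡ (m + n) ↑ʳ z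
  cast-₃ z = toℕ-injective (trans (toℕ-cast eq _) (trans (toℕ-↑ʳ m _)
    (trans (cong (m +_) (toℕ-↑ʳ n z)) (trans (sym (+-assoc m n _)) (sym (toℕ-↑ʳ (m + n) z))))))

cast-inv : ∀ {m n} .(p : m ≡ n) .(q : n ≡ m) {x y} → cast p x ≡ y → cast q y ≡ x
cast-inv p q {x} refl = toℕ-injective (trans (toℕ-cast q _) (toℕ-cast p x))

cast-id : ∀ {m} .(p : m ≡ m) x → cast p x ≡ x
cast-id p x = toℕ-injective (toℕ-cast p x)

module _ {c} (S : Signature c) where

  record Cospan (m n : ℕ) : Set (lsuc 0ℓ ⊔ c) where
    field
      apex  : LabelledHypergraph S
      left  : HypHom (discrete S m) apex
      right : HypHom (discrete S n) apex

module _ {c} {S : Signature c} where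

  open LabelledHypergraph
  open HypHom
  open _≐_
  open Cospan

  -- Morphisms m → n are isomorphism classes of cospans, so isomorphism is the
  -- equality of the Hom setoids.
  infix 4 _≈ᶜ_

  record _≈ᶜ_ {m n} (f g : Cospan S m n) : Set c where
    field
      iso   : HypIso (apex f) (apex g)
    open HypIso iso public
    field
      left-comm  : to ∘ₕ left f ≐ left g
      right-comm : to ∘ₕ right f ≐ right g

  open _≈ᶜ_

  infixl 6 _⨾ᶜ_
  infixl 7 _⊗ᶜ_

  _⨾ᶜ_ : ∀ {m n p} → Cospan S m n → Cospan S n p → Cospan S m p
  f ⨾ᶜ g = record
    { apex = P ; left = i₁ ∘ₕ left f ; right = i₂ ∘ₕ right g }
    where open Pushout (right f) (left g)

  -- The cospan m = m ← n with right leg ρ.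
  wire : ∀ {m n} → (Fin n → Fin m) → Cospan S m n
  wire {m} ρ = record { apex = discrete S m ; left = idₕ ; right = fromDiscrete ρ }

  idᶜ : ∀ {n} → Cospan S n n
  idᶜ = wire (λ x → x)

  _⊗ᶜ_ : ∀ {m n p q} → Cospan S m n → Cospan S p q → Cospan S (m + p) (n + q)
  f ⊗ᶜ g = record
    { apex  = apex f ⊕ apex g
    ; left  = fromDiscrete (vmap (left f) ⊞ vmap (left g))
    ; right = fromDiscrete (vmap (right f) ⊞ vmap (right g))
    }

  σᶜ : ∀ m n → Cospan S (m + n) (n + m)
  σᶜ m n = wire (swapFin n m)

  ≈ᶜ-refl : ∀ {m n} {f : Cospan S m n} → f ≈ᶜ f
  ≈ᶜ-refl = record
    { iso = record { to = idₕ ; from = idₕ ; from-to = mk≐ (λ _ → refl) (λ _ → refl)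
                   ; to-from = mk≐ (λ _ → refl) (λ _ → refl) }
    ; left-comm = discrete-≐ (λ _ → refl) ; right-comm = discrete-≐ (λ _ → refl) }

  from-left : ∀ {m n} {f g : Cospan S m n} (p : f ≈ᶜ g) →
              ∀ x → vmap (from p) (vmap (left g) x) ≡ vmap (left f) x
  from-left p x = trans (cong (vmap (from p)) (sym (V≐ (left-comm p) x))) (V≐ (from-to p) _)

  from-right : ∀ {m n} {f g : Cospan S m n} (p : f ≈ᶜ g) →
               ∀ x → vmap (from p) (vmap (right g) x) ≡ vmap (right f) x
  from-right p x = trans (cong (vmap (from p)) (sym (V≐ (right-comm p) x))) (V≐ (from-to p) _)

  ≈ᶜ-sym : ∀ {m n} {f g : Cospan S m n} → f ≈ᶜ g → g ≈ᶜ f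
  ≈ᶜ-sym p = record
    { iso = record { to = from p ; from = to p ; from-to = to-from p ; to-from = from-to p }
    ; left-comm = discrete-≐ (from-left p) ; right-comm = discrete-≐ (from-right p) }

  ≈ᶜ-trans : ∀ {m n} {f g h : Cospan S m n} → f ≈ᶜ g → g ≈ᶜ h → f ≈ᶜ h
  ≈ᶜ-trans p q = record
    { iso = record
      { to = to q ∘ₕ to p ; from = from p ∘ₕ from q
      ; from-to = mk≐ (λ v → trans (cong (vmap (from p)) (V≐ (from-to q) _)) (V≐ (from-to p) v))
                      (λ e → trans (cong (emap (from p)) (E≐ (from-to q) _)) (E≐ (from-to p) e))
      ; to-from = mk≐ (λ v → trans (cong (vmap (to q)) (V≐ (to-from p) _)) (V≐ (to-from q) v))
                      (λ e → trans (cong (emap (to q)) (E≐ (to-from p) _)) (E≐ (to-from q) e)) }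
    ; left-comm  = discrete-≐ (λ x → trans (cong (vmap (to q)) (V≐ (left-comm p) x)) (V≐ (left-comm q) x))
    ; right-comm = discrete-≐ (λ x → trans (cong (vmap (to q)) (V≐ (right-comm p) x)) (V≐ (right-comm q) x)) }

  ≈ᶜ-legs : ∀ {m n F} {l l′ : HypHom (discrete S m) F} {r r′ : HypHom (discrete S n) F} →
            (∀ x → vmap l x ≡ vmap l′ x) → (∀ x → vmap r x ≡ vmap r′ x) →
            record { apex = F ; left = l ; right = r } ≈ᶜ record { apex = F ; left = l′ ; right = r′ }
  ≈ᶜ-legs p q = record
    { iso = record { to = idₕ ; from = idₕ ; from-to = mk≐ (λ _ → refl) (λ _ → refl)
                   ; to-from = mk≐ (λ _ → refl) (λ _ → refl) }
    ; left-comm = discrete-≐ p ; right-comm = discrete-≐ q }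

  -- Any pushout of the inner legs, not only the chosen one, exhibits h as a
  -- composite of f and g; see composite-≈.
  record Composite {m n p} (f : Cospan S m n) (g : Cospan S n p) (h : Cospan S m p)
         : Set (lsuc 0ℓ ⊔ c) where
    field
      i : HypHom (apex f) (apex h)
      j : HypHom (apex g) (apex h)
      isPushout : IsPushout (right f) (left g) i j
      left-eq   : ∀ x → vmap i (vmap (left f) x) ≡ vmap (left h) x
      right-eq  : ∀ x → vmap j (vmap (right g) x) ≡ vmap (right h) x

  composite-≈ : ∀ {m n p} {f : Cospan S m n} {g : Cospan S n p} {h : Cospan S m p} →
                Composite f g h → f ⨾ᶜ g ≈ᶜ h
  composite-≈ {f = f} {g} {h} comp = record
    { iso = record
      { to = t ; from = s
      ; from-to = Q.unique (s ∘ₕ t) idₕ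
          (mk≐ (λ v → trans (cong (vmap s) (V≐ t₁ v)) (V≐ s₁ v))
               (λ e → trans (cong (emap s) (E≐ t₁ e)) (E≐ s₁ e)))
          (mk≐ (λ v → trans (cong (vmap s) (V≐ t₂ v)) (V≐ s₂ v))
               (λ e → trans (cong (emap s) (E≐ t₂ e)) (E≐ s₂ e)))
      ; to-from = R.unique (t ∘ₕ s) idₕ
          (mk≐ (λ v → trans (cong (vmap t) (V≐ s₁ v)) (V≐ t₁ v))
               (λ e → trans (cong (emap t) (E≐ s₁ e)) (E≐ t₁ e)))
          (mk≐ (λ v → trans (cong (vmap t) (V≐ s₂ v)) (V≐ t₂ v))
               (λ e → trans (cong (emap t) (E≐ s₂ e)) (E≐ t₂ e)))
      }
    ; left-comm  = discrete-≐ (λ x → trans (V≐ t₁ _) (left-eq x))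
    ; right-comm = discrete-≐ (λ x → trans (V≐ t₂ _) (right-eq x))
    }
    where
    open Composite comp
    module P = Pushout (right f) (left g)
    module Q = IsPushout P.isPushout
    module R = IsPushout isPushout
    t  = Q.universal i j R.commute
    t₁ = Q.universal₁ i j R.commute
    t₂ = Q.universal₂ i j R.commute
    s  = R.universal P.i₁ P.i₂ Q.commute
    s₁ = R.universal₁ P.i₁ P.i₂ Q.commute
    s₂ = R.universal₂ P.i₁ P.i₂ Q.commute

  ⨾ᶜ-cong : ∀ {m n p} {f f′ : Cospan S m n} {g g′ : Cospan S n p} →
            f ≈ᶜ f′ → g ≈ᶜ g′ → f ⨾ᶜ g ≈ᶜ f′ ⨾ᶜ g′
  ⨾ᶜ-cong {f = f} {f′} {g} {g′} a b = composite-≈ record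
    { i = P.i₁ ∘ₕ to a
    ; j = P.i₂ ∘ₕ to b
    ; isPushout = record
      { commute = discrete-≐ (λ x → trans (cong (vmap P.i₁) (V≐ (right-comm a) x))
                    (trans (V≐ Q.commute x) (cong (vmap P.i₂) (sym (V≐ (left-comm b) x)))))
      ; universal  = λ h k p → Q.universal (h ∘ₕ from a) (k ∘ₕ from b) (eq h k p)
      ; universal₁ = λ h k p → let q = Q.universal₁ (h ∘ₕ from a) (k ∘ₕ from b) (eq h k p) in
          mk≐ (λ v → trans (V≐ q _) (cong (vmap h) (V≐ (from-to a) v)))
              (λ e → trans (E≐ q _) (cong (emap h) (E≐ (from-to a) e)))
      ; universal₂ = λ h k p → let q = Q.universal₂ (h ∘ₕ from a) (k ∘ₕ from b) (eq h k p) in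
          mk≐ (λ v → trans (V≐ q _) (cong (vmap k) (V≐ (from-to b) v)))
              (λ e → trans (E≐ q _) (cong (emap k) (E≐ (from-to b) e)))
      ; unique = λ u v p q → Q.unique u v
          (mk≐ (λ y → trans (cong (vmap u ∘ vmap P.i₁) (sym (V≐ (to-from a) y)))
                 (trans (V≐ p _) (cong (vmap v ∘ vmap P.i₁) (V≐ (to-from a) y))))
               (λ y → trans (cong (λ z → emap u (emap P.i₁ z)) (sym (E≐ (to-from a) y)))
                 (trans (E≐ p _) (cong (λ z → emap v (emap P.i₁ z)) (E≐ (to-from a) y)))))
          (mk≐ (λ y → trans (cong (vmap u ∘ vmap P.i₂) (sym (V≐ (to-from b) y)))
                 (trans (V≐ q _) (cong (vmap v ∘ vmap P.i₂) (V≐ (to-from b) y))))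
               (λ y → trans (cong (λ z → emap u (emap P.i₂ z)) (sym (E≐ (to-from b) y)))
                 (trans (E≐ q _) (cong (λ z → emap v (emap P.i₂ z)) (E≐ (to-from b) y)))))
      }
    ; left-eq  = λ x → cong (vmap P.i₁) (V≐ (left-comm a) x)
    ; right-eq = λ x → cong (vmap P.i₂) (V≐ (right-comm b) x)
    }
    where
    module P = Pushout (right f′) (left g′)
    module Q = IsPushout P.isPushout
    eq : ∀ {X} (h : HypHom (apex f) X) (k : HypHom (apex g) X) → h ∘ₕ right f ≐ k ∘ₕ left g →
         (h ∘ₕ from a) ∘ₕ right f′ ≐ (k ∘ₕ from b) ∘ₕ left g′
    eq h k p = discrete-≐ (λ x → trans (cong (vmap h) (from-right a x))
                 (trans (V≐ p x) (cong (vmap k) (sym (from-left b x)))))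

  ⨾ᶜ-assoc : ∀ {m n p q} (f : Cospan S m n) (g : Cospan S n p) (h : Cospan S p q) →
             (f ⨾ᶜ g) ⨾ᶜ h ≈ᶜ f ⨾ᶜ (g ⨾ᶜ h)
  ⨾ᶜ-assoc f g h = composite-≈ record
    { i = i
    ; j = j
    ; isPushout = record
      { commute = discrete-≐ (λ x → trans (V≐ β₂ _) (cong (vmap FGH.i₂) (V≐ GHᵤ.commute x)))
      ; universal  = U
      ; universal₁ = λ u w p → FGᵤ.unique (U u w p ∘ₕ i) u
          (mk≐ (λ v → trans (cong (vmap (U u w p)) (V≐ β₁ v)) (V≐ (U₁ u w p) v))
               (λ e → trans (cong (emap (U u w p)) (E≐ β₁ e)) (E≐ (U₁ u w p) e)))
          (mk≐ (λ v → trans (cong (vmap (U u w p)) (V≐ β₂ v))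
                        (trans (V≐ (U₂ u w p) _) (V≐ (W₁ u w p) v)))
               (λ e → trans (cong (emap (U u w p)) (E≐ β₂ e))
                        (trans (E≐ (U₂ u w p) (emap GH.i₁ e)) (E≐ (W₁ u w p) e))))
      ; universal₂ = λ u w p →
          mk≐ (λ v → trans (V≐ (U₂ u w p) _) (V≐ (W₂ u w p) v))
              (λ e → trans (E≐ (U₂ u w p) (emap GH.i₂ e)) (E≐ (W₂ u w p) e))
      ; unique = λ u v p q → FGHᵤ.unique u v
          (mk≐ (λ x → trans (cong (vmap u) (sym (V≐ β₁ x)))
                        (trans (V≐ p (vmap FG.i₁ x)) (cong (vmap v) (V≐ β₁ x))))
               (λ x → trans (cong (emap u) (sym (E≐ β₁ x)))
                        (trans (E≐ p (emap FG.i₁ x)) (cong (emap v) (E≐ β₁ x)))))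
          (GHᵤ.unique (u ∘ₕ FGH.i₂) (v ∘ₕ FGH.i₂)
            (mk≐ (λ x → trans (cong (vmap u) (sym (V≐ β₂ x)))
                          (trans (V≐ p (vmap FG.i₂ x)) (cong (vmap v) (V≐ β₂ x))))
                 (λ x → trans (cong (emap u) (sym (E≐ β₂ x)))
                          (trans (E≐ p (emap FG.i₂ x)) (cong (emap v) (E≐ β₂ x)))))
            (mk≐ (λ x → V≐ q x) (λ x → E≐ q x)))
      }
    ; left-eq  = λ x → V≐ β₁ _
    ; right-eq = λ x → refl
    }
    where
    module FG = Pushout (right f) (left g)
    module FGᵤ = IsPushout FG.isPushout
    module GH = Pushout (right g) (left h)
    module GHᵤ = IsPushout GH.isPushout
    module FGH = Pushout (right f) (left (g ⨾ᶜ h))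
    module FGHᵤ = IsPushout FGH.isPushout
    com : FGH.i₁ ∘ₕ right f ≐ (FGH.i₂ ∘ₕ GH.i₁) ∘ₕ left g
    com = discrete-≐ (V≐ FGHᵤ.commute)
    i : HypHom (apex (f ⨾ᶜ g)) (apex (f ⨾ᶜ (g ⨾ᶜ h)))
    i  = FGᵤ.universal FGH.i₁ (FGH.i₂ ∘ₕ GH.i₁) com
    j : HypHom (apex h) (apex (f ⨾ᶜ (g ⨾ᶜ h)))
    j  = FGH.i₂ ∘ₕ GH.i₂
    β₁ = FGᵤ.universal₁ FGH.i₁ (FGH.i₂ ∘ₕ GH.i₁) com
    β₂ = FGᵤ.universal₂ FGH.i₁ (FGH.i₂ ∘ₕ GH.i₁) com
    module _ {X} (u : HypHom (apex (f ⨾ᶜ g)) X) (w : HypHom (apex h) X)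
             (p : u ∘ₕ right (f ⨾ᶜ g) ≐ w ∘ₕ left h) where
      p′ : (u ∘ₕ FG.i₂) ∘ₕ right g ≐ w ∘ₕ left h
      p′ = discrete-≐ (V≐ p)
      W  = GHᵤ.universal (u ∘ₕ FG.i₂) w p′
      W₁ = GHᵤ.universal₁ (u ∘ₕ FG.i₂) w p′
      W₂ = GHᵤ.universal₂ (u ∘ₕ FG.i₂) w p′
      p″ : (u ∘ₕ FG.i₁) ∘ₕ right f ≐ W ∘ₕ left (g ⨾ᶜ h)
      p″ = discrete-≐ (λ x → trans (cong (vmap u) (V≐ FGᵤ.commute x)) (sym (V≐ W₁ _)))
      U  = FGHᵤ.universal (u ∘ₕ FG.i₁) W p″
      U₁ = FGHᵤ.universal₁ (u ∘ₕ FG.i₁) W p″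
      U₂ = FGHᵤ.universal₂ (u ∘ₕ FG.i₁) W p″

  ⨾-wire : ∀ {m n p} (f : Cospan S m n) (ρ : Fin p → Fin n) →
           f ⨾ᶜ wire ρ ≈ᶜ record { apex = apex f ; left = left f ; right = right f ∘ₕ fromDiscrete ρ }
  ⨾-wire f ρ = composite-≈ {f = f} {wire ρ} record
    { i = idₕ ; j = right f
    ; isPushout = record
      { commute    = discrete-≐ (λ _ → refl)
      ; universal  = λ h _ _ → h
      ; universal₁ = λ _ _ _ → mk≐ (λ _ → refl) (λ _ → refl)
      ; universal₂ = λ _ _ p → discrete-≐ (V≐ p)
      ; unique     = λ _ _ p _ → mk≐ (V≐ p) (E≐ p) }
    ; left-eq = λ _ → refl ; right-eq = λ _ → refl }

  wire-⨾ : ∀ {m n p} (ρ : Fin n → Fin m) (ρ⁻¹ : Fin m → Fin n) →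
           (∀ x → ρ (ρ⁻¹ x) ≡ x) → (∀ x → ρ⁻¹ (ρ x) ≡ x) → (f : Cospan S n p) →
           wire ρ ⨾ᶜ f ≈ᶜ record { apex = apex f ; left = left f ∘ₕ fromDiscrete ρ⁻¹ ; right = right f }
  wire-⨾ ρ ρ⁻¹ ρρ⁻¹ ρ⁻¹ρ f = composite-≈ {f = wire ρ} {f} record
    { i = left f ∘ₕ fromDiscrete ρ⁻¹ ; j = idₕ
    ; isPushout = record
      { commute    = discrete-≐ (λ x → cong (vmap (left f)) (ρ⁻¹ρ x))
      ; universal  = λ _ k _ → k
      ; universal₁ = λ h _ p → discrete-≐ (λ x → trans (sym (V≐ p _)) (cong (vmap h) (ρρ⁻¹ x)))
      ; universal₂ = λ _ _ _ → mk≐ (λ _ → refl) (λ _ → refl)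
      ; unique     = λ _ _ _ q → mk≐ (V≐ q) (E≐ q) }
    ; left-eq = λ _ → refl ; right-eq = λ _ → refl }

  subst-≈ : ∀ {m m′ n n′} (p : m ≡ m′) (q : n ≡ n′) (f : Cospan S m n) →
            subst₂ (Cospan S) p q f
              ≈ᶜ record { apex = apex f ; left = left f ∘ₕ fromDiscrete (cast (sym p))
                        ; right = right f ∘ₕ fromDiscrete (cast (sym q)) }
  subst-≈ refl refl f = ≈ᶜ-legs (λ x → cong (vmap (left f)) (sym (cast-id refl x)))
                                (λ x → cong (vmap (right f)) (sym (cast-id refl x)))

  subst-cong : ∀ {m m′ n n′} (p : m ≡ m′) (q : n ≡ n′) {f g : Cospan S m n} →
               f ≈ᶜ g → subst₂ (Cospan S) p q f ≈ᶜ subst₂ (Cospan S) p q g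
  subst-cong refl refl f≈g = f≈g

  _⊕₁_ : ∀ {F F′ G G′ : LabelledHypergraph S} →
         HypHom F F′ → HypHom G G′ → HypHom (F ⊕ G) (F′ ⊕ G′)
  u ⊕₁ v = [ ι₁ ∘ₕ u , ι₂ ∘ₕ v ]ₕ

  ⊗ᶜ-cong : ∀ {m n p q} {f f′ : Cospan S m n} {g g′ : Cospan S p q} →
            f ≈ᶜ f′ → g ≈ᶜ g′ → f ⊗ᶜ g ≈ᶜ f′ ⊗ᶜ g′
  ⊗ᶜ-cong {m} {n} a b = record
    { iso = record
      { to = to a ⊕₁ to b ; from = from a ⊕₁ from b
      ; from-to = mk≐ (λ { (inj₁ v) → cong inj₁ (V≐ (from-to a) v) ; (inj₂ v) → cong inj₂ (V≐ (from-to b) v) })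
                      (λ { (inj₁ e) → cong inj₁ (E≐ (from-to a) e) ; (inj₂ e) → cong inj₂ (E≐ (from-to b) e) })
      ; to-from = mk≐ (λ { (inj₁ v) → cong inj₁ (V≐ (to-from a) v) ; (inj₂ v) → cong inj₂ (V≐ (to-from b) v) })
                      (λ { (inj₁ e) → cong inj₁ (E≐ (to-from a) e) ; (inj₂ e) → cong inj₂ (E≐ (to-from b) e) }) }
    ; left-comm  = discrete-≐ (λ x → legs (vmap (to a)) (vmap (to b)) (V≐ (left-comm a)) (V≐ (left-comm b)) (splitAt m x))
    ; right-comm = discrete-≐ (λ x → legs (vmap (to a)) (vmap (to b)) (V≐ (right-comm a)) (V≐ (right-comm b)) (splitAt n x))
    }
    where
    legs : ∀ {x y} {A A′ B B′ : Set} {l : Fin x → A} {l′ : Fin x → A′} {r : Fin y → B} {r′ : Fin y → B′}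
           (u : A → A′) (v : B → B′) → (∀ i → u (l i) ≡ l′ i) → (∀ j → v (r j) ≡ r′ j) →
           ∀ s → [ inj₁ ∘ u , inj₂ ∘ v ]′ ([ inj₁ ∘ l , inj₂ ∘ r ]′ s) ≡ [ inj₁ ∘ l′ , inj₂ ∘ r′ ]′ s
    legs u v p q (inj₁ i) = cong inj₁ (p i)
    legs u v p q (inj₂ j) = cong inj₂ (q j)

  ⊗ᶜ-⨾ : ∀ {m n p m′ n′ p′} (f : Cospan S m n) (g : Cospan S n p)
         (f′ : Cospan S m′ n′) (g′ : Cospan S n′ p′) →
         (f ⨾ᶜ g) ⊗ᶜ (f′ ⨾ᶜ g′) ≈ᶜ (f ⊗ᶜ f′) ⨾ᶜ (g ⊗ᶜ g′)
  ⊗ᶜ-⨾ {m} {n} {p} f g f′ g′ = ≈ᶜ-sym (composite-≈ record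
    { i = P.i₁ ⊕₁ P′.i₁
    ; j = P.i₂ ⊕₁ P′.i₂
    ; isPushout = record
      { commute = discrete-≐ (λ x → com (splitAt n x))
      ; universal = λ h k q → [ Q.universal (h ∘ₕ ι₁) (k ∘ₕ ι₁) (com₁ h k q)
                             , Q′.universal (h ∘ₕ ι₂) (k ∘ₕ ι₂) (com₂ h k q) ]ₕ
      ; universal₁ = λ h k q →
          let a = Q.universal₁ (h ∘ₕ ι₁) (k ∘ₕ ι₁) (com₁ h k q)
              b = Q′.universal₁ (h ∘ₕ ι₂) (k ∘ₕ ι₂) (com₂ h k q) in
          mk≐ (λ { (inj₁ v) → V≐ a v ; (inj₂ v) → V≐ b v }) (λ { (inj₁ e) → E≐ a e ; (inj₂ e) → E≐ b e })
      ; universal₂ = λ h k q →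
          let a = Q.universal₂ (h ∘ₕ ι₁) (k ∘ₕ ι₁) (com₁ h k q)
              b = Q′.universal₂ (h ∘ₕ ι₂) (k ∘ₕ ι₂) (com₂ h k q) in
          mk≐ (λ { (inj₁ v) → V≐ a v ; (inj₂ v) → V≐ b v }) (λ { (inj₁ e) → E≐ a e ; (inj₂ e) → E≐ b e })
      ; unique = λ u v a b → ⊕-epi u v
          (Q.unique (u ∘ₕ ι₁) (v ∘ₕ ι₁)
            (mk≐ (λ x → V≐ a (inj₁ x)) (λ x → E≐ a (inj₁ x)))
            (mk≐ (λ x → V≐ b (inj₁ x)) (λ x → E≐ b (inj₁ x))))
          (Q′.unique (u ∘ₕ ι₂) (v ∘ₕ ι₂)
            (mk≐ (λ x → V≐ a (inj₂ x)) (λ x → E≐ a (inj₂ x)))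
            (mk≐ (λ x → V≐ b (inj₂ x)) (λ x → E≐ b (inj₂ x))))
      }
    ; left-eq  = λ x → leg (vmap (left f)) (vmap (left f′)) (vmap P.i₁) (vmap P′.i₁) (splitAt m x)
    ; right-eq = λ x → leg (vmap (right g)) (vmap (right g′)) (vmap P.i₂) (vmap P′.i₂) (splitAt p x)
    })
    where
    module P  = Pushout (right f) (left g)
    module P′ = Pushout (right f′) (left g′)
    module Q  = IsPushout P.isPushout
    module Q′ = IsPushout P′.isPushout
    com : ∀ s → [ inj₁ ∘ vmap P.i₁ , inj₂ ∘ vmap P′.i₁ ]′
                  ([ inj₁ ∘ vmap (right f) , inj₂ ∘ vmap (right f′) ]′ s)
              ≡ [ inj₁ ∘ vmap P.i₂ , inj₂ ∘ vmap P′.i₂ ]′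
                  ([ inj₁ ∘ vmap (left g) , inj₂ ∘ vmap (left g′) ]′ s)
    com (inj₁ x) = cong inj₁ (V≐ Q.commute x)
    com (inj₂ x) = cong inj₂ (V≐ Q′.commute x)
    module _ {X} (h : HypHom (apex (f ⊗ᶜ f′)) X) (k : HypHom (apex (g ⊗ᶜ g′)) X)
             (q : h ∘ₕ right (f ⊗ᶜ f′) ≐ k ∘ₕ left (g ⊗ᶜ g′)) where
      com₁ : (h ∘ₕ ι₁) ∘ₕ right f ≐ (k ∘ₕ ι₁) ∘ₕ left g
      com₁ = discrete-≐ (λ x → trans (cong (vmap h) (sym (⊞-ˡ (vmap (right f)) (vmap (right f′)) x)))
               (trans (V≐ q (x ↑ˡ _)) (cong (vmap k) (⊞-ˡ (vmap (left g)) (vmap (left g′)) x))))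
      com₂ : (h ∘ₕ ι₂) ∘ₕ right f′ ≐ (k ∘ₕ ι₂) ∘ₕ left g′
      com₂ = discrete-≐ (λ x → trans (cong (vmap h) (sym (⊞-ʳ (vmap (right f)) (vmap (right f′)) x)))
               (trans (V≐ q (n ↑ʳ x)) (cong (vmap k) (⊞-ʳ (vmap (left g)) (vmap (left g′)) x))))
    leg : ∀ {x y} {A A′ B B′ : Set} (l : Fin x → A) (r : Fin y → B) (u : A → A′) (v : B → B′) →
          ∀ s → [ inj₁ ∘ u , inj₂ ∘ v ]′ ([ inj₁ ∘ l , inj₂ ∘ r ]′ s) ≡ [ inj₁ ∘ u ∘ l , inj₂ ∘ v ∘ r ]′ s
    leg l r u v (inj₁ _) = refl
    leg l r u v (inj₂ _) = refl

  ⊗ᶜ-identityˡ : ∀ {m n} (f : Cospan S m n) → idᶜ {0} ⊗ᶜ f ≈ᶜ f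
  ⊗ᶜ-identityˡ f = record
    { iso = record
      { to = [ fromDiscrete (λ ()) , idₕ ]ₕ ; from = ι₂
      ; from-to = mk≐ (λ { (inj₂ _) → refl }) (λ { (inj₂ _) → refl })
      ; to-from = mk≐ (λ _ → refl) (λ _ → refl) }
    ; left-comm = discrete-≐ (λ _ → refl) ; right-comm = discrete-≐ (λ _ → refl) }

  ⊗ᶜ-identityʳ : ∀ {m n} (f : Cospan S m n) →
                 subst₂ (Cospan S) (+-identityʳ m) (+-identityʳ n) (f ⊗ᶜ idᶜ {0}) ≈ᶜ f
  ⊗ᶜ-identityʳ f = ≈ᶜ-trans (subst-≈ _ _ (f ⊗ᶜ idᶜ)) record
    { iso = record
      { to = u ; from = ι₁
      ; from-to = mk≐ (λ { (inj₁ _) → refl }) (λ { (inj₁ _) → refl })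
      ; to-from = mk≐ (λ _ → refl) (λ _ → refl) }
    ; left-comm  = discrete-≐ (leg (left f))
    ; right-comm = discrete-≐ (leg (right f)) }
    where
    u : HypHom (apex f ⊕ discrete S 0) (apex f)
    u = [ idₕ , fromDiscrete (λ ()) ]ₕ
    leg : ∀ {k} (l : HypHom (discrete S k) (apex f)) x →
          vmap u ((vmap l ⊞ (λ y → y)) (cast (sym (+-identityʳ k)) x)) ≡ vmap l x
    leg {k} l x = cong (vmap u) (trans (cong (vmap l ⊞ (λ y → y)) lem) (⊞-ˡ (vmap l) (λ y → y) x))
      where
      lem : cast (sym (+-identityʳ k)) x ≡ x ↑ˡ 0
      lem = toℕ-injective (trans (toℕ-cast _ x) (sym (toℕ-↑ˡ x 0)))

  ⊗ᶜ-assoc : ∀ {m n p m′ n′ p′} (f : Cospan S m m′) (g : Cospan S n n′) (h : Cospan S p p′) →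
             subst₂ (Cospan S) (+-assoc m n p) (+-assoc m′ n′ p′) ((f ⊗ᶜ g) ⊗ᶜ h)
               ≈ᶜ f ⊗ᶜ (g ⊗ᶜ h)
  ⊗ᶜ-assoc f g h = ≈ᶜ-trans (subst-≈ _ _ ((f ⊗ᶜ g) ⊗ᶜ h)) record
    { iso = record
      { to = u
      ; from = [ ι₁ ∘ₕ ι₁ , [ ι₁ ∘ₕ ι₂ , ι₂ ]ₕ ]ₕ
      ; from-to = mk≐ (λ { (inj₁ (inj₁ _)) → refl ; (inj₁ (inj₂ _)) → refl ; (inj₂ _) → refl })
                      (λ { (inj₁ (inj₁ _)) → refl ; (inj₁ (inj₂ _)) → refl ; (inj₂ _) → refl })
      ; to-from = mk≐ (λ { (inj₁ _) → refl ; (inj₂ (inj₁ _)) → refl ; (inj₂ (inj₂ _)) → refl })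
                      (λ { (inj₁ _) → refl ; (inj₂ (inj₁ _)) → refl ; (inj₂ (inj₂ _)) → refl }) }
    ; left-comm  = discrete-≐ (leg (left f) (left g) (left h))
    ; right-comm = discrete-≐ (leg (right f) (right g) (right h)) }
    where
    u : HypHom ((apex f ⊕ apex g) ⊕ apex h) (apex f ⊕ (apex g ⊕ apex h))
    u = [ [ ι₁ , ι₂ ∘ₕ ι₁ ]ₕ , ι₂ ∘ₕ ι₂ ]ₕ
    leg : ∀ {x y z} (a : HypHom (discrete S x) (apex f)) (b : HypHom (discrete S y) (apex g))
          (d : HypHom (discrete S z) (apex h)) w →
          vmap u (((vmap a ⊞ vmap b) ⊞ vmap d) (cast (sym (+-assoc x y z)) w))
            ≡ (vmap a ⊞ (vmap b ⊞ vmap d)) w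
    leg {x} {y} {z} a b d = split-ind x _
      (λ i → trans (cong (vmap u) (trans (cong L (cast-₁ {x} {y} {z} eq i))
               (trans (⊞-ˡ AB D (i ↑ˡ y)) (cong inj₁ (⊞-ˡ A B i))))) (sym (⊞-ˡ A BD i)))
      (split-ind y _
        (λ j → trans (cong (vmap u) (trans (cong L (cast-₂ {x} {y} {z} eq j))
                 (trans (⊞-ˡ AB D (x ↑ʳ j)) (cong inj₁ (⊞-ʳ A B j)))))
               (sym (trans (⊞-ʳ A BD (j ↑ˡ z)) (cong inj₂ (⊞-ˡ B D j)))))
        (λ k → trans (cong (vmap u) (trans (cong L (cast-₃ {x} {y} {z} eq k)) (⊞-ʳ AB D k)))
               (sym (trans (⊞-ʳ A BD (y ↑ʳ k)) (cong inj₂ (⊞-ʳ B D k))))))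
      where
      A  = vmap a
      B  = vmap b
      D  = vmap d
      AB = A ⊞ B
      BD = B ⊞ D
      L  = AB ⊞ D
      eq = sym (+-assoc x y z)

  σᶜ-natural : ∀ {m n m′ n′} (f : Cospan S m m′) (g : Cospan S n n′) →
               (f ⊗ᶜ g) ⨾ᶜ σᶜ m′ n′ ≈ᶜ σᶜ m n ⨾ᶜ (g ⊗ᶜ f)
  σᶜ-natural {m} {n} {m′} {n′} f g =
    ≈ᶜ-trans (⨾-wire (f ⊗ᶜ g) _)
      (≈ᶜ-trans mid (≈ᶜ-sym (wire-⨾ (swapFin n m) (swapFin m n) (swap-swap m n) (swap-swap n m) (g ⊗ᶜ f))))
    where
    mid : record { apex = apex (f ⊗ᶜ g) ; left = left (f ⊗ᶜ g)
                 ; right = right (f ⊗ᶜ g) ∘ₕ fromDiscrete (swapFin n′ m′) }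
          ≈ᶜ record { apex = apex (g ⊗ᶜ f) ; left = left (g ⊗ᶜ f) ∘ₕ fromDiscrete (swapFin m n)
                    ; right = right (g ⊗ᶜ f) }
    mid = record
      { iso = record
        { to = [ ι₂ , ι₁ ]ₕ ; from = [ ι₂ , ι₁ ]ₕ
        ; from-to = mk≐ (λ { (inj₁ _) → refl ; (inj₂ _) → refl }) (λ { (inj₁ _) → refl ; (inj₂ _) → refl })
        ; to-from = mk≐ (λ { (inj₁ _) → refl ; (inj₂ _) → refl }) (λ { (inj₁ _) → refl ; (inj₂ _) → refl }) }
      ; left-comm = discrete-≐ (split-ind m _
          (λ i → trans (cong swap′ (⊞-ˡ lf lg i))
                       (sym (trans (cong (lg ⊞ lf) (swap-ˡ m n i)) (⊞-ʳ lg lf i))))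
          (λ j → trans (cong swap′ (⊞-ʳ lf lg j))
                       (sym (trans (cong (lg ⊞ lf) (swap-ʳ m n j)) (⊞-ˡ lg lf j)))))
      ; right-comm = discrete-≐ (split-ind n′ _
          (λ i → trans (cong swap′ (trans (cong (rf ⊞ rg) (swap-ˡ n′ m′ i)) (⊞-ʳ rf rg i)))
                       (sym (⊞-ˡ rg rf i)))
          (λ j → trans (cong swap′ (trans (cong (rf ⊞ rg) (swap-ʳ n′ m′ j)) (⊞-ˡ rf rg j)))
                       (sym (⊞-ʳ rg rf j))))
      }
      where
      swap′ : V (apex f) ⊎ V (apex g) → V (apex g) ⊎ V (apex f)
      swap′ = [ inj₂ , inj₁ ]′
      lf = vmap (left f)
      lg = vmap (left g)
      rf = vmap (right f)
      rg = vmap (right g)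

  wire-cong : ∀ {m n} {ρ ρ′ : Fin n → Fin m} → ρ ≗ ρ′ → wire ρ ≈ᶜ wire ρ′
  wire-cong p = ≈ᶜ-legs (λ _ → refl) p

  wire-∘ : ∀ {m n p} (ρ : Fin n → Fin m) (τ : Fin p → Fin n) → wire ρ ⨾ᶜ wire τ ≈ᶜ wire (ρ ∘ τ)
  wire-∘ ρ τ = ≈ᶜ-trans (⨾-wire (wire ρ) τ) (≈ᶜ-legs (λ _ → refl) (λ _ → refl))

  σᶜ-involutive : ∀ m n → σᶜ m n ⨾ᶜ σᶜ n m ≈ᶜ idᶜ
  σᶜ-involutive m n = ≈ᶜ-trans (wire-∘ (swapFin n m) (swapFin m n)) (wire-cong (swap-swap m n))

  _⊗ᶠ_ : ∀ {m n p q} → (Fin n → Fin m) → (Fin q → Fin p) → Fin (n + q) → Fin (m + p)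
  _⊗ᶠ_ {m} {p = p} ρ τ = join m p ∘ (ρ ⊞ τ)

  wire-⊗ : ∀ {m n p q} (ρ : Fin n → Fin m) (τ : Fin q → Fin p) → wire ρ ⊗ᶜ wire τ ≈ᶜ wire (ρ ⊗ᶠ τ)
  wire-⊗ {m} {n} {p} {q} ρ τ = record
    { iso = record
      { to = [ fromDiscrete (_↑ˡ p) , fromDiscrete (m ↑ʳ_) ]ₕ
      ; from = fromDiscrete (splitAt m)
      ; from-to = mk≐ (λ v → trans (cong (splitAt m) (joinₕ v)) (splitAt-join m p v))
                      (λ { (inj₁ ()) ; (inj₂ ()) })
      ; to-from = discrete-≐ (λ x → trans (joinₕ (splitAt m x)) (join-splitAt m p x)) }
    ; left-comm  = discrete-≐ (λ x → trans (joinₕ ((idf ⊞ idf) x)) (trans (cong (join m p) (η (splitAt m x))) (join-splitAt m p x)))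
    ; right-comm = discrete-≐ (λ x → joinₕ ((ρ ⊞ τ) x)) }
    where
    idf : ∀ {k} → Fin k → Fin k
    idf x = x
    joinₕ : ∀ v → [ _↑ˡ p , m ↑ʳ_ ]′ v ≡ join m p v
    joinₕ (inj₁ _) = refl
    joinₕ (inj₂ _) = refl
    η : ∀ (s : Fin m ⊎ Fin p) → [ inj₁ , inj₂ ]′ s ≡ s
    η (inj₁ _) = refl
    η (inj₂ _) = refl

  ⊗ᶠ-ˡ : ∀ {m n p q} (ρ : Fin n → Fin m) (τ : Fin q → Fin p) i → (ρ ⊗ᶠ τ) (i ↑ˡ q) ≡ ρ i ↑ˡ p
  ⊗ᶠ-ˡ {m} {p = p} ρ τ i = cong (join m p) (⊞-ˡ ρ τ i)

  ⊗ᶠ-ʳ : ∀ {m n p q} (ρ : Fin n → Fin m) (τ : Fin q → Fin p) j → (ρ ⊗ᶠ τ) (n ↑ʳ j) ≡ m ↑ʳ τ j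
  ⊗ᶠ-ʳ {m} {p = p} ρ τ j = cong (join m p) (⊞-ʳ ρ τ j)

  ⊗ᶜ-id : ∀ {m n} → idᶜ {m} ⊗ᶜ idᶜ {n} ≈ᶜ idᶜ
  ⊗ᶜ-id {m} {n} = ≈ᶜ-trans (wire-⊗ idf idf) (wire-cong
    (split-ind m _ (⊗ᶠ-ˡ {m} {m} {n} {n} idf idf) (⊗ᶠ-ʳ {m} {m} {n} {n} idf idf)))
    where
    idf : ∀ {k} → Fin k → Fin k
    idf x = x

  subst-wire : ∀ {m m′ n n′} (p : m ≡ m′) (q : n ≡ n′) (ρ : Fin n → Fin m) →
               subst₂ (Cospan S) p q (wire ρ) ≈ᶜ wire (cast p ∘ ρ ∘ cast (sym q))
  subst-wire refl refl ρ = wire-cong (λ x →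
    sym (trans (cast-id refl _) (cong ρ (cast-id refl x))))

  σᶜ-hexagon : ∀ m n p →
               σᶜ m (n + p)
                 ≈ᶜ subst₂ (Cospan S) (+-assoc m n p) (+-assoc n m p) (σᶜ m n ⊗ᶜ idᶜ {p})
                    ⨾ᶜ subst₂ (Cospan S) refl (sym (+-assoc n p m)) (idᶜ {n} ⊗ᶜ σᶜ m p)
  σᶜ-hexagon m n p = ≈ᶜ-sym (≈ᶜ-trans
    (⨾ᶜ-cong (≈ᶜ-trans (subst-cong a b (wire-⊗ (swapFin n m) id′)) (subst-wire a b ρ))
             (≈ᶜ-trans (subst-cong refl (sym d) (wire-⊗ id′ (swapFin p m))) (subst-wire refl (sym d) τ)))
    (≈ᶜ-trans (wire-∘ f₁ (cast refl ∘ τ ∘ cast (sym (sym d)))) (wire-cong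
      (split-ind (n + p) _
        (split-ind n _
          (λ i → trans (cong f₃ (cast-inv (sym d) (sym (sym d)) (cast-₁ {n} {p} {m} (sym d) i)))
                 (trans (cong f₂ (⊗ᶠ-ˡ {n} {n} id′ (swapFin p m) i))
                 (trans (cong f₁ (cast-id refl _))
                 (trans (cong (cast a ∘ ρ) (cast-₁ {n} {m} {p} (sym b) i))
                 (trans (cong (cast a) (trans (⊗ᶠ-ˡ {p = p} {p} (swapFin n m) id′ (i ↑ˡ m)) (cong (_↑ˡ p) (swap-ˡ n m i))))
                 (trans (cast-inv (sym a) a (cast-₂ {m} {n} {p} (sym a) i))
                 (sym (swap-ˡ (n + p) m (i ↑ˡ p)))))))))
          (λ j → trans (cong f₃ (cast-inv (sym d) (sym (sym d)) (cast-₂ {n} {p} {m} (sym d) j)))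
                 (trans (cong f₂ (trans (⊗ᶠ-ʳ {n} {n} id′ (swapFin p m) (j ↑ˡ m)) (cong (n ↑ʳ_) (swap-ˡ p m j))))
                 (trans (cong f₁ (cast-id refl _))
                 (trans (cong (cast a ∘ ρ) (cast-₃ {n} {m} {p} (sym b) j))
                 (trans (cong (cast a) (⊗ᶠ-ʳ {p = p} {p} (swapFin n m) id′ j))
                 (trans (cast-inv (sym a) a (cast-₃ {m} {n} {p} (sym a) j))
                 (sym (swap-ˡ (n + p) m (n ↑ʳ j))))))))))
        (λ k → trans (cong f₃ (cast-inv (sym d) (sym (sym d)) (cast-₃ {n} {p} {m} (sym d) k)))
               (trans (cong f₂ (trans (⊗ᶠ-ʳ {n} {n} id′ (swapFin p m) (p ↑ʳ k)) (cong (n ↑ʳ_) (swap-ʳ p m k))))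
               (trans (cong f₁ (cast-id refl _))
               (trans (cong (cast a ∘ ρ) (cast-₂ {n} {m} {p} (sym b) k))
               (trans (cong (cast a) (trans (⊗ᶠ-ˡ {p = p} {p} (swapFin n m) id′ (n ↑ʳ k)) (cong (_↑ˡ p) (swap-ʳ n m k))))
               (trans (cast-inv (sym a) a (cast-₁ {m} {n} {p} (sym a) k))
               (sym (swap-ʳ (n + p) m k))))))))))))
    where
    a = +-assoc m n p
    b = +-assoc n m p
    d = +-assoc n p m
    id′ : ∀ {k} → Fin k → Fin k
    id′ x = x
    ρ : Fin ((n + m) + p) → Fin ((m + n) + p)
    ρ = swapFin n m ⊗ᶠ id′
    τ : Fin (n + (p + m)) → Fin (n + (m + p))
    τ = id′ {n} ⊗ᶠ swapFin p m
    f₁ : Fin (n + (m + p)) → Fin (m + (n + p))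
    f₁ = cast a ∘ ρ ∘ cast (sym b)
    f₂ : Fin (n + (m + p)) → Fin (m + (n + p))
    f₂ = f₁ ∘ cast refl
    f₃ : Fin (n + (p + m)) → Fin (m + (n + p))
    f₃ = f₂ ∘ τ

  Csp : PROP (lsuc 0ℓ ⊔ c) c
  Csp = record
    { Hom = Cospan S ; _≈_ = _≈ᶜ_ ; id = idᶜ ; _⨾_ = _⨾ᶜ_ ; _⊗_ = _⊗ᶜ_ ; σ = σᶜ
    ; ≈-equiv = record { refl = ≈ᶜ-refl ; sym = ≈ᶜ-sym ; trans = ≈ᶜ-trans }
    ; ⨾-cong = ⨾ᶜ-cong
    ; ⨾-assoc = ⨾ᶜ-assoc
    ; ⨾-identityˡ = λ f → ≈ᶜ-trans
        (wire-⨾ (λ x → x) (λ x → x) (λ _ → refl) (λ _ → refl) f)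
        (≈ᶜ-legs (λ _ → refl) (λ _ → refl))
    ; ⨾-identityʳ = λ f → ≈ᶜ-trans (⨾-wire f (λ x → x)) (≈ᶜ-legs (λ _ → refl) (λ _ → refl))
    ; ⊗-cong = ⊗ᶜ-cong
    ; ⊗-id = ⊗ᶜ-id
    ; ⊗-⨾ = ⊗ᶜ-⨾
    ; ⊗-identityˡ = ⊗ᶜ-identityˡ
    ; ⊗-identityʳ = ⊗ᶜ-identityʳ
    ; ⊗-assoc = ⊗ᶜ-assoc
    ; σ-natural = σᶜ-natural
    ; σ-involutive = σᶜ-involutive
    ; σ-hexagon = σᶜ-hexagon
    }

module _ {c} {S : Signature c} where

  open LabelledHypergraph
  open HypHom
  open _≐_
  open Cospan

  SourcePosition : LabelledHypergraph S → Set
  SourcePosition F = Σ[ e ∈ Edge F ] Fin (proj₁ e)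

  TargetPosition : LabelledHypergraph S → Set
  TargetPosition F = Σ[ e ∈ Edge F ] Fin (proj₁ (proj₂ e))

  sourceAt : (F : LabelledHypergraph S) → SourcePosition F → V F
  sourceAt F ((_ , _ , e) , p) = lookup (src F e) p

  targetAt : (F : LabelledHypergraph S) → TargetPosition F → V F
  targetAt F ((_ , _ , e) , p) = lookup (tgt F e) p

  -- The degree is a pair of cardinalities, each expressed by a bijection with Fin.
  HasDegree : (F : LabelledHypergraph S) → V F → ℕ × ℕ → Set
  HasDegree F v (i , o) =
    ((Σ[ t ∈ TargetPosition F ] targetAt F t ≡ v) ↔ Fin i) ×
    ((Σ[ s ∈ SourcePosition F ] sourceAt F s ≡ v) ↔ Fin o)

  InImage : ∀ {F G : LabelledHypergraph S} → HypHom F G → V G → Set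
  InImage {F} f v = ∃[ x ] vmap f x ≡ v

  record PartialLeftMonogamous {m n} (f : Cospan S m n) : Set (lsuc 0ℓ ⊔ c) where
    field
      left-mono  : Mono (left f)
      deg-inputs : ∀ v → InImage (left f) v → ∃[ o ] HasDegree (apex f) v (0 , o)
      deg-others : ∀ v → ¬ InImage (left f) v →
                   ∃[ o ] (HasDegree (apex f) v (0 , o) ⊎ HasDegree (apex f) v (1 , o))

  mono⇒injective : ∀ {n F} (f : HypHom (discrete S n) F) → Mono f →
                   ∀ {x y} → vmap f x ≡ vmap f y → x ≡ y
  mono⇒injective f mono {x} {y} p =
    V≐ (mono {discrete S 1} (fromDiscrete (λ _ → x)) (fromDiscrete (λ _ → y)) (discrete-≐ (λ _ → p))) zero

  injective⇒mono : ∀ {n F} (f : HypHom (discrete S n) F) →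
                   (∀ {x y} → vmap f x ≡ vmap f y → x ≡ y) → Mono f
  injective⇒mono f inj g h p = mk≐ (λ v → inj (V≐ p v)) (λ e → ⊥-elim (emap g e))

  -- An equivalent form of partial left-monogamy, convenient for the closure
  -- properties.
  record PLM {m n} (f : Cospan S m n) : Set where
    field
      left-inj   : ∀ {x y} → vmap (left f) x ≡ vmap (left f) y → x ≡ y
      target-inj : ∀ {s t} → targetAt (apex f) s ≡ targetAt (apex f) t → s ≡ t
      disjoint   : ∀ {t x} → targetAt (apex f) t ≢ vmap (left f) x

  imageDec : ∀ {n F} (f : HypHom (discrete S n) F) v → Dec (InImage f v)
  imageDec {F = F} f v = any? (λ x → Finite-≟ (V-finite F) (vmap f x) v)

  toPLM : ∀ {m n} {f : Cospan S m n} → PartialLeftMonogamous f → PLM f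
  toPLM {f = f} plm = record
    { left-inj   = mono⇒injective (left f) left-mono
    ; target-inj = λ {s} {t} p → tinj s t p (imageDec (left f) (targetAt (apex f) t))
    ; disjoint   = λ {t} {x} p → none (proj₁ (proj₂ (deg-inputs _ (x , refl)))) (t , p)
    }
    where
    open PartialLeftMonogamous plm
    none : ∀ {A : Set} → A ↔ Fin 0 → ¬ A
    none A↔0 a with Inverse.to A↔0 a
    ... | ()
    one : ∀ {A : Set} → A ↔ Fin 1 → (a b : A) → a ≡ b
    one A↔1 a b = trans (sym (strictlyInverseʳ a)) (trans (cong from (eq (to a) (to b))) (strictlyInverseʳ b))
      where
      open Inverse A↔1
      eq : (x y : Fin 1) → x ≡ y
      eq zero zero = refl
    tinj : ∀ s t → targetAt (apex f) s ≡ targetAt (apex f) t →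
           Dec (InImage (left f) (targetAt (apex f) t)) → s ≡ t
    tinj s t p (yes q) = ⊥-elim (none (proj₁ (proj₂ (deg-inputs _ q))) (t , refl))
    tinj s t p (no ¬q) with deg-others _ ¬q
    ... | _ , inj₁ (d , _) = ⊥-elim (none d (t , refl))
    ... | _ , inj₂ (d , _) = cong proj₁ (one d (s , p) (t , refl))

  outDegree : ∀ F v → Finite (Σ[ s ∈ SourcePosition F ] sourceAt F s ≡ v)
  outDegree F v = Finite-Σ (Finite-Σ (Edge-finite F) (λ e → Finite-Fin _))
    (λ s → Finite-Dec (Finite-≟ (V-finite F) (sourceAt F s) v) (Finite-UIP (V-finite F)))

  inDegree : ∀ F v → Finite (Σ[ t ∈ TargetPosition F ] targetAt F t ≡ v)
  inDegree F v = Finite-Σ (Finite-Σ (Edge-finite F) (λ e → Finite-Fin _))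
    (λ t → Finite-Dec (Finite-≟ (V-finite F) (targetAt F t) v) (Finite-UIP (V-finite F)))

  fromPLM : ∀ {m n} {f : Cospan S m n} → PLM f → PartialLeftMonogamous f
  fromPLM {f = f} plm = record
    { left-mono  = injective⇒mono (left f) left-inj
    ; deg-inputs = λ { v (x , refl) → _ , empty (λ { (t , p) → disjoint p }) , proj₂ (outDegree F _) }
    ; deg-others = λ v _ → _ , others v (inDegree F v)
    }
    where
    open PLM plm
    F = apex f
    empty : ∀ {A : Set} → ¬ A → A ↔ Fin 0
    empty ¬a = mk↔ₛ′ (⊥-elim ∘ ¬a) (λ ()) (λ ()) (λ a → ⊥-elim (¬a a))
    pos-irrelevant : ∀ {v} (s t : Σ[ t ∈ TargetPosition F ] targetAt F t ≡ v) → s ≡ t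
    pos-irrelevant {v} (s , refl) (t , q) with target-inj q
    ... | refl = cong (t ,_) (Finite-UIP (V-finite F) refl q)
    others : ∀ v → Finite (Σ[ t ∈ TargetPosition F ] targetAt F t ≡ v) →
             HasDegree F v (0 , _) ⊎ HasDegree F v (1 , _)
    others v (0 , i) = inj₁ (i , proj₂ (outDegree F v))
    others v (1 , i) = inj₂ (i , proj₂ (outDegree F v))
    others v (suc (suc _) , i) =
      ⊥-elim (0≢1 (trans (sym (strictlyInverseˡ zero))
                   (trans (cong to (pos-irrelevant _ _)) (strictlyInverseˡ (suc zero)))))
      where
      open Inverse i
      0≢1 : ∀ {n} → _≢_ {A = Fin (suc (suc n))} zero (suc zero)
      0≢1 ()

  wire-PLM : ∀ {m n} (ρ : Fin n → Fin m) → PLM (wire {S = S} ρ)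
  wire-PLM ρ = record
    { left-inj = λ p → p
    ; target-inj = λ { {(_ , _ , ()) , _} }
    ; disjoint = λ { {(_ , _ , ()) , _} } }

  module GlueTargets (F G : LabelledHypergraph S) {W : Set} (finW : Finite W)
                     (q : V F ⊎ V G → W) where

    H : LabelledHypergraph S
    H = glue F G finW q

    inF : TargetPosition F → TargetPosition H
    inF ((k , l , e) , p) = (k , l , inj₁ e) , p

    inG : TargetPosition G → TargetPosition H
    inG ((k , l , e) , p) = (k , l , inj₂ e) , p

    targetAtF : ∀ t → targetAt H (inF t) ≡ q (inj₁ (targetAt F t))
    targetAtF ((_ , _ , e) , p) = lookup-map p (q ∘ inj₁) (tgt F e)

    targetAtG : ∀ t → targetAt H (inG t) ≡ q (inj₂ (targetAt G t))
    targetAtG ((_ , _ , e) , p) = lookup-map p (q ∘ inj₂) (tgt G e)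

    target-injective :
      (∀ {s t} → q (inj₁ (targetAt F s)) ≡ q (inj₁ (targetAt F t)) → s ≡ t) →
      (∀ {s t} → q (inj₂ (targetAt G s)) ≡ q (inj₂ (targetAt G t)) → s ≡ t) →
      (∀ {s t} → q (inj₁ (targetAt F s)) ≢ q (inj₂ (targetAt G t))) →
      ∀ {s t} → targetAt H s ≡ targetAt H t → s ≡ t
    target-injective injF injG disj {(k , l , inj₁ e) , x} {(k′ , l′ , inj₁ e′) , y} p =
      cong inF (injF {(k , l , e) , x} {(k′ , l′ , e′) , y}
        (trans (sym (targetAtF ((k , l , e) , x))) (trans p (targetAtF ((k′ , l′ , e′) , y)))))
    target-injective injF injG disj {(k , l , inj₂ e) , x} {(k′ , l′ , inj₂ e′) , y} p =
      cong inG (injG {(k , l , e) , x} {(k′ , l′ , e′) , y}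
        (trans (sym (targetAtG ((k , l , e) , x))) (trans p (targetAtG ((k′ , l′ , e′) , y)))))
    target-injective injF injG disj {(k , l , inj₁ e) , x} {(k′ , l′ , inj₂ e′) , y} p =
      ⊥-elim (disj {(k , l , e) , x} {(k′ , l′ , e′) , y}
        (trans (sym (targetAtF ((k , l , e) , x))) (trans p (targetAtG ((k′ , l′ , e′) , y)))))
    target-injective injF injG disj {(k , l , inj₂ e) , x} {(k′ , l′ , inj₁ e′) , y} p =
      ⊥-elim (disj {(k′ , l′ , e′) , y} {(k , l , e) , x}
        (trans (sym (targetAtF ((k′ , l′ , e′) , y))) (trans (sym p) (targetAtG ((k , l , e) , x)))))

    target-avoids : ∀ {w} → (∀ t → q (inj₁ (targetAt F t)) ≢ w) →
                    (∀ t → q (inj₂ (targetAt G t)) ≢ w) → ∀ {t} → targetAt H t ≢ w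
    target-avoids avF avG {(k , l , inj₁ e) , x} p =
      avF ((k , l , e) , x) (trans (sym (targetAtF ((k , l , e) , x))) p)
    target-avoids avF avG {(k , l , inj₂ e) , x} p =
      avG ((k , l , e) , x) (trans (sym (targetAtG ((k , l , e) , x))) p)

  ⊗-PLM : ∀ {m n p q} {f : Cospan S m n} {g : Cospan S p q} → PLM f → PLM g → PLM (f ⊗ᶜ g)
  ⊗-PLM {m} {n} {p} {q} {f} {g} pf pg = record
    { left-inj = λ {x} {y} e →
        trans (sym (join-splitAt m p x))
          (trans (cong (join m p) (leg-inj (splitAt m x) (splitAt m y) e)) (join-splitAt m p y))
    ; target-inj = λ {s} {t} → target-injective (λ e → F.target-inj (inj₁-injective e))
        (λ e → G.target-inj (inj₂-injective e)) (λ ()) {s} {t}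
    ; disjoint = λ {t} {x} → target-avoids (avF (splitAt m x)) (avG (splitAt m x)) {t}
    }
    where
    module F = PLM pf
    module G = PLM pg
    open GlueTargets (apex f) (apex g) (Finite-⊎ (V-finite (apex f)) (V-finite (apex g))) (λ v → v)
    leg : Fin m ⊎ Fin p → V (apex f) ⊎ V (apex g)
    leg = [ inj₁ ∘ vmap (left f) , inj₂ ∘ vmap (left g) ]′
    leg-inj : ∀ a b → leg a ≡ leg b → a ≡ b
    leg-inj (inj₁ _) (inj₁ _) e = cong inj₁ (F.left-inj (inj₁-injective e))
    leg-inj (inj₂ _) (inj₂ _) e = cong inj₂ (G.left-inj (inj₂-injective e))
    avF : ∀ s t → inj₁ (targetAt (apex f) t) ≢ leg s
    avF (inj₁ x) t e = F.disjoint {t} {x} (inj₁-injective e)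
    avG : ∀ s t → inj₂ (targetAt (apex g) t) ≢ leg s
    avG (inj₂ x) t e = G.disjoint {t} {x} (inj₂-injective e)

  ⨾-PLM : ∀ {m n p} {f : Cospan S m n} {g : Cospan S n p} → PLM f → PLM g → PLM (f ⨾ᶜ g)
  ⨾-PLM {m} {n} {p} {f} {g} pf pg = record
    { left-inj = λ e → F.left-inj (inj₁-injective (proj-≡ (inj₁ _) (inj₁ _) e))
    ; target-inj = λ {s} {t} → target-injective
        (λ e → F.target-inj (inj₁-injective (proj-≡ (inj₁ _) (inj₁ _) e)))
        (λ {s} {t} e → G.target-inj (inj₂-injective
          (trans (sym (classify-target s))
            (trans (proj-≡ (inj₂ _) (inj₂ _) e) (classify-target t)))))
        (λ {s} {t} e → inj₁≢inj₂ (trans (proj-≡ (inj₁ _) (inj₂ _) e) (classify-target t)))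
        {s} {t}
    ; disjoint = λ {t} {x} → target-avoids
        (λ s e → F.disjoint {s} {x} (inj₁-injective (proj-≡ (inj₁ _) (inj₁ _) e)))
        (λ s e → inj₁≢inj₂ (trans (sym (proj-≡ (inj₂ _) (inj₁ _) e)) (classify-target s)))
        {t}
    }
    where
    module F = PLM pf
    module G = PLM pg
    module P = Pushout (right f) (left g)
    open GlueTargets (apex f) (apex g) (Finite-Fin P.C.size) P.C.proj
    A : Set
    A = V (apex f) ⊎ V (apex g)
    inj₁≢inj₂ : ∀ {x y} → _≢_ {A = A} (inj₁ x) (inj₂ y)
    inj₁≢inj₂ ()
    classify₂ : ∀ w → Dec (InImage (left g) w) → A
    classify₂ w (yes (x , _)) = inj₁ (vmap (right f) x)
    classify₂ w (no _)        = inj₂ w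
    classify : A → A
    classify (inj₁ v) = inj₁ v
    classify (inj₂ w) = classify₂ w (imageDec (left g) w)
    classify-eq : ∀ x → classify (inj₁ (vmap (right f) x)) ≡ classify (inj₂ (vmap (left g) x))
    classify-eq x with imageDec (left g) (vmap (left g) x)
    ... | yes (y , e) = cong (inj₁ ∘ vmap (right f)) (sym (G.left-inj e))
    ... | no ¬p       = ⊥-elim (¬p (x , refl))
    classify-target : ∀ t → classify (inj₂ (targetAt (apex g) t)) ≡ inj₂ (targetAt (apex g) t)
    classify-target t with imageDec (left g) (targetAt (apex g) t)
    ... | yes (x , e) = ⊥-elim (G.disjoint {t} {x} (sym e))
    ... | no _        = refl
    proj-≡ : ∀ a b → P.C.proj a ≡ P.C.proj b → classify a ≡ classify b
    proj-≡ a b e = trans (sym (P.C.respects classify classify-eq a))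
      (trans (cong (classify ∘ P.C.section) e) (P.C.respects classify classify-eq b))

  PLM-closed : Closed (Csp {S = S}) PartialLeftMonogamous
  PLM-closed = record
    { id-closed = fromPLM (wire-PLM (λ x → x))
    ; ⨾-closed  = λ {_} {_} {_} {f} {g} x y → fromPLM (⨾-PLM {f = f} {g} (toPLM x) (toPLM y))
    ; ⊗-closed  = λ {_} {_} {_} {_} {f} {g} x y → fromPLM (⊗-PLM {f = f} {g} (toPLM x) (toPLM y))
    ; σ-closed  = λ m n → fromPLM (wire-PLM (swapFin n m))
    }

PLMCsp : ∀ {c} (S : Signature c) → PROP (lsuc 0ℓ ⊔ c) c
PLMCsp S = subPROP (Csp {S = S}) PartialLeftMonogamous PLM-closed

{-# OPTIONS --safe #-}
module Submission where

-- Every term is rewritten to a feedback normal form: the hyperedges in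
-- parallel, wired by a function φ that tells which output of a hyperedge, or
-- which input, feeds each input of a hyperedge and each output.  The wiring is
-- a term because cocommutative comonoids present the opposite of finite sets,
-- and a trace feeds the outputs of the hyperedges back.  A wire traced onto
-- itself stays, as a vertex without source; any other traced wire is
-- substituted away.  Normal forms are, up to renumbering, the partial
-- left-monogamous cospans, since each vertex is an input, the unique target
-- of a hyperedge, or has no source; and renumbering is an instance of sliding.
-- Soundness holds for all cospans, where a trace identifies inputs with outputs.

open import Defs
open import Level using (_⊔_; 0ℓ) renaming (suc to lsuc)
open import Axiom.UniquenessOfIdentityProofs using (module Decidable⇒UIP)
open import Data.Bool using (Bool; true; false; _∨_)
import Data.Bool.Properties as Bool
open import Data.Empty using (⊥; ⊥-elim)
open import Data.Fin using (Fin; zero; suc; lift; _↑ˡ_; _↑ʳ_; splitAt; join; cast; punchIn; toℕ)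
open import Data.Fin.Permutation
  using (Permutation; _⟨$⟩ʳ_; _⟨$⟩ˡ_; remove; punchIn-permute; inverseˡ; inverseʳ)
open import Data.Fin.Properties
  using (splitAt-↑ˡ; splitAt-↑ʳ; join-splitAt; toℕ-injective; toℕ-cast; toℕ-↑ˡ; any?)
open import Data.Nat using (ℕ; zero; suc; _+_)
open import Data.Nat.Properties using (+-assoc; +-identityʳ; ≡-irrelevant)
open import Data.Product using (_×_; _,_; proj₁; proj₂; Σ-syntax)
open import Data.Sum using (_⊎_; inj₁; inj₂; [_,_]′; swap; assocˡ; assocʳ; map₁; map₂) renaming (map to map⊎)
open import Data.Sum.Properties using (inj₁-injective; inj₂-injective)
open import Data.Vec using (Vec; []; _∷_; lookup; map; tabulate)
open import Data.Vec.Properties using (lookup-map; lookup∘tabulate)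
open import Function using (_∘_; Inverse; mk↔ₛ′)
open import Relation.Binary.PropositionalEquality
  using (_≡_; _≢_; _≗_; refl; sym; trans; cong; subst; subst₂)
open import Relation.Nullary using (Dec; yes; no; does)

-- Wirings by cocommutative comonoids

-- Copying and discarding are natural for wirings but not for generators, so a hyperedge can be
-- neither duplicated nor dropped. The hyperedges and their labels therefore survive every equation,
-- and normal forms with isomorphic cospans can differ only by a renumbering. A closed wire cannot
-- be removed either: the trace of `Δ`, a map from 0 to 1, is a vertex without source that an output
-- or a hyperedge may still use.
--
-- Two obstacles shape the rest. Arities add associatively only up to equality proofs, so terms are
-- treated as maps between coded disjoint unions, where reassociation is an ordinary function.
-- Composites and traces of cospans are quotients, so the trace axioms are checked on presentations,
-- one generating identification at a time.
--
-- Functoriality of the inverse is not computed on normal forms. Completeness says that a term is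
-- determined by its cospan, and the term chosen for a cospan denotes that cospan; all functor laws
-- follow.

module Free-Term {c} (S : Signature c) where

  open Congruence (S ⊎ₛ comonoidSignature) (ComonoidEquation S) public

  Tm : ℕ → ℕ → Set c
  Tm = Term (S ⊎ₛ comonoidSignature)

  infixr 5 _▸_
  -- Composition again, but associating to the right, which is the shape on which `pull₁`, `pull₂`
  -- and `cancel` act.
  _▸_ : ∀ {m n p} → Tm m n → Tm n p → Tm m p
  f ▸ g = f ⨾ g

  infixr 2 _≈⟨_⟩_
  infix 3 _∎≈
  _≈⟨_⟩_ : ∀ {m n} (f : Tm m n) {g h : Tm m n} → f ≈ g → g ≈ h → f ≈ h
  _ ≈⟨ p ⟩ q = ≈-trans p q

  _∎≈ : ∀ {m n} (f : Tm m n) → f ≈ f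
  _ ∎≈ = ≈-refl

  ≡⇒≈ : ∀ {m n} {f g : Tm m n} → f ≡ g → f ≈ g
  ≡⇒≈ refl = ≈-refl

  post : ∀ {m n p} {f g : Tm m n} {k : Tm n p} → f ≈ g → f ▸ k ≈ g ▸ k
  post p = ⨾-cong p ≈-refl

  pre : ∀ {m n p} {f : Tm m n} {g h : Tm n p} → g ≈ h → f ▸ g ≈ f ▸ h
  pre p = ⨾-cong ≈-refl p

  pull₁ : ∀ {m n p q} {f : Tm m n} {g : Tm n p} {h : Tm m p} {k : Tm p q} →
          f ▸ g ≈ h → f ▸ g ▸ k ≈ h ▸ k
  pull₁ p = ≈-trans (≈-sym (⨾-assoc _ _ _)) (post p)

  pull₂ : ∀ {m n n′ p q} {f : Tm m n} {g : Tm n p} {h : Tm m n′} {h′ : Tm n′ p} {k : Tm p q} →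
          f ▸ g ≈ h ▸ h′ → f ▸ g ▸ k ≈ h ▸ h′ ▸ k
  pull₂ p = ≈-trans (pull₁ p) (⨾-assoc _ _ _)

  cancel : ∀ {m n p} {f : Tm m n} {g : Tm n m} {k : Tm m p} → f ▸ g ≈ id → f ▸ g ▸ k ≈ k
  cancel p = ≈-trans (pull₁ p) (⨾-identityˡ _)

  ⊗-split : ∀ {m n p q} (f : Tm m n) (g : Tm p q) → f ⊗ g ≈ (f ⊗ id) ▸ (id ⊗ g)
  ⊗-split f g = ≈-trans (⊗-cong (≈-sym (⨾-identityʳ f)) (≈-sym (⨾-identityˡ g))) (⊗-⨾ _ _ _ _)

  ⊗-split′ : ∀ {m n p q} (f : Tm m n) (g : Tm p q) → f ⊗ g ≈ (id ⊗ g) ▸ (f ⊗ id)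
  ⊗-split′ f g = ≈-trans (⊗-cong (≈-sym (⨾-identityˡ f)) (≈-sym (⨾-identityʳ g))) (⊗-⨾ _ _ _ _)

  interchange : ∀ {m n p q} (f : Tm m n) (g : Tm p q) → (f ⊗ id) ▸ (id ⊗ g) ≈ (id ⊗ g) ▸ (f ⊗ id)
  interchange f g = ≈-trans (≈-sym (⊗-split f g)) (⊗-split′ f g)

  whisker-⨾ : ∀ {m n p k} (f : Tm m n) (g : Tm n p) → (f ▸ g) ⊗ id {n = k} ≈ (f ⊗ id) ▸ (g ⊗ id)
  whisker-⨾ f g = ≈-trans (⊗-cong ≈-refl (≈-sym (⨾-identityˡ id))) (⊗-⨾ f g id id)

  -- Wires are added on the left, where 1 + p computes, so that no casts arise.
  infixr 8 L_
  L_ : ∀ {p q} → Tm p q → Tm (suc p) (suc q)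
  L f = id {n = 1} ⊗ f

  L-cong : ∀ {p q} {f g : Tm p q} → f ≈ g → L f ≈ L g
  L-cong = ⊗-cong ≈-refl

  L-⨾ : ∀ {p q r} (f : Tm p q) (g : Tm q r) → L (f ▸ g) ≈ L f ▸ L g
  L-⨾ f g = ≈-trans (⊗-cong (≈-sym (⨾-identityˡ id)) ≈-refl) (⊗-⨾ id id f g)

  LL : ∀ {p q} (f : Tm p q) → L (L f) ≈ id {n = 2} ⊗ f
  LL f = ≈-trans (≈-sym (⊗-assoc id id f)) (⊗-cong ⊗-id ≈-refl)

  sᵗ : ∀ {p} → Tm (2 + p) (2 + p)
  sᵗ = σ 1 1 ⊗ id

  dᵗ : ∀ {p} → Tm (1 + p) (2 + p)
  dᵗ = Δ S ⊗ id

  eᵗ : ∀ {p} → Tm (1 + p) p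
  eᵗ = ε S ⊗ id

  s-natural : ∀ {p q} (f : Tm p q) → sᵗ ▸ L (L f) ≈ L (L f) ▸ sᵗ
  s-natural f = ≈-trans (pre (LL f)) (≈-trans (interchange _ f) (post (≈-sym (LL f))))

  d-natural : ∀ {p q} (f : Tm p q) → dᵗ ▸ L (L f) ≈ L f ▸ dᵗ
  d-natural f = ≈-trans (pre (LL f)) (interchange _ f)

  e-natural : ∀ {p q} (f : Tm p q) → eᵗ ▸ f ≈ L f ▸ eᵗ
  e-natural f = ≈-trans (pre (≈-sym (⊗-identityˡ f))) (interchange _ f)

  ⊗-id-id : ∀ {m n k p} (f : Tm m n) → f ⊗ id {n = k + p} ≈ f ⊗ (id {n = k} ⊗ id {n = p})
  ⊗-id-id f = ⊗-cong ≈-refl (≈-sym ⊗-id)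

  -- `+-assoc 1 m k` reduces to `refl`, so the `subst₂` in `⊗-assoc` vanishes. The same holds for
  -- all associativities with a numeral on the left.
  L-whisker : ∀ {m n k} (f : Tm m n) → L (f ⊗ id {n = k}) ≈ (L f) ⊗ id
  L-whisker f = ≈-sym (⊗-assoc id f id)

  s-small : ∀ {p} → sᵗ {suc p} ≈ (σ 1 1 ⊗ id {n = 1}) ⊗ id {n = p}
  s-small = ≈-trans (⊗-id-id _) (≈-sym (⊗-assoc _ id id))

  d-small : ∀ {p} → dᵗ {suc p} ≈ (Δ S ⊗ id {n = 1}) ⊗ id {n = p}
  d-small = ≈-trans (⊗-id-id _) (≈-sym (⊗-assoc _ id id))

  e-small : ∀ {p} → eᵗ {suc p} ≈ (ε S ⊗ id {n = 1}) ⊗ id {n = p}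
  e-small = ≈-trans (⊗-id-id _) (≈-sym (⊗-assoc _ id id))

  private
    J : ∀ {m n p} {f g : Tm m n} → f ≈ g → f ⊗ id {n = p} ≈ g ⊗ id
    J p = ⊗-cong p ≈-refl

    J₂ : ∀ {m n q p} {f : Tm m n} {g : Tm n q} {h : Tm m q} →
         f ▸ g ≈ h → (f ⊗ id {n = p}) ▸ (g ⊗ id) ≈ h ⊗ id
    J₂ p = ≈-trans (≈-sym (whisker-⨾ _ _)) (J p)

  s-s : ∀ {p} → sᵗ {p} ▸ sᵗ ≈ id
  s-s = ≈-trans (J₂ (σ-involutive 1 1)) ⊗-id

  d-s : ∀ {p} → dᵗ {p} ▸ sᵗ ≈ dᵗ
  d-s = J₂ (equation cocomm)

  d-e : ∀ {p} → dᵗ {p} ▸ eᵗ ≈ id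
  d-e = ≈-trans (pre e-small) (≈-trans (J₂ (equation counitˡ)) ⊗-id)

  d-Le : ∀ {p} → dᵗ {p} ▸ L eᵗ ≈ id
  d-Le = ≈-trans (pre (L-whisker _)) (≈-trans (J₂ (equation counitʳ)) ⊗-id)

  d-d : ∀ {p} → dᵗ {p} ▸ dᵗ ≈ dᵗ ▸ L dᵗ
  d-d = ≈-trans (pre d-small) (≈-trans (J₂ (equation coassoc))
          (≈-trans (whisker-⨾ _ _) (pre (≈-sym (L-whisker _)))))

  σ₁₂ : σ 1 2 ≈ (σ 1 1 ⊗ id {n = 1}) ▸ (id {n = 1} ⊗ σ 1 1)
  σ₁₂ = σ-hexagon 1 1 1

  -- Naturality moves `Δ` through the crossing, which becomes `σ 1 2`; the hexagon splits that into
  -- two adjacent crossings.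
  s-d : ∀ {p} → sᵗ ▸ dᵗ {suc p} ≈ L dᵗ ▸ sᵗ ▸ L sᵗ
  s-d = sᵗ ▸ dᵗ ≈⟨ pre d-small ⟩
        sᵗ ▸ ((Δ S ⊗ id {n = 1}) ⊗ id) ≈⟨ J₂ (≈-sym (σ-natural id (Δ S))) ⟩
        ((L Δ S) ⨾ σ 1 2) ⊗ id ≈⟨ J (pre σ₁₂) ⟩
        (L Δ S ▸ (σ 1 1 ⊗ id {n = 1}) ▸ (id {n = 1} ⊗ σ 1 1)) ⊗ id
          ≈⟨ ≈-trans (whisker-⨾ _ _) (⨾-cong (≈-sym (L-whisker _))
               (≈-trans (whisker-⨾ _ _) (⨾-cong (≈-sym s-small) (≈-sym (L-whisker _))))) ⟩
        L dᵗ ▸ sᵗ ▸ L sᵗ ∎≈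

  -- The Yang-Baxter equation: naturality of `σ 1 2` with respect to the crossing of its two wires,
  -- with `σ 1 2` unfolded on both sides.
  braid : ∀ {p} → L (sᵗ {p}) ▸ sᵗ ▸ L sᵗ ≈ sᵗ ▸ L sᵗ ▸ sᵗ
  braid =
    L sᵗ ▸ sᵗ ▸ L sᵗ
      ≈⟨ ⨾-cong (L-whisker _) (≈-trans (⨾-cong s-small (L-whisker _)) (J₂ (≈-sym σ₁₂))) ⟩
    ((L σ 1 1) ⊗ id) ▸ (σ 1 2 ⊗ id) ≈⟨ J₂ (σ-natural id (σ 1 1)) ⟩
    (σ 1 2 ▸ (σ 1 1 ⊗ id)) ⊗ id ≈⟨ J (post σ₁₂) ⟩
    (((σ 1 1 ⊗ id {n = 1}) ▸ (id {n = 1} ⊗ σ 1 1)) ▸ (σ 1 1 ⊗ id)) ⊗ id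
      ≈⟨ ≈-trans (whisker-⨾ _ _) (⨾-cong (≈-trans (whisker-⨾ _ _)
           (⨾-cong (≈-sym s-small) (≈-sym (L-whisker _)))) (≈-sym s-small)) ⟩
    (sᵗ ▸ L sᵗ) ▸ sᵗ ≈⟨ ⨾-assoc _ _ _ ⟩
    sᵗ ▸ L sᵗ ▸ sᵗ ∎≈

  LsLs : ∀ {p q} {k : Tm (3 + p) q} → L (sᵗ {p}) ▸ L sᵗ ▸ k ≈ k
  LsLs = cancel (≈-trans (≈-sym (L-⨾ _ _)) (≈-trans (L-cong s-s) ⊗-id))

  -- The mirror image of `s-d`, obtained from it by cancelling one crossing in front and two behind.
  s-Ld : ∀ {p} → sᵗ ▸ L (dᵗ {p}) ≈ dᵗ ▸ L sᵗ ▸ sᵗ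
  s-Ld = ≈-sym (dᵗ ▸ L sᵗ ▸ sᵗ ≈⟨ ≈-sym (cancel s-s) ⟩
         sᵗ ▸ sᵗ ▸ dᵗ ▸ L sᵗ ▸ sᵗ ≈⟨ pre (≈-sym (⨾-assoc _ _ _)) ⟩
         sᵗ ▸ (sᵗ ▸ dᵗ) ▸ L sᵗ ▸ sᵗ ≈⟨ pre (post s-d) ⟩
         sᵗ ▸ (L dᵗ ▸ sᵗ ▸ L sᵗ) ▸ L sᵗ ▸ sᵗ ≈⟨ pre (⨾-assoc _ _ _) ⟩
         sᵗ ▸ L dᵗ ▸ (sᵗ ▸ L sᵗ) ▸ L sᵗ ▸ sᵗ ≈⟨ pre (pre (⨾-assoc _ _ _)) ⟩
         sᵗ ▸ L dᵗ ▸ sᵗ ▸ L sᵗ ▸ L sᵗ ▸ sᵗ ≈⟨ pre (pre (pre LsLs)) ⟩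
         sᵗ ▸ L dᵗ ▸ sᵗ ▸ sᵗ ≈⟨ pre (pre s-s) ⟩
         sᵗ ▸ L dᵗ ▸ id ≈⟨ pre (⨾-identityʳ _) ⟩
         sᵗ ▸ L dᵗ ∎≈)

  -- Equality proofs in ℕ are unique, so a cast whose two arities coincide is trivial, whichever
  -- proof it carries.
  subst₂-irr : ∀ {m n} (p : m ≡ m) (q : n ≡ n) (f : Tm m n) → subst₂ Tm p q f ≈ f
  subst₂-irr p q f rewrite ≡-irrelevant p refl | ≡-irrelevant q refl = ≈-refl

  castᵗ : ∀ {m n} → m ≡ n → Tm m n
  castᵗ p = subst₂ Tm refl p id

  -- The hexagon at 0, 0 makes σ m 0 idempotent up to casts, and it is invertible.
  σ-unitʳ : ∀ m → σ m 0 ≈ castᵗ (+-identityʳ m)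
  σ-unitʳ m = go (+-identityʳ m) (+-assoc m 0 0) (+-identityʳ (m + 0)) refl (σ m 0 ⊗ id) (σ 0 m)
    (σ-involutive m 0) (⊗-identityʳ (σ m 0))
    (≈-trans (σ-hexagon m 0 0) (pre (⊗-identityˡ _)))
    where
    go : ∀ {j k m} (eq : k ≡ m) (p p′ : j ≡ k) (q : k ≡ k) (t : Tm j k) {f : Tm k m} (g : Tm m k) →
         f ⨾ g ≈ id → subst₂ Tm p′ eq t ≈ f → f ≈ subst₂ Tm p q t ⨾ f → f ≈ castᵗ eq
    go refl refl p′ q t {f} g inv t≈f idem =
      f ≈⟨ ≈-sym (⨾-identityʳ f) ⟩
      f ▸ id ≈⟨ pre (≈-sym inv) ⟩
      f ▸ f ▸ g ≈⟨ pull₁ (≈-trans (post (≈-trans (≈-sym (≈-trans (≈-sym (subst₂-irr p′ refl t)) t≈f))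
                     (≈-sym (subst₂-irr refl q t)))) (≈-sym idem)) ⟩
      f ▸ g ≈⟨ inv ⟩
      id ∎≈

  σ₁₀ : σ 1 0 ≈ id
  σ₁₀ = σ-unitʳ 1

  s-e : ∀ {p} → sᵗ {p} ▸ eᵗ ≈ L eᵗ
  s-e = ≈-trans (pre e-small) (≈-trans (J₂ (≈-trans (≈-sym (σ-natural id (ε S)))
          (≈-trans (pre σ₁₀) (⨾-identityʳ _)))) (≈-sym (L-whisker _)))

  s-Le : ∀ {p} → sᵗ {p} ▸ L eᵗ ≈ eᵗ
  s-Le = ≈-trans (pre (≈-sym s-e)) (cancel s-s)

  L₂ : ∀ {p q r} {f : Tm p q} {g : Tm q r} {h : Tm p r} → f ▸ g ≈ h → L f ▸ L g ≈ L h
  L₂ p = ≈-trans (≈-sym (L-⨾ _ _)) (L-cong p)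

  -- `copy i` duplicates wire i, the new copy becoming the first output.
  copy : ∀ {p} → Fin p → Tm p (suc p)
  copy zero    = dᵗ
  copy (suc i) = L copy i ▸ sᵗ

  discard : ∀ p → Tm p 0
  discard zero    = id
  discard (suc p) = eᵗ ▸ discard p

  -- The input of `wireᵗ φ` feeding output j is φ j.
  wireᵗ : ∀ {p q} → (Fin q → Fin p) → Tm p q
  wireᵗ {p} {zero}  φ = discard p
  wireᵗ {p} {suc q} φ = copy (φ zero) ▸ L wireᵗ (φ ∘ suc)

  wireᵗ-cong : ∀ {p q} {φ ψ : Fin q → Fin p} → φ ≗ ψ → wireᵗ φ ≈ wireᵗ ψ
  wireᵗ-cong {q = zero}  h = ≈-refl
  wireᵗ-cong {q = suc q} h =
    ⨾-cong (≡⇒≈ (cong copy (h zero))) (L-cong (wireᵗ-cong (h ∘ suc)))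

  copy-e : ∀ {p} (i : Fin p) → copy i ▸ eᵗ ≈ id
  copy-e zero    = d-e
  copy-e (suc i) = ≈-trans (⨾-assoc _ _ _) (≈-trans (pre s-e)
    (≈-trans (L₂ (copy-e i)) ⊗-id))

  copy-copy : ∀ {p} (a : Fin p) → copy a ▸ dᵗ ≈ copy a ▸ L copy a
  copy-copy zero    = d-d
  copy-copy (suc i) =
    (L copy i ▸ sᵗ) ▸ dᵗ ≈⟨ ⨾-assoc _ _ _ ⟩
    L copy i ▸ sᵗ ▸ dᵗ ≈⟨ pre s-d ⟩
    L copy i ▸ L dᵗ ▸ sᵗ ▸ L sᵗ ≈⟨ pull₁ (L₂ (copy-copy i)) ⟩
    L (copy i ▸ L copy i) ▸ sᵗ ▸ L sᵗ ≈⟨ ≈-trans (post (L-⨾ _ _)) (⨾-assoc _ _ _) ⟩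
    L copy i ▸ L L copy i ▸ sᵗ ▸ L sᵗ ≈⟨ pre (pull₂ (≈-sym (s-natural _))) ⟩
    L copy i ▸ sᵗ ▸ L L copy i ▸ L sᵗ ≈⟨ ≈-sym (⨾-assoc _ _ _) ⟩
    (L copy i ▸ sᵗ) ▸ L L copy i ▸ L sᵗ ≈⟨ pre (≈-sym (L-⨾ _ _)) ⟩
    (L copy i ▸ sᵗ) ▸ L (L copy i ▸ sᵗ) ∎≈

  -- Two copies may be taken in either order. For one wire this is coassociativity with
  -- cocommutativity; for wire 0 and another it is naturality of `Δ`; for two later wires the
  -- crossings have to be rearranged by `braid`.
  copy-comm : ∀ {p} (a b : Fin p) → copy a ▸ L copy b ▸ sᵗ ≈ copy b ▸ L copy a
  copy-comm zero zero =
    dᵗ ▸ L dᵗ ▸ sᵗ ≈⟨ pull₂ (≈-sym d-d) ⟩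
    dᵗ ▸ dᵗ ▸ sᵗ ≈⟨ pre d-s ⟩
    dᵗ ▸ dᵗ ≈⟨ d-d ⟩
    dᵗ ▸ L dᵗ ∎≈
  copy-comm zero (suc j) =
    dᵗ ▸ L (L copy j ▸ sᵗ) ▸ sᵗ ≈⟨ pre (≈-trans (post (L-⨾ _ _)) (⨾-assoc _ _ _)) ⟩
    dᵗ ▸ L L copy j ▸ L sᵗ ▸ sᵗ ≈⟨ pull₂ (d-natural _) ⟩
    L copy j ▸ dᵗ ▸ L sᵗ ▸ sᵗ ≈⟨ pre (≈-sym s-Ld) ⟩
    L copy j ▸ sᵗ ▸ L dᵗ ≈⟨ ≈-sym (⨾-assoc _ _ _) ⟩
    (L copy j ▸ sᵗ) ▸ L dᵗ ∎≈
  copy-comm (suc i) zero =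
    (L copy i ▸ sᵗ) ▸ L dᵗ ▸ sᵗ ≈⟨ ⨾-assoc _ _ _ ⟩
    L copy i ▸ sᵗ ▸ L dᵗ ▸ sᵗ ≈⟨ pre (≈-trans (pull₁ s-Ld) (≈-trans (⨾-assoc _ _ _) (pre (⨾-assoc _ _ _)))) ⟩
    L copy i ▸ dᵗ ▸ L sᵗ ▸ sᵗ ▸ sᵗ ≈⟨ pre (pre (≈-trans (pre s-s) (⨾-identityʳ _))) ⟩
    L copy i ▸ dᵗ ▸ L sᵗ ≈⟨ pull₂ (≈-sym (d-natural _)) ⟩
    dᵗ ▸ L L copy i ▸ L sᵗ ≈⟨ pre (≈-sym (L-⨾ _ _)) ⟩
    dᵗ ▸ L (L copy i ▸ sᵗ) ∎≈
  copy-comm (suc i) (suc j) =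
    (L copy i ▸ sᵗ) ▸ L (L copy j ▸ sᵗ) ▸ sᵗ
      ≈⟨ ≈-trans (⨾-assoc _ _ _) (pre (pre (≈-trans (post (L-⨾ _ _)) (⨾-assoc _ _ _)))) ⟩
    L copy i ▸ sᵗ ▸ L L copy j ▸ L sᵗ ▸ sᵗ ≈⟨ pre (pull₂ (s-natural _)) ⟩
    L copy i ▸ L L copy j ▸ sᵗ ▸ L sᵗ ▸ sᵗ ≈⟨ pull₁ (≈-sym (L-⨾ _ _)) ⟩
    L (copy i ▸ L copy j) ▸ sᵗ ▸ L sᵗ ▸ sᵗ ≈⟨ pre (≈-sym braid) ⟩
    L (copy i ▸ L copy j) ▸ L sᵗ ▸ sᵗ ▸ L sᵗ ≈⟨ pull₁ (L₂ (≈-trans (⨾-assoc _ _ _) (copy-comm i j))) ⟩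
    L (copy j ▸ L copy i) ▸ sᵗ ▸ L sᵗ ≈⟨ ≈-trans (post (L-⨾ _ _)) (⨾-assoc _ _ _) ⟩
    L copy j ▸ L L copy i ▸ sᵗ ▸ L sᵗ ≈⟨ pre (pull₂ (≈-sym (s-natural _))) ⟩
    L copy j ▸ sᵗ ▸ L L copy i ▸ L sᵗ ≈⟨ ≈-sym (⨾-assoc _ _ _) ⟩
    (L copy j ▸ sᵗ) ▸ L L copy i ▸ L sᵗ ≈⟨ pre (≈-sym (L-⨾ _ _)) ⟩
    (L copy j ▸ sᵗ) ▸ L (L copy i ▸ sᵗ) ∎≈

  -- Coassociativity turns a second copy of an output into a second copy of its source, and
  -- `copy-comm` carries it past the copies that serve the other outputs.
  wireᵗ-copy : ∀ {p q} (φ : Fin q → Fin p) (i : Fin q) → wireᵗ φ ▸ copy i ≈ copy (φ i) ▸ L wireᵗ φ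
  wireᵗ-copy φ zero =
    (copy (φ zero) ▸ L wireᵗ (φ ∘ suc)) ▸ dᵗ ≈⟨ ⨾-assoc _ _ _ ⟩
    copy (φ zero) ▸ L wireᵗ (φ ∘ suc) ▸ dᵗ ≈⟨ pre (≈-sym (d-natural _)) ⟩
    copy (φ zero) ▸ dᵗ ▸ L L wireᵗ (φ ∘ suc) ≈⟨ pull₂ (copy-copy _) ⟩
    copy (φ zero) ▸ L copy (φ zero) ▸ L L wireᵗ (φ ∘ suc) ≈⟨ pre (≈-sym (L-⨾ _ _)) ⟩
    copy (φ zero) ▸ L (copy (φ zero) ▸ L wireᵗ (φ ∘ suc)) ∎≈
  wireᵗ-copy φ (suc j) =
    (copy (φ zero) ▸ L wireᵗ (φ ∘ suc)) ▸ L copy j ▸ sᵗ ≈⟨ ⨾-assoc _ _ _ ⟩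
    copy (φ zero) ▸ L wireᵗ (φ ∘ suc) ▸ L copy j ▸ sᵗ ≈⟨ pre (pull₁ (L₂ (wireᵗ-copy (φ ∘ suc) j))) ⟩
    copy (φ zero) ▸ L (copy (φ (suc j)) ▸ L wireᵗ (φ ∘ suc)) ▸ sᵗ
      ≈⟨ pre (≈-trans (post (L-⨾ _ _)) (⨾-assoc _ _ _)) ⟩
    copy (φ zero) ▸ L copy (φ (suc j)) ▸ L L wireᵗ (φ ∘ suc) ▸ sᵗ ≈⟨ pre (pre (≈-sym (s-natural _))) ⟩
    copy (φ zero) ▸ L copy (φ (suc j)) ▸ sᵗ ▸ L L wireᵗ (φ ∘ suc)
      ≈⟨ ≈-trans (pre (≈-sym (⨾-assoc _ _ _))) (pull₂ (copy-comm _ _)) ⟩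
    copy (φ (suc j)) ▸ L copy (φ zero) ▸ L L wireᵗ (φ ∘ suc) ≈⟨ pre (≈-sym (L-⨾ _ _)) ⟩
    copy (φ (suc j)) ▸ L (copy (φ zero) ▸ L wireᵗ (φ ∘ suc)) ∎≈

  wireᵗ-discard : ∀ {p q} (φ : Fin q → Fin p) → wireᵗ φ ▸ discard q ≈ discard p
  wireᵗ-discard {q = zero}  φ = ⨾-identityʳ _
  wireᵗ-discard {q = suc q} φ =
    (copy (φ zero) ▸ L wireᵗ (φ ∘ suc)) ▸ eᵗ ▸ discard q ≈⟨ ⨾-assoc _ _ _ ⟩
    copy (φ zero) ▸ L wireᵗ (φ ∘ suc) ▸ eᵗ ▸ discard q ≈⟨ pre (pull₂ (≈-sym (e-natural _))) ⟩
    copy (φ zero) ▸ eᵗ ▸ wireᵗ (φ ∘ suc) ▸ discard q ≈⟨ cancel (copy-e _) ⟩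
    wireᵗ (φ ∘ suc) ▸ discard q ≈⟨ wireᵗ-discard (φ ∘ suc) ⟩
    discard _ ∎≈

  -- Induction over the outputs of the second wiring, with `wireᵗ-discard` as base and `wireᵗ-copy`
  -- as step. The order is reversed since functions point from outputs to sources.
  wireᵗ-∘ : ∀ {p q r} (φ : Fin q → Fin p) (ψ : Fin r → Fin q) → wireᵗ φ ▸ wireᵗ ψ ≈ wireᵗ (φ ∘ ψ)
  wireᵗ-∘ {r = zero}  φ ψ = wireᵗ-discard φ
  wireᵗ-∘ {r = suc r} φ ψ =
    wireᵗ φ ▸ copy (ψ zero) ▸ L wireᵗ (ψ ∘ suc) ≈⟨ pull₂ (wireᵗ-copy φ _) ⟩
    copy (φ (ψ zero)) ▸ L wireᵗ φ ▸ L wireᵗ (ψ ∘ suc) ≈⟨ pre (L₂ (wireᵗ-∘ φ (ψ ∘ suc))) ⟩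
    copy (φ (ψ zero)) ▸ L wireᵗ (φ ∘ ψ ∘ suc) ∎≈

  wireᵗ-suc : ∀ {p q} (φ : Fin q → Fin p) → wireᵗ (suc ∘ φ) ≈ eᵗ ▸ wireᵗ φ
  wireᵗ-suc {q = zero}  φ = ≈-refl
  wireᵗ-suc {q = suc q} φ =
    (L copy (φ zero) ▸ sᵗ) ▸ L wireᵗ (suc ∘ φ ∘ suc) ≈⟨ ⨾-assoc _ _ _ ⟩
    L copy (φ zero) ▸ sᵗ ▸ L wireᵗ (suc ∘ φ ∘ suc)
      ≈⟨ pre (pre (≈-trans (L-cong (wireᵗ-suc (φ ∘ suc))) (L-⨾ _ _))) ⟩
    L copy (φ zero) ▸ sᵗ ▸ L eᵗ ▸ L wireᵗ (φ ∘ suc) ≈⟨ pre (pull₁ s-Le) ⟩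
    L copy (φ zero) ▸ eᵗ ▸ L wireᵗ (φ ∘ suc) ≈⟨ pull₂ (≈-sym (e-natural _)) ⟩
    eᵗ ▸ copy (φ zero) ▸ L wireᵗ (φ ∘ suc) ∎≈

  -- After wire 0 is copied to output 0 nothing else uses it, so `wireᵗ-suc` discards it and the
  -- counit law removes the copy.
  L-wireᵗ : ∀ {p q} (φ : Fin q → Fin p) → L wireᵗ φ ≈ wireᵗ (lift 1 φ)
  L-wireᵗ φ = ≈-sym (≈-trans (pre (≈-trans (L-cong (wireᵗ-suc φ)) (L-⨾ _ _))) (cancel d-Le))

  wireᵗ-id : ∀ {p} → wireᵗ {p} (λ i → i) ≈ id
  wireᵗ-id {zero}  = ≈-refl
  wireᵗ-id {suc p} = ≈-trans (wireᵗ-cong {φ = λ i → i} {ψ = lift 1 (λ i → i)} (λ { zero → refl ; (suc i) → refl }))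
    (≈-trans (≈-sym (L-wireᵗ (λ i → i))) (≈-trans (L-cong wireᵗ-id) ⊗-id))

  wireᵗ-id′ : ∀ {p} {φ : Fin p → Fin p} → (∀ i → φ i ≡ i) → wireᵗ φ ≈ id
  wireᵗ-id′ h = ≈-trans (wireᵗ-cong h) wireᵗ-id

  infixr 7 _⊕ᶠ_
  _⊕ᶠ_ : ∀ {m n p q} → (Fin n → Fin m) → (Fin q → Fin p) → Fin (n + q) → Fin (m + p)
  _⊕ᶠ_ = _⊗ᶠ_ {S = S}

  id-⊗ : ∀ k {p q} (f : Tm p q) → id {n = suc k} ⊗ f ≈ L (id {n = k} ⊗ f)
  id-⊗ k f = ≈-trans (⊗-cong (≈-sym ⊗-id) ≈-refl) (⊗-assoc (id {n = 1}) (id {n = k}) f)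

  id-⊗-wireᵗ : ∀ k {p q} (φ : Fin q → Fin p) → id {n = k} ⊗ wireᵗ φ ≈ wireᵗ ((λ (i : Fin k) → i) ⊕ᶠ φ)
  id-⊗-wireᵗ zero    φ = ⊗-identityˡ _
  id-⊗-wireᵗ (suc k) φ = ≈-trans (id-⊗ k _) (≈-trans (L-cong (id-⊗-wireᵗ k φ))
    (≈-trans (L-wireᵗ ((λ (i : Fin k) → i) ⊕ᶠ φ)) (wireᵗ-cong {φ = lift 1 ((λ (i : Fin k) → i) ⊕ᶠ φ)} {ψ = (λ (i : Fin (suc k)) → i) ⊕ᶠ φ}
      (λ { zero → refl ; (suc i) → ext i }))))
    where
    ext : ∀ i → lift 1 ((λ (i : Fin k) → i) ⊕ᶠ φ) (suc i) ≡ ((λ (i : Fin (suc k)) → i) ⊕ᶠ φ) (suc i)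
    ext i with splitAt k i
    ... | inj₁ _ = refl
    ... | inj₂ _ = refl

  copy-⊗ : ∀ {p} k (i : Fin p) → copy i ⊗ id {n = k} ≈ copy (i ↑ˡ k)
  copy-⊗ k zero    = ≈-trans (⊗-assoc (Δ S) id id) (⊗-cong ≈-refl ⊗-id)
  copy-⊗ k (suc i) = ≈-trans (whisker-⨾ _ _) (⨾-cong
    (≈-trans (≈-sym (L-whisker _)) (L-cong (copy-⊗ k i)))
    (≈-trans (⊗-assoc (σ 1 1) id id) (⊗-cong ≈-refl ⊗-id)))

  discard-⊗ : ∀ p k → discard p ⊗ id {n = k} ≈ wireᵗ (p ↑ʳ_)
  discard-⊗ zero    k = ≈-trans ⊗-id (≈-sym wireᵗ-id)
  discard-⊗ (suc p) k = ≈-trans (whisker-⨾ _ _) (≈-trans (⨾-cong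
    (≈-trans (⊗-assoc (ε S) id id) (⊗-cong ≈-refl ⊗-id)) (discard-⊗ p k)) (≈-sym (wireᵗ-suc (p ↑ʳ_))))

  wireᵗ-⊗-id : ∀ k {p q} (φ : Fin q → Fin p) → wireᵗ φ ⊗ id {n = k} ≈ wireᵗ (φ ⊕ᶠ (λ (i : Fin k) → i))
  wireᵗ-⊗-id k {p} {zero}  φ = discard-⊗ p k
  wireᵗ-⊗-id k {p} {suc q} φ = ≈-trans (whisker-⨾ _ _) (⨾-cong (copy-⊗ k _)
    (≈-trans (≈-sym (L-whisker _)) (L-cong (≈-trans (wireᵗ-⊗-id k (φ ∘ suc)) (wireᵗ-cong ext)))))
    where
    ext : ∀ i → ((φ ∘ suc) ⊕ᶠ (λ (i : Fin k) → i)) i ≡ (φ ⊕ᶠ (λ (i : Fin k) → i)) (suc i)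
    ext i with splitAt q i
    ... | inj₁ _ = refl
    ... | inj₂ _ = refl

  wireᵗ-⊗ : ∀ {m n p q} (φ : Fin n → Fin m) (ψ : Fin q → Fin p) → wireᵗ φ ⊗ wireᵗ ψ ≈ wireᵗ (φ ⊕ᶠ ψ)
  wireᵗ-⊗ {m} {n} {p} {q} φ ψ = ≈-trans (⊗-split _ _)
    (≈-trans (⨾-cong (wireᵗ-⊗-id p φ) (id-⊗-wireᵗ n ψ)) (≈-trans (wireᵗ-∘ _ _) (wireᵗ-cong
      (split-ind n _
        (λ i → trans (cong (φ ⊕ᶠ idp) (⊗ᶠ-ˡ {S = S} idn ψ i))
                 (trans (⊗ᶠ-ˡ {S = S} φ idp i) (sym (⊗ᶠ-ˡ {S = S} φ ψ i))))
        (λ j → trans (cong (φ ⊕ᶠ idp) (⊗ᶠ-ʳ {S = S} idn ψ j))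
                 (trans (⊗ᶠ-ʳ {S = S} φ idp (ψ j)) (sym (⊗ᶠ-ʳ {S = S} φ ψ j))))))))
    where
    idn : Fin n → Fin n
    idn i = i
    idp : Fin p → Fin p
    idp i = i

  wireᵗ-subst : ∀ {m m′ n n′} (p : m ≡ m′) (q : n ≡ n′) (ρ : Fin n → Fin m) →
                subst₂ Tm p q (wireᵗ ρ) ≈ wireᵗ (cast p ∘ ρ ∘ cast (sym q))
  wireᵗ-subst refl refl ρ = wireᵗ-cong (λ x → sym (trans (cast-id refl _) (cong ρ (cast-id refl x))))

  subst-conj : ∀ {m m′ n n′} (p : m ≡ m′) (q : n ≡ n′) (f : Tm m n) →
               subst₂ Tm p q f ≈ wireᵗ (cast p) ▸ f ▸ wireᵗ (cast (sym q))
  subst-conj refl refl f = ≈-sym (≈-trans (⨾-cong (wireᵗ-id′ (cast-id refl))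
    (≈-trans (pre (wireᵗ-id′ (cast-id refl))) (⨾-identityʳ f))) (⨾-identityˡ f))

  subst-cong₂ : ∀ {m m′ n n′} (p : m ≡ m′) (q : n ≡ n′) {f g : Tm m n} → f ≈ g →
                subst₂ Tm p q f ≈ subst₂ Tm p q g
  subst-cong₂ refl refl h = h

  inverse-unique : ∀ {m n} {f : Tm m n} {g g′ : Tm n m} → g ▸ f ≈ id → f ▸ g′ ≈ id → g ≈ g′
  inverse-unique {f = f} {g} {g′} p q =
    g ≈⟨ ≈-sym (⨾-identityʳ g) ⟩
    g ▸ id ≈⟨ pre (≈-sym q) ⟩
    g ▸ f ▸ g′ ≈⟨ cancel p ⟩
    g′ ∎≈

  -- The left legs are identities, so the isomorphism of apices is the identity on vertices and the
  -- right legs must agree. Coherences already known for cospans thus become equalities of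
  -- functions.
  wire-reflect : ∀ {m n} {ρ ρ′ : Fin n → Fin m} → wire {S = S} ρ ≈ᶜ wire ρ′ → ρ ≗ ρ′
  wire-reflect p i = trans (sym (_≐_.V≐ (_≈ᶜ_.left-comm p) _)) (_≐_.V≐ (_≈ᶜ_.right-comm p) i)

  -- The functions agree because the corresponding wirings of cospans do.
  hexagonᶠ : ∀ m n p →
    let a = +-assoc m n p ; b = +-assoc n m p ; d = sym (+-assoc n p m) in
    swapFin (n + p) m ≗ (cast a ∘ (swapFin n m ⊕ᶠ (λ (i : Fin p) → i)) ∘ cast (sym b))
                        ∘ (cast refl ∘ ((λ (i : Fin n) → i) ⊕ᶠ swapFin p m) ∘ cast (sym d))
  hexagonᶠ m n p = wire-reflect (≈ᶜ-trans (σᶜ-hexagon m n p) (≈ᶜ-trans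
    (⨾ᶜ-cong (≈ᶜ-trans (subst-cong a b (wire-⊗ (swapFin n m) idᶠ)) (subst-wire a b (swapFin n m ⊕ᶠ idᶠ)))
             (≈ᶜ-trans (subst-cong refl d (wire-⊗ idᶠ (swapFin p m))) (subst-wire refl d (idᶠ {n} ⊕ᶠ swapFin p m))))
    (wire-∘ (cast a ∘ (swapFin n m ⊕ᶠ idᶠ {p}) ∘ cast (sym b)) (cast refl ∘ (idᶠ {n} ⊕ᶠ swapFin p m) ∘ cast (sym d)))))
    where
    idᶠ : ∀ {k} → Fin k → Fin k
    idᶠ i = i
    a = +-assoc m n p
    b = +-assoc n m p
    d = sym (+-assoc n p m)

  σ-hexagon-wireᵗ : ∀ m n p → σ m n ≈ wireᵗ (swapFin n m) → σ m p ≈ wireᵗ (swapFin p m) →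
                    σ m (n + p) ≈ wireᵗ (swapFin (n + p) m)
  σ-hexagon-wireᵗ m n p x y = ≈-trans (σ-hexagon m n p) (≈-trans
    (⨾-cong (≈-trans (subst-cong₂ a b (≈-trans (⊗-cong x (≈-sym wireᵗ-id)) (wireᵗ-⊗ (swapFin n m) idᶠ)))
              (wireᵗ-subst a b (swapFin n m ⊕ᶠ idᶠ)))
            (≈-trans (subst-cong₂ refl d (≈-trans (⊗-cong (≈-sym wireᵗ-id) y) (wireᵗ-⊗ idᶠ (swapFin p m))))
              (wireᵗ-subst refl d (idᶠ {n} ⊕ᶠ swapFin p m))))
    (≈-trans (wireᵗ-∘ (cast a ∘ (swapFin n m ⊕ᶠ idᶠ {p}) ∘ cast (sym b)) (cast refl ∘ (idᶠ {n} ⊕ᶠ swapFin p m) ∘ cast (sym d)))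
      (wireᵗ-cong (λ i → sym (hexagonᶠ m n p i)))))
    where
    idᶠ : ∀ {k} → Fin k → Fin k
    idᶠ i = i
    a = +-assoc m n p
    b = +-assoc n m p
    d = sym (+-assoc n p m)

  σ-wireᵗ₀ : ∀ m → σ m 0 ≈ wireᵗ (swapFin 0 m)
  σ-wireᵗ₀ m = ≈-trans (σ-unitʳ m) (go (+-identityʳ m) (swapFin 0 m)
    (λ i → trans (cast-inv (sym (+-identityʳ m)) (+-identityʳ m) (lem i)) refl))
    where
    lem : ∀ i → cast (sym (+-identityʳ m)) i ≡ i ↑ˡ 0
    lem i = toℕ-injective (trans (toℕ-cast _ i) (sym (toℕ-↑ˡ i 0)))
    go : ∀ {k} (eq : k ≡ m) (ρ : Fin m → Fin k) → (∀ i → cast eq (ρ i) ≡ i) → castᵗ eq ≈ wireᵗ ρ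
    go refl ρ h = ≈-sym (wireᵗ-id′ (λ i → trans (sym (cast-id refl _)) (h i)))

  s-wireᵗ : σ 1 1 ≈ wireᵗ (swapFin 1 1)
  s-wireᵗ = ≈-sym (
    wireᵗ (swapFin 1 1) ≈⟨ ≈-refl ⟩
    (L dᵗ ▸ sᵗ) ▸ L wireᵗ (λ (i : Fin 1) → swapFin 1 1 (suc i))
      ≈⟨ pre (L-cong (≈-trans (wireᵗ-cong {φ = swapFin 1 1 ∘ suc} {ψ = lift {0} {1} 1 (λ ())} (λ { zero → refl }))
           (≈-trans (≈-sym (L-wireᵗ {1} {0} (λ ()))) (L-cong (⨾-identityʳ _))))) ⟩
    (L dᵗ ▸ sᵗ) ▸ L L eᵗ ≈⟨ ≈-trans (⨾-assoc _ _ _) (pre (s-natural _)) ⟩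
    L dᵗ ▸ L L eᵗ ▸ sᵗ ≈⟨ cancel (≈-trans (L₂ d-Le) ⊗-id) ⟩
    sᵗ {0} ≈⟨ ≈-trans (≈-sym (subst₂-irr _ _ _)) (⊗-identityʳ (σ 1 1)) ⟩
    σ 1 1 ∎≈)

  σ₁-wireᵗ : ∀ n → σ 1 n ≈ wireᵗ (swapFin n 1)
  σ₁-wireᵗ zero    = σ-wireᵗ₀ 1
  σ₁-wireᵗ (suc n) = σ-hexagon-wireᵗ 1 1 n s-wireᵗ (σ₁-wireᵗ n)

  -- The hexagon splits only the second argument of `σ`, so induction reaches `σ 1 n` but not
  -- `σ n 1`. The latter is obtained as its inverse.
  σ-wireᵗ₁ : ∀ n → σ n 1 ≈ wireᵗ (swapFin 1 n)
  σ-wireᵗ₁ n = inverse-unique {f = σ 1 n} {g′ = wireᵗ (swapFin 1 n)} (σ-involutive n 1)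
    (≈-trans (post (σ₁-wireᵗ n)) (≈-trans (wireᵗ-∘ (swapFin n 1) (swapFin 1 n)) (wireᵗ-id′ {φ = swapFin n 1 ∘ swapFin 1 n} (swap-swap 1 n))))

  σ-wireᵗ : ∀ m n → σ m n ≈ wireᵗ (swapFin n m)
  σ-wireᵗ m zero    = σ-wireᵗ₀ m
  σ-wireᵗ m (suc n) = σ-hexagon-wireᵗ m 1 n (σ-wireᵗ₁ m) (σ-wireᵗ m n)

  Δ-wireᵗ : Δ S ≈ wireᵗ {1} {2} (λ _ → zero)
  Δ-wireᵗ = ≈-sym (≈-trans (pre (≈-trans (L-cong (≈-trans (pre (L-cong (⨾-identityʳ _))) d-Le)) ⊗-id))
    (≈-trans (⨾-identityʳ _) (≈-trans (≈-sym (subst₂-irr _ _ _)) (⊗-identityʳ (Δ S)))))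

  ε-wireᵗ : ε S ≈ wireᵗ {1} {0} (λ ())
  ε-wireᵗ = ≈-sym (≈-trans (⨾-identityʳ _) (≈-trans (≈-sym (subst₂-irr _ _ _)) (⊗-identityʳ (ε S))))

-- Terms between coded objects

-- Codes for finite sets.  They let functions between tensor products of
-- objects be written on disjoint unions, so that their equalities are proved
-- by case analysis.
infixr 6 _✚_
data Ob : Set where
  fin : ℕ → Ob
  _✚_ : Ob → Ob → Ob

El : Ob → Set
El (fin n) = Fin n
El (A ✚ B) = El A ⊎ El B

size : Ob → ℕ
size (fin n) = n
size (A ✚ B) = size A + size B

enc : ∀ A → El A → Fin (size A)
enc (fin n) i = i
enc (A ✚ B) = join (size A) (size B) ∘ map⊎ (enc A) (enc B)

dec : ∀ A → Fin (size A) → El A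
dec (fin n) i = i
dec (A ✚ B) = map⊎ (dec A) (dec B) ∘ splitAt (size A)

dec-enc : ∀ A x → dec A (enc A x) ≡ x
dec-enc (fin n) x = refl
dec-enc (A ✚ B) (inj₁ a) = trans (cong (map⊎ (dec A) (dec B)) (splitAt-↑ˡ (size A) (enc A a) (size B)))
  (cong inj₁ (dec-enc A a))
dec-enc (A ✚ B) (inj₂ b) = trans (cong (map⊎ (dec A) (dec B)) (splitAt-↑ʳ (size A) (size B) (enc B b)))
  (cong inj₂ (dec-enc B b))

enc-dec : ∀ A i → enc A (dec A i) ≡ i
enc-dec (fin n) i = refl
enc-dec (A ✚ B) i = trans (lem (splitAt (size A) i)) (join-splitAt (size A) (size B) i)
  where
  lem : ∀ s → join (size A) (size B) (map⊎ (enc A) (enc B) (map⊎ (dec A) (dec B) s)) ≡ join (size A) (size B) s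
  lem (inj₁ x) = cong (_↑ˡ size B) (enc-dec A x)
  lem (inj₂ y) = cong (size A ↑ʳ_) (enc-dec B y)

-- On codes the cast along `+-assoc` is reassociation of a disjoint union. This is what removes
-- `subst₂` from the axioms on coded maps.
enc-assocʳ : ∀ A B C v → cast (+-assoc (size A) (size B) (size C)) (enc ((A ✚ B) ✚ C) v) ≡ enc (A ✚ (B ✚ C)) (assocʳ v)
enc-assocʳ A B C (inj₁ (inj₁ a)) = cast-inv (sym (+-assoc (size A) _ _)) (+-assoc (size A) _ _) (cast-₁ {size A} {size B} {size C} (sym (+-assoc (size A) _ _)) (enc A a))
enc-assocʳ A B C (inj₁ (inj₂ b)) = cast-inv (sym (+-assoc (size A) _ _)) (+-assoc (size A) _ _) (cast-₂ {size A} {size B} {size C} (sym (+-assoc (size A) _ _)) (enc B b))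
enc-assocʳ A B C (inj₂ c) = cast-inv (sym (+-assoc (size A) _ _)) (+-assoc (size A) _ _) (cast-₃ {size A} {size B} {size C} (sym (+-assoc (size A) _ _)) (enc C c))

enc-swap : ∀ A B v → swapFin (size A) (size B) (enc (A ✚ B) v) ≡ enc (B ✚ A) (swap v)
enc-swap A B (inj₁ a) = swap-ˡ (size A) (size B) (enc A a)
enc-swap A B (inj₂ b) = swap-ʳ (size A) (size B) (enc B b)

assocˡʳ : ∀ {A B C : Set} (x : A ⊎ B ⊎ C) → assocʳ (assocˡ x) ≡ x
assocˡʳ (inj₁ _) = refl
assocˡʳ (inj₂ (inj₁ _)) = refl
assocˡʳ (inj₂ (inj₂ _)) = refl

assocʳˡ : ∀ {A B C : Set} (x : (A ⊎ B) ⊎ C) → assocˡ (assocʳ x) ≡ x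
assocʳˡ (inj₁ (inj₁ _)) = refl
assocʳˡ (inj₁ (inj₂ _)) = refl
assocʳˡ (inj₂ _) = refl

module Coded {c} (S : Signature c) where

  open Free-Term S

  infix 3 _⇒_
  -- A record and not a synonym for terms: `size` is not injective, so the codes could not be
  -- recovered from the arities.
  record _⇒_ (A B : Ob) : Set c where
    constructor ⌜_⌝
    field term : Tm (size A) (size B)
  open _⇒_ public

  infix 4 _≋_
  record _≋_ {A B} (f g : A ⇒ B) : Set c where
    constructor mk≋
    field un≋ : term f ≈ term g
  open _≋_ public

  ≋-refl : ∀ {A B} {f : A ⇒ B} → f ≋ f
  ≋-refl = mk≋ ≈-refl

  ≋-sym : ∀ {A B} {f g : A ⇒ B} → f ≋ g → g ≋ f
  ≋-sym (mk≋ p) = mk≋ (≈-sym p)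

  ≋-trans : ∀ {A B} {f g h : A ⇒ B} → f ≋ g → g ≋ h → f ≋ h
  ≋-trans (mk≋ p) (mk≋ q) = mk≋ (≈-trans p q)

  infixr 2 _≋⟨_⟩_
  infix 3 _∎≋
  _≋⟨_⟩_ : ∀ {A B} (f : A ⇒ B) {g h : A ⇒ B} → f ≋ g → g ≋ h → f ≋ h
  _ ≋⟨ p ⟩ q = ≋-trans p q

  _∎≋ : ∀ {A B} (f : A ⇒ B) → f ≋ f
  _ ∎≋ = ≋-refl

  infixr 5 _∙_
  infixr 7 _⊛_

  -- Outside this block coded maps are handled only through the laws proved in it; the `term-`
  -- equations lead back to terms where the semantics needs them.
  abstract
    1ₕ : ∀ {A} → A ⇒ A
    1ₕ = ⌜ id ⌝

    _∙_ : ∀ {A B C} → A ⇒ B → B ⇒ C → A ⇒ C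
    f ∙ g = ⌜ term f ⨾ term g ⌝

    _⊛_ : ∀ {A B C D} → A ⇒ B → C ⇒ D → A ✚ C ⇒ B ✚ D
    f ⊛ g = ⌜ term f ⊗ term g ⌝

    ⟪_⟫ : ∀ {A B} → (El B → El A) → A ⇒ B
    ⟪_⟫ {A} {B} φ = ⌜ wireᵗ (enc A ∘ φ ∘ dec B) ⌝

    TR : ∀ X {A B} → X ✚ A ⇒ X ✚ B → A ⇒ B
    TR X f = ⌜ Tr (size X) (term f) ⌝

    term-1 : ∀ {A} → term (1ₕ {A}) ≡ id
    term-1 = refl

    term-∙ : ∀ {A B C} (f : A ⇒ B) (g : B ⇒ C) → term (f ∙ g) ≡ term f ⨾ term g
    term-∙ f g = refl

    term-⊛ : ∀ {A B C D} (f : A ⇒ B) (g : C ⇒ D) → term (f ⊛ g) ≡ term f ⊗ term g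
    term-⊛ f g = refl

    term-⟪⟫ : ∀ {A B} (φ : El B → El A) → term {A} {B} ⟪ φ ⟫ ≡ wireᵗ (enc A ∘ φ ∘ dec B)
    term-⟪⟫ φ = refl

    term-TR : ∀ X {A B} (f : X ✚ A ⇒ X ✚ B) → term (TR X f) ≡ Tr (size X) (term f)
    term-TR X f = refl

    ∙-cong : ∀ {A B C} {f f′ : A ⇒ B} {g g′ : B ⇒ C} → f ≋ f′ → g ≋ g′ → f ∙ g ≋ f′ ∙ g′
    ∙-cong (mk≋ p) (mk≋ q) = mk≋ (⨾-cong p q)

    ∙-assoc : ∀ {A B C D} {f : A ⇒ B} {g : B ⇒ C} {h : C ⇒ D} → (f ∙ g) ∙ h ≋ f ∙ g ∙ h
    ∙-assoc = mk≋ (⨾-assoc _ _ _)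

    ∙-idˡ : ∀ {A B} {f : A ⇒ B} → 1ₕ ∙ f ≋ f
    ∙-idˡ = mk≋ (⨾-identityˡ _)

    ∙-idʳ : ∀ {A B} {f : A ⇒ B} → f ∙ 1ₕ ≋ f
    ∙-idʳ = mk≋ (⨾-identityʳ _)

    ⊛-cong : ∀ {A B C D} {f f′ : A ⇒ B} {g g′ : C ⇒ D} → f ≋ f′ → g ≋ g′ → f ⊛ g ≋ f′ ⊛ g′
    ⊛-cong (mk≋ p) (mk≋ q) = mk≋ (⊗-cong p q)

    ⊛-id : ∀ {A B} → 1ₕ {A} ⊛ 1ₕ {B} ≋ 1ₕ
    ⊛-id = mk≋ ⊗-id

    ⊛-∙ : ∀ {A B C A′ B′ C′} {f : A ⇒ B} {g : B ⇒ C} {f′ : A′ ⇒ B′} {g′ : B′ ⇒ C′} →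
          (f ∙ g) ⊛ (f′ ∙ g′) ≋ (f ⊛ f′) ∙ (g ⊛ g′)
    ⊛-∙ = mk≋ (⊗-⨾ _ _ _ _)

    ⟪⟫-cong : ∀ {A B} {φ ψ : El B → El A} → φ ≗ ψ → ⟪_⟫ {A} {B} φ ≋ ⟪ ψ ⟫
    ⟪⟫-cong {A} {B} h = mk≋ (wireᵗ-cong (λ i → cong (enc A) (h (dec B i))))

    ⟪⟫-id : ∀ {A} → ⟪_⟫ {A} {A} (λ x → x) ≋ 1ₕ
    ⟪⟫-id {A} = mk≋ (wireᵗ-id′ {φ = enc A ∘ dec A} (enc-dec A))

    ⟪⟫-∙ : ∀ {A B C} {φ : El B → El A} {ψ : El C → El B} → ⟪_⟫ {A} {B} φ ∙ ⟪_⟫ {B} {C} ψ ≋ ⟪ φ ∘ ψ ⟫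
    ⟪⟫-∙ {A} {B} {C} {φ} {ψ} = mk≋ (≈-trans (wireᵗ-∘ (enc A ∘ φ ∘ dec B) (enc B ∘ ψ ∘ dec C))
      (wireᵗ-cong (λ i → cong (enc A ∘ φ) (dec-enc B (ψ (dec C i))))))

    ⟪⟫-⊛ : ∀ {A B C D} {φ : El B → El A} {ψ : El D → El C} →
           ⟪_⟫ {A} {B} φ ⊛ ⟪_⟫ {C} {D} ψ ≋ ⟪ map⊎ φ ψ ⟫
    ⟪⟫-⊛ {A} {B} {C} {D} {φ} {ψ} = mk≋ (≈-trans (wireᵗ-⊗ φ′ ψ′) (wireᵗ-cong (λ i → lem (splitAt (size B) i))))
      where
      φ′ : Fin (size B) → Fin (size A)
      φ′ = enc A ∘ φ ∘ dec B
      ψ′ : Fin (size D) → Fin (size C)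
      ψ′ = enc C ∘ ψ ∘ dec D
      lem : ∀ s → join (size A) (size C) ([ inj₁ ∘ φ′ , inj₂ ∘ ψ′ ]′ s)
                ≡ enc (A ✚ C) (map⊎ φ ψ (map⊎ (dec B) (dec D) s))
      lem (inj₁ _) = refl
      lem (inj₂ _) = refl

    private
      -- A cast of arities is a wiring on either side, so each axiom mediated by `subst₂` becomes a
      -- conjugation by functions on codes.
      cast-wire : ∀ A B {C D} (p : size A ≡ size C) (q : size B ≡ size D) {f : Tm (size A) (size B)}
                  (u : El A → El C) (v : El B → El D) (v⁻ : El D → El B) → (∀ x → v (v⁻ x) ≡ x) →
                  (∀ x → cast p (enc A x) ≡ enc C (u x)) → (∀ x → cast q (enc B x) ≡ enc D (v x)) →
                  subst₂ Tm p q f ≈ term (⟪_⟫ {C} {A} u) ⨾ (f ⨾ term (⟪_⟫ {B} {D} v⁻))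
      cast-wire A B {C} {D} p q {f} u v v⁻ vv⁻ hu hv = ≈-trans (subst-conj p q f) (⨾-cong
        (wireᵗ-cong (λ i → trans (cong (cast p) (sym (enc-dec A i))) (hu (dec A i))))
        (pre (wireᵗ-cong (λ i → cast-inv q (sym q)
          (trans (hv (v⁻ (dec D i))) (trans (cong (enc D) (vv⁻ _)) (enc-dec D i)))))))

      assoc-cast : ∀ X Y A B {f : Tm (size ((X ✚ Y) ✚ A)) (size ((X ✚ Y) ✚ B))} →
                   subst₂ Tm (+-assoc (size X) (size Y) (size A)) (+-assoc (size X) (size Y) (size B)) f
                   ≈ term (⟪_⟫ {X ✚ (Y ✚ A)} {(X ✚ Y) ✚ A} assocʳ) ⨾ (f ⨾ term (⟪_⟫ {(X ✚ Y) ✚ B} {X ✚ (Y ✚ B)} assocˡ))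
      assoc-cast X Y A B = cast-wire ((X ✚ Y) ✚ A) ((X ✚ Y) ✚ B) {X ✚ (Y ✚ A)} {X ✚ (Y ✚ B)} _ _
        assocʳ assocʳ assocˡ assocˡʳ (enc-assocʳ X Y A) (enc-assocʳ X Y B)

      assoc-cast₃ : ∀ A B C A′ B′ C′ {f : Tm (size ((A ✚ B) ✚ C)) (size ((A′ ✚ B′) ✚ C′))} →
                   subst₂ Tm (+-assoc (size A) (size B) (size C)) (+-assoc (size A′) (size B′) (size C′)) f
                   ≈ term (⟪_⟫ {A ✚ (B ✚ C)} {(A ✚ B) ✚ C} assocʳ) ⨾ (f ⨾ term (⟪_⟫ {(A′ ✚ B′) ✚ C′} {A′ ✚ (B′ ✚ C′)} assocˡ))
      assoc-cast₃ A B C A′ B′ C′ = cast-wire ((A ✚ B) ✚ C) ((A′ ✚ B′) ✚ C′) {A ✚ (B ✚ C)} {A′ ✚ (B′ ✚ C′)} _ _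
        assocʳ assocʳ assocˡ assocˡʳ (enc-assocʳ A B C) (enc-assocʳ A′ B′ C′)

      swap-wire : ∀ A B → σ (size A) (size B) ≈ term (⟪_⟫ {A ✚ B} {B ✚ A} swap)
      swap-wire A B = ≈-trans (σ-wireᵗ (size A) (size B)) (wireᵗ-cong (λ i →
        trans (cong (swapFin (size B) (size A)) (sym (enc-dec (B ✚ A) i))) (enc-swap B A (dec (B ✚ A) i))))

    assoc-⊛ : ∀ {A B C A′ B′ C′} {f : A ⇒ A′} {g : B ⇒ B′} {h : C ⇒ C′} →
              ⟪ assocʳ ⟫ ∙ ((f ⊛ g) ⊛ h) ∙ ⟪ assocˡ ⟫ ≋ f ⊛ (g ⊛ h)
    assoc-⊛ {A} {B} {C} {A′} {B′} {C′} = mk≋ (≈-trans (≈-sym (assoc-cast₃ A B C A′ B′ C′)) (⊗-assoc _ _ _))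

    swap-⊛ : ∀ {A B A′ B′} {f : A ⇒ A′} {g : B ⇒ B′} → (f ⊛ g) ∙ ⟪ swap ⟫ ≋ ⟪ swap ⟫ ∙ (g ⊛ f)
    swap-⊛ {A} {B} {A′} {B′} = mk≋ (≈-trans (pre (≈-sym (swap-wire A′ B′)))
      (≈-trans (σ-natural _ _) (post (swap-wire A B))))

    unit-⊛ : ∀ {A B} {f : A ⇒ B} → (1ₕ {fin 0} ⊛ f) ∙ ⟪ inj₂ ⟫ ≋ ⟪ inj₂ ⟫ ∙ f
    unit-⊛ {A} {B} = mk≋ (≈-trans (⨾-cong (⊗-identityˡ _) (wireᵗ-id′ {φ = enc B ∘ dec B} (enc-dec B)))
      (≈-trans (≈-trans (⨾-identityʳ _) (≈-sym (⨾-identityˡ _))) (post (≈-sym (wireᵗ-id′ {φ = enc A ∘ dec A} (enc-dec A))))))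

    TR-cong : ∀ X {A B} {f g : X ✚ A ⇒ X ✚ B} → f ≋ g → TR X f ≋ TR X g
    TR-cong X (mk≋ p) = mk≋ (Tr-cong _ p)

    TR-tighten : ∀ X {A B A′ B′} {g : A′ ⇒ A} {f : X ✚ A ⇒ X ✚ B} {h : B ⇒ B′} →
                 TR X ((1ₕ ⊛ g) ∙ f ∙ (1ₕ ⊛ h)) ≋ g ∙ TR X f ∙ h
    TR-tighten X = mk≋ (≈-trans (Tr-cong _ (≈-sym (⨾-assoc _ _ _)))
      (≈-trans (tightening _ _ _ _) (⨾-assoc _ _ _)))

    TR-slide : ∀ X Y {A B} {f : X ✚ A ⇒ Y ✚ B} {g : Y ⇒ X} → TR X (f ∙ (g ⊛ 1ₕ)) ≋ TR Y ((g ⊛ 1ₕ) ∙ f)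
    TR-slide X Y = mk≋ (sliding _ _ _ _)

    TR-vanish₀ : ∀ {A B} {f : fin 0 ✚ A ⇒ fin 0 ✚ B} →
                 TR (fin 0) f ≋ ⟪ [ (λ ()) , (λ x → x) ]′ ⟫ ∙ f ∙ ⟪ inj₂ ⟫
    TR-vanish₀ {A} {B} = mk≋ (≈-trans (vanishing₀ _) (≈-sym (≈-trans
      (⨾-cong (wireᵗ-id′ {φ = enc A ∘ dec A} (enc-dec A)) (pre (wireᵗ-id′ {φ = enc B ∘ dec B} (enc-dec B))))
      (≈-trans (⨾-identityˡ _) (⨾-identityʳ _)))))

    TR-vanish₊ : ∀ X Y {A B} {f : (X ✚ Y) ✚ A ⇒ (X ✚ Y) ✚ B} →
                 TR (X ✚ Y) f ≋ TR Y (TR X (⟪ assocʳ ⟫ ∙ f ∙ ⟪ assocˡ ⟫))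
    TR-vanish₊ X Y {A} {B} = mk≋ (≈-trans (vanishing₊ _ _ _) (Tr-cong _ (Tr-cong _ (assoc-cast X Y A B))))

    TR-superpose : ∀ X {A B C D} {f : X ✚ A ⇒ X ✚ B} {g : C ⇒ D} →
                   TR X (⟪ assocʳ ⟫ ∙ (f ⊛ g) ∙ ⟪ assocˡ ⟫) ≋ TR X f ⊛ g
    TR-superpose X {A} {B} {C} {D} = mk≋ (≈-trans (Tr-cong _ (≈-sym (assoc-cast₃ X A C X B D))) (superposing _ _ _))

    TR-yank : ∀ X → TR X (⟪_⟫ {X ✚ X} {X ✚ X} swap) ≋ 1ₕ
    TR-yank X = mk≋ (≈-trans (Tr-cong _ (≈-sym (swap-wire X X))) (yanking _))

    -- `A` and `fin (size A)` are different codes of one arity. The wirings along `dec` and `enc`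
    -- between them are identities as terms.
    recode : ∀ {A B} (t : Tm (size A) (size B)) →
             _≋_ {A} {B} ⌜ t ⌝ (⟪_⟫ {A} {fin (size A)} (dec A) ∙ (⌜_⌝ {fin (size A)} {fin (size B)} t ∙ ⟪_⟫ {fin (size B)} {B} (enc B)))
    recode {A} {B} t = mk≋ (≈-sym (≈-trans (⨾-cong (wireᵗ-id′ {φ = enc A ∘ dec A} (enc-dec A))
      (pre (wireᵗ-id′ {φ = enc B ∘ dec B} (enc-dec B)))) (≈-trans (⨾-identityˡ _) (⨾-identityʳ _))))

    recode⁻ : ∀ {A B} (t : Tm (size A) (size B)) →
              _≋_ {fin (size A)} {fin (size B)} ⌜ t ⌝
                (⟪_⟫ {fin (size A)} {A} (enc A) ∙ (⌜_⌝ {A} {B} t ∙ ⟪_⟫ {B} {fin (size B)} (dec B)))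
    recode⁻ {A} {B} t = mk≋ (≈-sym (≈-trans (⨾-cong (wireᵗ-id′ {φ = enc A ∘ dec A} (enc-dec A))
      (pre (wireᵗ-id′ {φ = enc B ∘ dec B} (enc-dec B)))) (≈-trans (⨾-identityˡ _) (⨾-identityʳ _))))

    ⟪⟫-fin : ∀ {m n} (φ : Fin n → Fin m) → wireᵗ φ ≈ term (⟪_⟫ {fin m} {fin n} φ)
    ⟪⟫-fin φ = ≈-refl

-- Calculus of wirings and traces

swap₁₂ : ∀ {A B C : Set} → A ⊎ B ⊎ C → B ⊎ A ⊎ C
swap₁₂ (inj₁ a)        = inj₂ (inj₁ a)
swap₁₂ (inj₂ (inj₁ b)) = inj₁ b
swap₁₂ (inj₂ (inj₂ c)) = inj₂ (inj₂ c)

mid₄ : ∀ {A B C D : Set} → (A ⊎ B) ⊎ (C ⊎ D) → (A ⊎ C) ⊎ (B ⊎ D)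
mid₄ (inj₁ (inj₁ a)) = inj₁ (inj₁ a)
mid₄ (inj₁ (inj₂ b)) = inj₂ (inj₁ b)
mid₄ (inj₂ (inj₁ c)) = inj₁ (inj₂ c)
mid₄ (inj₂ (inj₂ d)) = inj₂ (inj₂ d)

mid₄-mid₄ : ∀ {A B C D : Set} (x : (A ⊎ B) ⊎ (C ⊎ D)) → mid₄ (mid₄ x) ≡ x
mid₄-mid₄ (inj₁ (inj₁ _)) = refl
mid₄-mid₄ (inj₁ (inj₂ _)) = refl
mid₄-mid₄ (inj₂ (inj₁ _)) = refl
mid₄-mid₄ (inj₂ (inj₂ _)) = refl

module Wiring {c} (S : Signature c) where

  open Coded S

  after : ∀ {A B C} {f : A ⇒ B} {g h : B ⇒ C} → g ≋ h → f ∙ g ≋ f ∙ h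
  after p = ∙-cong ≋-refl p

  before : ∀ {A B C} {f g : A ⇒ B} {h : B ⇒ C} → f ≋ g → f ∙ h ≋ g ∙ h
  before p = ∙-cong p ≋-refl

  merge : ∀ {A B C D} {f : A ⇒ B} {g : B ⇒ C} {h : A ⇒ C} {k : C ⇒ D} → f ∙ g ≋ h → f ∙ g ∙ k ≋ h ∙ k
  merge p = ≋-trans (≋-sym ∙-assoc) (before p)

  wires₂ : ∀ {A B C D} {φ : El B → El A} {ψ : El C → El B} {k : C ⇒ D} →
           ⟪_⟫ {A} {B} φ ∙ ⟪ ψ ⟫ ∙ k ≋ ⟪ φ ∘ ψ ⟫ ∙ k
  wires₂ = merge ⟪⟫-∙

  ⟪⟫-id′ : ∀ {A} {φ : El A → El A} → (∀ x → φ x ≡ x) → ⟪_⟫ {A} {A} φ ≋ 1ₕ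
  ⟪⟫-id′ h = ≋-trans (⟪⟫-cong h) ⟪⟫-id

  wire-⊛ˡ : ∀ {A B C} {φ : El B → El A} → ⟪_⟫ {A} {B} φ ⊛ 1ₕ {C} ≋ ⟪ map₁ φ ⟫
  wire-⊛ˡ = ≋-trans (⊛-cong ≋-refl (≋-sym ⟪⟫-id)) ⟪⟫-⊛

  wire-⊛ʳ : ∀ {A B C} {φ : El B → El A} → 1ₕ {C} ⊛ ⟪_⟫ {A} {B} φ ≋ ⟪ map₂ φ ⟫
  wire-⊛ʳ = ≋-trans (⊛-cong (≋-sym ⟪⟫-id) ≋-refl) ⟪⟫-⊛

  ⊛-split : ∀ {A B C D} {f : A ⇒ B} {g : C ⇒ D} → f ⊛ g ≋ (f ⊛ 1ₕ) ∙ (1ₕ ⊛ g)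
  ⊛-split = ≋-trans (⊛-cong (≋-sym ∙-idʳ) (≋-sym ∙-idˡ)) ⊛-∙

  ⊛-∙ˡ : ∀ {A B C D} {f : A ⇒ B} {g : B ⇒ C} → (f ∙ g) ⊛ 1ₕ {D} ≋ (f ⊛ 1ₕ) ∙ (g ⊛ 1ₕ)
  ⊛-∙ˡ = ≋-trans (⊛-cong ≋-refl (≋-sym ∙-idˡ)) ⊛-∙

  -- Pure wiring before and after a map. Nested occurrences fuse by `W-W`, after which structural
  -- equations come down to pointwise equality of two functions, settled by cases.
  W : ∀ {A A′ B B′} → (El A′ → El A) → A′ ⇒ B′ → (El B → El B′) → A ⇒ B
  W {A} {A′} {B} {B′} u f v = ⟪_⟫ {A} {A′} u ∙ f ∙ ⟪_⟫ {B′} {B} v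

  W-cong : ∀ {A A′ B B′} {u u′ : El A′ → El A} {f f′ : A′ ⇒ B′} {v v′ : El B → El B′} →
           u ≗ u′ → f ≋ f′ → v ≗ v′ → W {A} {A′} {B} {B′} u f v ≋ W u′ f′ v′
  W-cong p q r = ∙-cong (⟪⟫-cong p) (∙-cong q (⟪⟫-cong r))

  W-W : ∀ {A A′ A″ B B′ B″} {u : El A′ → El A} {u′ : El A″ → El A′} {f : A″ ⇒ B″}
        {v′ : El B′ → El B″} {v : El B → El B′} →
        W {A} {A′} {B} {B′} u (W {A′} {A″} {B′} {B″} u′ f v′) v ≋ W {A} {A″} {B} {B″} (u ∘ u′) f (v′ ∘ v)
  W-W = ≋-trans (after (≋-trans ∙-assoc (after (≋-trans ∙-assoc (after ⟪⟫-∙))))) wires₂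

  W-id : ∀ {A B} {u : El A → El A} {f : A ⇒ B} {v : El B → El B} →
         (∀ x → u x ≡ x) → (∀ x → v x ≡ x) → W {A} {A} {B} {B} u f v ≋ f
  W-id p q = ≋-trans (∙-cong (⟪⟫-id′ p) (≋-trans (after (⟪⟫-id′ q)) ∙-idʳ)) ∙-idˡ

  W-adjoint : ∀ {A A′ B B′} {u : El A′ → El A} {u⁻ : El A → El A′} {f : A′ ⇒ B′} {g : A ⇒ B}
              {v : El B → El B′} {v⁻ : El B′ → El B} →
              (∀ x → u⁻ (u x) ≡ x) → (∀ x → v (v⁻ x) ≡ x) →
              W {A} {A′} {B} {B′} u f v ≋ g → f ≋ W {A′} {A} {B′} {B} u⁻ g v⁻
  W-adjoint p q h = ≋-trans (≋-sym (W-id p q)) (≋-trans (≋-sym W-W) (∙-cong ≋-refl (∙-cong h ≋-refl)))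

  TR-W : ∀ {X A A′ B B′} {u : El A′ → El A} {f : X ✚ A′ ⇒ X ✚ B′} {v : El B → El B′} →
         W {A} {A′} {B} {B′} u (TR X f) v ≋ TR X (W (map₂ u) f (map₂ v))
  TR-W {X} = ≋-trans (≋-sym (TR-tighten X)) (TR-cong X (∙-cong wire-⊛ʳ (after wire-⊛ʳ)))

  TR-merge : ∀ X Y {A A′ B B′} {u : El A′ → El (X ✚ (Y ✚ A))} {f : A′ ⇒ B′} {v : El (X ✚ (Y ✚ B)) → El B′} →
             TR Y (TR X (W {_} {A′} {_} {B′} u f v)) ≋ TR (X ✚ Y) (W (assocˡ ∘ u) f (v ∘ assocʳ))
  TR-merge X Y {u = u} {v = v} = ≋-sym (≋-trans (TR-vanish₊ X Y) (TR-cong Y (TR-cong X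
    (≋-trans W-W (W-cong (λ x → assocˡʳ (u x)) ≋-refl (λ x → cong v (assocˡʳ x)))))))

  -- The wirings along `u⁻` and then `u` compose to the identity and can be inserted on the traced
  -- output; sliding takes the second of them round the loop.
  TR-conj : ∀ {X X′ A B} (u : El X → El X′) (u⁻ : El X′ → El X) → (∀ x → u⁻ (u x) ≡ x) →
            {f : X ✚ A ⇒ X ✚ B} →
            TR X f ≋ TR X′ (W {X′ ✚ A} {X ✚ A} {X′ ✚ B} {X ✚ B} (map₁ u) f (map₁ u⁻))
  TR-conj {X} {X′} u u⁻ inv {f} =
    TR X f ≋⟨ TR-cong X (≋-sym (≋-trans ∙-assoc (≋-trans (after (≋-trans (≋-sym ⊛-∙ˡ)
                (≋-trans (⊛-cong (≋-trans ⟪⟫-∙ (⟪⟫-id′ inv)) ≋-refl) ⊛-id))) ∙-idʳ))) ⟩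
    TR X ((f ∙ (⟪_⟫ {X} {X′} u⁻ ⊛ 1ₕ)) ∙ (⟪ u ⟫ ⊛ 1ₕ)) ≋⟨ TR-slide X X′ ⟩
    TR X′ ((⟪ u ⟫ ⊛ 1ₕ) ∙ f ∙ (⟪ u⁻ ⟫ ⊛ 1ₕ)) ≋⟨ TR-cong X′ (∙-cong wire-⊛ˡ (after wire-⊛ˡ)) ⟩
    _ ∎≋

  -- Both iterated traces are one trace over the sum, and `TR-conj` exchanges the summands.
  TR-swap : ∀ X Y {A B} {f : X ✚ (Y ✚ A) ⇒ X ✚ (Y ✚ B)} →
            TR Y (TR X f) ≋ TR X (TR Y (W {Y ✚ (X ✚ A)} {_} {Y ✚ (X ✚ B)} swap₁₂ f swap₁₂))
  TR-swap X Y {A} {B} {f} =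
    TR Y (TR X f) ≋⟨ TR-cong Y (TR-cong X (≋-sym (W-id {u = λ x → x} {v = λ x → x} (λ _ → refl) (λ _ → refl)))) ⟩
    TR Y (TR X (W (λ x → x) f (λ x → x))) ≋⟨ TR-merge X Y ⟩
    TR (X ✚ Y) (W assocˡ f assocʳ)
      ≋⟨ TR-conj {X ✚ Y} {Y ✚ X} swap swap (λ { (inj₁ _) → refl ; (inj₂ _) → refl }) ⟩
    TR (Y ✚ X) (W (map₁ swap) (W assocˡ f assocʳ) (map₁ swap))
      ≋⟨ TR-cong (Y ✚ X) (≋-trans W-W (W-cong
           (λ { (inj₁ _) → refl ; (inj₂ (inj₁ _)) → refl ; (inj₂ (inj₂ _)) → refl }) ≋-refl
           (λ { (inj₁ (inj₁ _)) → refl ; (inj₁ (inj₂ _)) → refl ; (inj₂ _) → refl }))) ⟩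
    TR (Y ✚ X) (W (assocˡ ∘ swap₁₂) f (swap₁₂ ∘ assocʳ)) ≋⟨ ≋-sym (TR-merge Y X) ⟩
    _ ∎≋

  assoc-W : ∀ {A B C A′ B′ C′} {f : A ⇒ A′} {g : B ⇒ B′} {h : C ⇒ C′} →
            W assocʳ ((f ⊛ g) ⊛ h) assocˡ ≋ f ⊛ (g ⊛ h)
  assoc-W = assoc-⊛

  assoc-W′ : ∀ {A B C A′ B′ C′} {f : A ⇒ A′} {g : B ⇒ B′} {h : C ⇒ C′} →
             (f ⊛ g) ⊛ h ≋ W assocˡ (f ⊛ (g ⊛ h)) assocʳ
  assoc-W′ {A} {B} {C} {A′} {B′} {C′} = W-adjoint
    assocʳˡ assocʳˡ assoc-⊛

  swap-W : ∀ {A B A′ B′} {f : A ⇒ A′} {g : B ⇒ B′} → f ⊛ g ≋ W swap (g ⊛ f) swap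
  swap-W {f = f} {g} = ≋-sym (≋-trans (after swap-⊛) (≋-trans wires₂
    (≋-trans (before (⟪⟫-id′ (λ { (inj₁ _) → refl ; (inj₂ _) → refl }))) ∙-idˡ)))

  ⊛-W : ∀ {A A′ B B′ C C′ D D′} {u : El A′ → El A} {f : A′ ⇒ B′} {v : El B → El B′}
        {u′ : El C′ → El C} {g : C′ ⇒ D′} {v′ : El D → El D′} →
        W {A} {A′} {B} {B′} u f v ⊛ W {C} {C′} {D} {D′} u′ g v′ ≋ W (map⊎ u u′) (f ⊛ g) (map⊎ v v′)
  ⊛-W = ≋-trans ⊛-∙ (∙-cong ⟪⟫-⊛ (≋-trans ⊛-∙ (after ⟪⟫-⊛)))

  ⊛-Wˡ : ∀ {A A′ B B′ C D} {u : El A′ → El A} {f : A′ ⇒ B′} {v : El B → El B′} {g : C ⇒ D} →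
        W {A} {A′} {B} {B′} u f v ⊛ g ≋ W (map₁ u) (f ⊛ g) (map₁ v)
  ⊛-Wˡ = ≋-trans (⊛-cong ≋-refl (≋-sym (W-id {u = λ x → x} {v = λ x → x} (λ _ → refl) (λ _ → refl)))) ⊛-W

  ⊛-Wʳ : ∀ {A A′ B B′ C D} {u : El A′ → El A} {f : A′ ⇒ B′} {v : El B → El B′} {g : C ⇒ D} →
        g ⊛ W {A} {A′} {B} {B′} u f v ≋ W (map₂ u) (g ⊛ f) (map₂ v)
  ⊛-Wʳ = ≋-trans (⊛-cong (≋-sym (W-id {u = λ x → x} {v = λ x → x} (λ _ → refl) (λ _ → refl))) ≋-refl) ⊛-W

  swap₁₂-W : ∀ {A B C A′ B′ C′} {f : A ⇒ A′} {g : B ⇒ B′} {h : C ⇒ C′} →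
             f ⊛ (g ⊛ h) ≋ W swap₁₂ (g ⊛ (f ⊛ h)) swap₁₂
  swap₁₂-W {f = f} {g} {h} =
    f ⊛ (g ⊛ h) ≋⟨ ≋-sym assoc-W ⟩
    W assocʳ ((f ⊛ g) ⊛ h) assocˡ ≋⟨ ∙-cong ≋-refl (before (≋-trans (⊛-cong swap-W ≋-refl) ⊛-Wˡ)) ⟩
    W assocʳ (W (map₁ swap) ((g ⊛ f) ⊛ h) (map₁ swap)) assocˡ ≋⟨ W-W ⟩
    W (assocʳ ∘ map₁ swap) ((g ⊛ f) ⊛ h) (map₁ swap ∘ assocˡ)
      ≋⟨ ∙-cong ≋-refl (before assoc-W′) ⟩
    W (assocʳ ∘ map₁ swap) (W assocˡ (g ⊛ (f ⊛ h)) assocʳ) (map₁ swap ∘ assocˡ)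
      ≋⟨ ≋-trans W-W (W-cong
           (λ { (inj₁ _) → refl ; (inj₂ (inj₁ _)) → refl ; (inj₂ (inj₂ _)) → refl }) ≋-refl
           (λ { (inj₁ _) → refl ; (inj₂ (inj₁ _)) → refl ; (inj₂ (inj₂ _)) → refl })) ⟩
    _ ∎≋

  mid₄-W : ∀ {A B C D A′ B′ C′ D′} {f : A ⇒ A′} {g : B ⇒ B′} {h : C ⇒ C′} {k : D ⇒ D′} →
           (f ⊛ g) ⊛ (h ⊛ k) ≋ W mid₄ ((f ⊛ h) ⊛ (g ⊛ k)) mid₄
  mid₄-W {f = f} {g} {h} {k} =
    (f ⊛ g) ⊛ (h ⊛ k) ≋⟨ assoc-W′ ⟩
    W assocˡ (f ⊛ (g ⊛ (h ⊛ k))) assocʳ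
      ≋⟨ ∙-cong ≋-refl (before (≋-trans (⊛-cong ≋-refl swap₁₂-W) ⊛-Wʳ)) ⟩
    W assocˡ (W (map₂ swap₁₂) (f ⊛ (h ⊛ (g ⊛ k))) (map₂ swap₁₂)) assocʳ ≋⟨ W-W ⟩
    W (assocˡ ∘ map₂ swap₁₂) (f ⊛ (h ⊛ (g ⊛ k))) (map₂ swap₁₂ ∘ assocʳ)
      ≋⟨ ∙-cong ≋-refl (before (≋-sym assoc-W)) ⟩
    W (assocˡ ∘ map₂ swap₁₂) (W assocʳ ((f ⊛ h) ⊛ (g ⊛ k)) assocˡ) (map₂ swap₁₂ ∘ assocʳ)
      ≋⟨ ≋-trans W-W (W-cong ext ≋-refl ext) ⟩
    _ ∎≋
    where
    ext : ∀ {A B C D : Set} (x : (A ⊎ C) ⊎ (B ⊎ D)) → assocˡ {A = A} (map₂ swap₁₂ (assocʳ x)) ≡ mid₄ x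
    ext (inj₁ (inj₁ _)) = refl
    ext (inj₁ (inj₂ _)) = refl
    ext (inj₂ (inj₁ _)) = refl
    ext (inj₂ (inj₂ _)) = refl

  TR-swap₁₂ : ∀ X {A} → TR X (⟪_⟫ {X ✚ (X ✚ A)} {X ✚ (X ✚ A)} swap₁₂) ≋ 1ₕ
  TR-swap₁₂ X {A} =
    TR X ⟪ swap₁₂ ⟫ ≋⟨ TR-cong X (≋-sym (≋-trans (∙-cong ≋-refl (≋-trans (before wire-⊛ˡ) ⟪⟫-∙)) (≋-trans ⟪⟫-∙ (⟪⟫-cong
      (λ { (inj₁ _) → refl ; (inj₂ (inj₁ _)) → refl ; (inj₂ (inj₂ _)) → refl }))))) ⟩
    TR X (⟪ assocʳ ⟫ ∙ (⟪_⟫ {X ✚ X} {X ✚ X} swap ⊛ 1ₕ) ∙ ⟪ assocˡ ⟫) ≋⟨ TR-superpose X ⟩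
    TR X ⟪ swap ⟫ ⊛ 1ₕ ≋⟨ ≋-trans (⊛-cong (TR-yank X) ≋-refl) ⊛-id ⟩
    1ₕ ∎≋

  -- Since every traced wire is fed by an input, the wiring factors through a crossing of `X` with
  -- itself, which yanking straightens. The effect is substitution: each use of a traced wire `x`
  -- becomes a use of `a x`.
  TR-wire : ∀ X {A B} (ψ : El (X ✚ B) → El (X ✚ A)) (a : El X → El A) →
            (∀ x → ψ (inj₁ x) ≡ inj₂ (a x)) →
            TR X (⟪_⟫ {X ✚ A} {X ✚ B} ψ) ≋ ⟪ [ a , (λ y → y) ]′ ∘ ψ ∘ inj₂ ⟫
  TR-wire X {A} {B} ψ a h =
    TR X ⟪ ψ ⟫ ≋⟨ TR-cong X (≋-sym (≋-trans (∙-cong wire-⊛ʳ (≋-trans (after wire-⊛ʳ) ⟪⟫-∙)) (≋-trans ⟪⟫-∙ (⟪⟫-cong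
      (λ { (inj₁ x) → sym (h x) ; (inj₂ y) → lem (ψ (inj₂ y)) }))))) ⟩
    TR X ((1ₕ ⊛ ⟪ [ a , (λ y → y) ]′ ⟫) ∙ ⟪ swap₁₂ ⟫ ∙ (1ₕ ⊛ ⟪_⟫ {X ✚ A} {B} (ψ ∘ inj₂)))
      ≋⟨ TR-tighten X ⟩
    ⟪ [ a , (λ y → y) ]′ ⟫ ∙ TR X ⟪ swap₁₂ ⟫ ∙ ⟪ ψ ∘ inj₂ ⟫
      ≋⟨ after (≋-trans (before (TR-swap₁₂ X)) ∙-idˡ) ⟩
    ⟪ [ a , (λ y → y) ]′ ⟫ ∙ ⟪ ψ ∘ inj₂ ⟫ ≋⟨ ⟪⟫-∙ ⟩
    _ ∎≋
    where
    lem : ∀ z → map₂ [ a , (λ y → y) ]′ (swap₁₂ (inj₂ z)) ≡ z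
    lem (inj₁ _) = refl
    lem (inj₂ _) = refl

  -- The box b with its outputs fed back.  φ gives the source of each input of b
  -- and of each output, among the outputs of b and the inputs.
  M : ∀ {A B C D} (b : D ⇒ C) (φ : El (D ✚ B) → El (C ✚ A)) → A ⇒ B
  M {C = C} b φ = TR C (⟪ φ ⟫ ∙ (b ⊛ 1ₕ))

  M-cong : ∀ {A B C D} {b : D ⇒ C} {φ φ′ : El (D ✚ B) → El (C ✚ A)} → φ ≗ φ′ →
           M {A} {B} b φ ≋ M b φ′
  M-cong {C = C} h = TR-cong C (before (⟪⟫-cong h))

  M-W : ∀ {A B C D} {b : D ⇒ C} {u : El (D ✚ B) → El (C ✚ A)} {v : El (C ✚ B) → El (C ✚ B)} →
        (∀ x → v x ≡ x) → TR C (W {C ✚ A} {D ✚ B} {C ✚ B} {C ✚ B} u (b ⊛ 1ₕ) v) ≋ M b u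
  M-W {C = C} h = TR-cong C (after (≋-trans (after (⟪⟫-id′ h)) ∙-idʳ))

  M-pre : ∀ {A A′ B C D} {b : D ⇒ C} {φ : El (D ✚ B) → El (C ✚ A)} (u : El A → El A′) →
          ⟪_⟫ {A′} {A} u ∙ M b φ ≋ M b (map₂ u ∘ φ)
  M-pre {A} {A′} {B} {C} {D} {b} {φ} u =
    ⟪_⟫ {A′} {A} u ∙ M b φ ≋⟨ ≋-sym (after (≋-trans (after (⟪⟫-id′ {φ = λ x → x} (λ _ → refl))) ∙-idʳ)) ⟩
    W u (M b φ) (λ x → x) ≋⟨ TR-W ⟩
    TR C (W (map₂ u) (⟪ φ ⟫ ∙ (b ⊛ 1ₕ)) (map₂ (λ x → x)))
      ≋⟨ TR-cong C (≋-trans (after ∙-assoc) wires₂) ⟩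
    _ ≋⟨ M-W (λ { (inj₁ _) → refl ; (inj₂ _) → refl }) ⟩
    _ ∎≋

  -- The square rewrites `b` as `b′` between the renumberings `P⁻` and `Q`. Sliding `Q` round the
  -- feedback lets the wiring absorb both.
  M-conj : ∀ {A B C D C′ D′} {b : D ⇒ C} {b′ : D′ ⇒ C′} {φ : El (D ✚ B) → El (C ✚ A)}
           (φ′ : El (D′ ✚ B) → El (C′ ✚ A))
           (P : El D → El D′) (P⁻ : El D′ → El D) (Q : El C → El C′) →
           (∀ x → P⁻ (P x) ≡ x) → (∀ x → P (P⁻ x) ≡ x) →
           ⟪_⟫ {D′} {D} P ∙ b ≋ b′ ∙ ⟪_⟫ {C′} {C} Q →
           (∀ x → φ′ (map₁ P x) ≡ map₁ Q (φ x)) →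
           M b φ ≋ M b′ φ′
  M-conj {A} {B} {C} {D} {C′} {D′} {b} {b′} {φ} φ′ P P⁻ Q P⁻P PP⁻ square h =
    TR C (⟪ φ ⟫ ∙ (b ⊛ 1ₕ)) ≋⟨ TR-cong C (≋-trans (after (≋-trans (⊛-cong b≋ ≋-refl)
                                    (≋-trans ⊛-∙ˡ (after ⊛-∙ˡ)))) (≋-trans (≋-sym ∙-assoc) (≋-sym ∙-assoc))) ⟩
    TR C (((⟪ φ ⟫ ∙ (⟪ P⁻ ⟫ ⊛ 1ₕ)) ∙ (b′ ⊛ 1ₕ)) ∙ (⟪ Q ⟫ ⊛ 1ₕ)) ≋⟨ TR-slide C C′ ⟩
    TR C′ ((⟪ Q ⟫ ⊛ 1ₕ) ∙ (⟪ φ ⟫ ∙ (⟪ P⁻ ⟫ ⊛ 1ₕ)) ∙ (b′ ⊛ 1ₕ))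
      ≋⟨ TR-cong C′ (merge (≋-trans (∙-cong wire-⊛ˡ (≋-trans (after wire-⊛ˡ) ⟪⟫-∙)) (≋-trans ⟪⟫-∙
           (⟪⟫-cong (λ x → trans (sym (h _)) (cong φ′ (lem x))))))) ⟩
    TR C′ (⟪ φ′ ⟫ ∙ (b′ ⊛ 1ₕ)) ∎≋
    where
    b≋ : b ≋ ⟪_⟫ {D} {D′} P⁻ ∙ b′ ∙ ⟪_⟫ {C′} {C} Q
    b≋ = ≋-sym (≋-trans (after (≋-sym square)) (≋-trans wires₂ (≋-trans (before (⟪⟫-id′ P⁻P)) ∙-idˡ)))
    lem : ∀ x → map₁ P (map₁ P⁻ x) ≡ x
    lem (inj₁ x) = cong inj₁ (PP⁻ x)
    lem (inj₂ x) = refl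

-- Hyperedges are indexed by Fin k; ⨁ k f is the set of all their ports when
-- edge i has f i of them.
⨁ : ∀ k → (Fin k → ℕ) → Ob
⨁ zero    f = fin 0
⨁ (suc k) f = fin (f zero) ✚ ⨁ k (f ∘ suc)

infixr 5 _⊹_
_⊹_ : ∀ {a} {A : Set a} {k l} → (Fin k → A) → (Fin l → A) → Fin (k + l) → A
_⊹_ {k = zero}  f g i       = g i
_⊹_ {k = suc k} f g zero    = f zero
_⊹_ {k = suc k} f g (suc i) = ((f ∘ suc) ⊹ g) i

⨁-⊹ : ∀ {a} {A : Set a} (h : A → ℕ) {k l} (f : Fin k → A) (g : Fin l → A) →
      El (⨁ k (h ∘ f)) ⊎ El (⨁ l (h ∘ g)) → El (⨁ (k + l) (h ∘ (f ⊹ g)))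
⨁-⊹ h {zero}  f g (inj₂ y)        = y
⨁-⊹ h {suc k} f g (inj₁ (inj₁ x)) = inj₁ x
⨁-⊹ h {suc k} f g (inj₁ (inj₂ x)) = inj₂ (⨁-⊹ h (f ∘ suc) g (inj₁ x))
⨁-⊹ h {suc k} f g (inj₂ y)        = inj₂ (⨁-⊹ h (f ∘ suc) g (inj₂ y))

⨁-⊹⁻ : ∀ {a} {A : Set a} (h : A → ℕ) {k l} (f : Fin k → A) (g : Fin l → A) →
       El (⨁ (k + l) (h ∘ (f ⊹ g))) → El (⨁ k (h ∘ f)) ⊎ El (⨁ l (h ∘ g))
⨁-⊹⁻ h {zero}  f g y        = inj₂ y
⨁-⊹⁻ h {suc k} f g (inj₁ x) = inj₁ (inj₁ x)
⨁-⊹⁻ h {suc k} f g (inj₂ y) = map₁ inj₂ (⨁-⊹⁻ h (f ∘ suc) g y)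

⨁-⊹⁻-⊹ : ∀ {a} {A : Set a} (h : A → ℕ) {k l} (f : Fin k → A) (g : Fin l → A) x →
         ⨁-⊹⁻ h f g (⨁-⊹ h f g x) ≡ x
⨁-⊹⁻-⊹ h {zero}  f g (inj₂ y)        = refl
⨁-⊹⁻-⊹ h {suc k} f g (inj₁ (inj₁ x)) = refl
⨁-⊹⁻-⊹ h {suc k} f g (inj₁ (inj₂ x)) = cong (map₁ inj₂) (⨁-⊹⁻-⊹ h (f ∘ suc) g (inj₁ x))
⨁-⊹⁻-⊹ h {suc k} f g (inj₂ y)        = cong (map₁ inj₂) (⨁-⊹⁻-⊹ h (f ∘ suc) g (inj₂ y))

⨁-⊹-⊹⁻ : ∀ {a} {A : Set a} (h : A → ℕ) {k l} (f : Fin k → A) (g : Fin l → A) y →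
         ⨁-⊹ h f g (⨁-⊹⁻ h f g y) ≡ y
⨁-⊹-⊹⁻ h {zero}  f g y        = refl
⨁-⊹-⊹⁻ h {suc k} f g (inj₁ x) = refl
⨁-⊹-⊹⁻ h {suc k} f g (inj₂ y) = trans (lem (⨁-⊹⁻ h (f ∘ suc) g y)) (cong inj₂ (⨁-⊹-⊹⁻ h (f ∘ suc) g y))
  where
  lem : ∀ z → ⨁-⊹ h f g (map₁ inj₂ z) ≡ inj₂ (⨁-⊹ h (f ∘ suc) g z)
  lem (inj₁ _) = refl
  lem (inj₂ _) = refl

-- Feedback normal forms

module Closure {c} (S : Signature c) where

  open Coded S
  open Wiring S
  open Signature S

  -- The newly traced wires join the feedback as boxes that are identities, so a trace only changes
  -- the wiring by reassociation.
  M-trace : ∀ {X A B C D} {b : D ⇒ C} {φ : El (D ✚ (X ✚ B)) → El (C ✚ (X ✚ A))} →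
            TR X (M b φ) ≋ M (b ⊛ 1ₕ {X}) (assocˡ ∘ φ ∘ assocʳ)
  M-trace {X} {A} {B} {C} {D} {b} {φ} =
    TR X (TR C (⟪ φ ⟫ ∙ (b ⊛ 1ₕ)))
      ≋⟨ TR-cong X (TR-cong C (≋-trans (after (≋-trans (⊛-cong ≋-refl (≋-sym ⊛-id)) (≋-sym assoc-W))) wires₂)) ⟩
    TR X (TR C (W (φ ∘ assocʳ) ((b ⊛ 1ₕ) ⊛ 1ₕ) assocˡ)) ≋⟨ TR-merge C X ⟩
    TR (C ✚ X) (W (assocˡ ∘ φ ∘ assocʳ) ((b ⊛ 1ₕ) ⊛ 1ₕ) (assocˡ ∘ assocʳ))
      ≋⟨ M-W (λ { (inj₁ (inj₁ _)) → refl ; (inj₁ (inj₂ _)) → refl ; (inj₂ _) → refl }) ⟩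
    _ ∎≋

  ⊛-TR : ∀ X {A B C D} {f : A ⇒ B} {g : X ✚ C ⇒ X ✚ D} →
         f ⊛ TR X g ≋ TR X (W (map₂ swap ∘ assocʳ) (g ⊛ f) (assocˡ ∘ map₂ swap))
  ⊛-TR X {f = f} {g} =
    f ⊛ TR X g ≋⟨ swap-W ⟩
    W swap (TR X g ⊛ f) swap ≋⟨ ∙-cong ≋-refl (before (≋-sym (TR-superpose X))) ⟩
    W swap (TR X (W assocʳ (g ⊛ f) assocˡ)) swap ≋⟨ TR-W ⟩
    TR X (W (map₂ swap) (W assocʳ (g ⊛ f) assocˡ) (map₂ swap))
      ≋⟨ TR-cong X W-W ⟩
    _ ∎≋

  -- Superposing pulls out the trace of each factor and the feedbacks merge. The trace of the second
  -- factor ends up innermost, and `TR-merge` lists the inner object first; hence the reversed order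
  -- of the boxes.
  M-⊛ : ∀ {A B C D A′ B′ C′ D′} {b : D ⇒ C} {φ : El (D ✚ B) → El (C ✚ A)}
        {b′ : D′ ⇒ C′} {φ′ : El (D′ ✚ B′) → El (C′ ✚ A′)} →
        M {A} {B} b φ ⊛ M {A′} {B′} b′ φ′ ≋ M (b′ ⊛ b) (map₂ swap ∘ mid₄ ∘ map⊎ φ′ φ ∘ mid₄ ∘ map₂ swap)
  M-⊛ {A} {B} {C} {D} {A′} {B′} {C′} {D′} {b} {φ} {b′} {φ′} =
    TR C x ⊛ TR C′ x′ ≋⟨ ≋-sym (TR-superpose C) ⟩
    TR C (W assocʳ (x ⊛ TR C′ x′) assocˡ)
      ≋⟨ TR-cong C (∙-cong ≋-refl (before (≋-trans (⊛-TR C′) (TR-cong C′ (∙-cong ≋-refl (before boxes)))))) ⟩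
    TR C (W assocʳ (TR C′ (W (map₂ swap ∘ assocʳ)
                             (W (map⊎ φ′ φ ∘ mid₄) ((b′ ⊛ b) ⊛ 1ₕ) mid₄)
                             (assocˡ ∘ map₂ swap))) assocˡ)
      ≋⟨ TR-cong C (≋-trans TR-W (TR-cong C′ (≋-trans (∙-cong ≋-refl (before W-W)) W-W))) ⟩
    TR C (TR C′ (W _ ((b′ ⊛ b) ⊛ 1ₕ) _)) ≋⟨ TR-merge C′ C ⟩
    TR (C′ ✚ C) (W {(C′ ✚ C) ✚ (A ✚ A′)} {(D′ ✚ D) ✚ (B′ ✚ B)} {(C′ ✚ C) ✚ (B ✚ B′)} {(C′ ✚ C) ✚ (B′ ✚ B)}
                   _ ((b′ ⊛ b) ⊛ 1ₕ) _)
      ≋⟨ TR-cong (C′ ✚ C) (W-cong {u′ = map₂ swap ∘ mid₄ ∘ map⊎ φ′ φ ∘ mid₄}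
           {v′ = map₂ swap}
           (λ y → ext (map⊎ φ′ φ (mid₄ y))) ≋-refl
           (λ { (inj₁ (inj₁ _)) → refl ; (inj₁ (inj₂ _)) → refl ; (inj₂ (inj₁ _)) → refl ; (inj₂ (inj₂ _)) → refl })) ⟩
    TR (C′ ✚ C) (W (map₂ swap ∘ mid₄ ∘ map⊎ φ′ φ ∘ mid₄) ((b′ ⊛ b) ⊛ 1ₕ {B′ ✚ B}) (map₂ swap))
      ≋⟨ TR-cong (C′ ✚ C) (after (≋-trans (after (≋-sym wire-⊛ʳ)) slide)) ⟩
    TR (C′ ✚ C) (⟪ map₂ swap ∘ mid₄ ∘ map⊎ φ′ φ ∘ mid₄ ⟫ ∙ ⟪ map₂ swap ⟫ ∙ ((b′ ⊛ b) ⊛ 1ₕ))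
      ≋⟨ TR-cong (C′ ✚ C) wires₂ ⟩
    _ ∎≋
    where
    x = ⟪ φ ⟫ ∙ (b ⊛ 1ₕ)
    x′ = ⟪ φ′ ⟫ ∙ (b′ ⊛ 1ₕ)
    boxes : x′ ⊛ x ≋ W (map⊎ φ′ φ ∘ mid₄) ((b′ ⊛ b) ⊛ 1ₕ) mid₄
    boxes = ≋-trans ⊛-∙ (≋-trans (∙-cong ⟪⟫-⊛ (≋-trans mid₄-W (∙-cong ≋-refl (before (⊛-cong ≋-refl ⊛-id))))) wires₂)
    slide : ∀ {X Y E F} {f : X ⇒ Y} {φ : El E → El F} → (f ⊛ 1ₕ) ∙ (1ₕ ⊛ ⟪_⟫ {F} {E} φ) ≋ ⟪ map₂ φ ⟫ ∙ (f ⊛ 1ₕ)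
    slide = ≋-trans (≋-sym ⊛-split) (≋-trans (≋-trans (⊛-cong (≋-sym ∙-idˡ) (≋-sym ∙-idʳ)) ⊛-∙) (before wire-⊛ʳ))
    ext : ∀ {C′ A′ C A : Set} (z : (C′ ⊎ A′) ⊎ (C ⊎ A)) →
          assocˡ (map₂ assocʳ (map₂ swap (assocʳ z))) ≡ map₂ swap (mid₄ z)
    ext (inj₁ (inj₁ _)) = refl
    ext (inj₁ (inj₂ _)) = refl
    ext (inj₂ (inj₁ _)) = refl
    ext (inj₂ (inj₂ _)) = refl

  M-wire : ∀ {A B} (φ : El B → El A) → ⟪_⟫ {A} {B} φ ≋ M (1ₕ {fin 0}) (map₂ φ)
  M-wire φ = ≋-sym (≋-trans TR-vanish₀ (≋-trans (after (≋-trans ∙-assoc (after (≋-trans (before ⊛-id) ∙-idˡ))))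
    (≋-trans wires₂ ⟪⟫-∙)))

  -- Sliding the box round its own feedback leaves the trace of a crossing, which is yanked
  -- straight.
  M-gen : ∀ {A B} (f : A ⇒ B) → f ≋ M f swap
  M-gen {A} {B} f = ≋-sym (
    TR B (⟪ swap ⟫ ∙ (f ⊛ 1ₕ)) ≋⟨ TR-slide B A ⟩
    TR A ((f ⊛ 1ₕ) ∙ ⟪ swap ⟫) ≋⟨ TR-cong A (≋-trans swap-⊛ (≋-sym (≋-trans (before ⊛-id) ∙-idˡ))) ⟩
    TR A ((1ₕ ⊛ 1ₕ) ∙ ⟪ swap ⟫ ∙ (1ₕ ⊛ f)) ≋⟨ TR-tighten A ⟩
    1ₕ ∙ TR A ⟪ swap ⟫ ∙ f ≋⟨ ≋-trans ∙-idˡ (≋-trans (before (TR-yank A)) ∙-idˡ) ⟩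
    f ∎≋)

  -- Composition is a trace of a tensor, so closure of normal forms under composition follows from
  -- closure under tensor and trace.
  ∙-TR : ∀ {A B C} (f : A ⇒ B) (g : B ⇒ C) → f ∙ g ≋ TR B (⟪ swap ⟫ ∙ (f ⊛ g))
  ∙-TR {A} {B} f g = ≋-sym (
    TR B (⟪ swap ⟫ ∙ (f ⊛ g))
      ≋⟨ TR-cong B (≋-trans (after ⊛-split) (≋-trans (≋-sym ∙-assoc) (≋-sym (≋-trans (before ⊛-id) ∙-idˡ)))) ⟩
    TR B ((1ₕ ⊛ 1ₕ) ∙ (⟪ swap ⟫ ∙ (f ⊛ 1ₕ)) ∙ (1ₕ ⊛ g)) ≋⟨ TR-tighten B ⟩
    1ₕ ∙ TR B (⟪ swap ⟫ ∙ (f ⊛ 1ₕ)) ∙ g ≋⟨ ≋-trans ∙-idˡ (before (≋-sym (M-gen f))) ⟩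
    f ∙ g ∎≋)

  -- The hypothesis says that the wires of `X` are fed from outside `X`. Exchanging the traces
  -- brings the trace over `X` inside, where the boxes `b` do not touch its wires and `TR-wire`
  -- substitutes them away.
  M-elim : ∀ {X A B C D} {b : D ⇒ C} {φ : El ((D ✚ X) ✚ B) → El ((C ✚ X) ✚ A)} (a : El X → El (C ✚ A)) →
           (∀ x → φ (inj₁ (inj₂ x)) ≡ map₁ inj₁ (a x)) →
           M {A} {B} (b ⊛ 1ₕ {X}) φ ≋ M b ([ a , (λ y → y) ]′ ∘ swap₁₂ ∘ assocʳ ∘ φ ∘ map₁ inj₁)
  M-elim {X} {A} {B} {C} {D} {b} {φ} a h =
    M (b ⊛ 1ₕ) φ ≋⟨ M-cong (λ x → sym (trans (assocʳˡ (φ (assocˡ (assocʳ x)))) (cong φ (assocʳˡ x)))) ⟩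
    M (b ⊛ 1ₕ) (assocˡ ∘ φ₁ ∘ assocʳ) ≋⟨ ≋-sym M-trace ⟩
    TR X (TR C (⟪ φ₁ ⟫ ∙ (b ⊛ 1ₕ))) ≋⟨ TR-swap C X ⟩
    TR C (TR X (W swap₁₂ (⟪ φ₁ ⟫ ∙ (b ⊛ 1ₕ)) swap₁₂))
      ≋⟨ TR-cong C (TR-cong X (≋-trans (after (≋-trans ∙-assoc (after (before
           (≋-trans (⊛-cong ≋-refl (≋-sym ⊛-id)) swap₁₂-W))))) (≋-trans wires₂
           (≋-trans (after (≋-trans ∙-assoc (after (≋-trans ∙-assoc (≋-trans (after (≋-trans ⟪⟫-∙ (⟪⟫-id′ swap₁₂²))) ∙-idʳ))))) wires₂)))) ⟩
    TR C (TR X (⟪ swap₁₂ ∘ φ₁ ∘ swap₁₂ ⟫ ∙ (1ₕ ⊛ (b ⊛ 1ₕ))))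
      ≋⟨ TR-cong C (≋-trans (TR-cong X (≋-sym (≋-trans (before ⊛-id) ∙-idˡ))) (≋-trans (TR-tighten X) ∙-idˡ)) ⟩
    TR C (TR X ⟪ swap₁₂ ∘ φ₁ ∘ swap₁₂ ⟫ ∙ (b ⊛ 1ₕ))
      ≋⟨ TR-cong C (before (TR-wire X (swap₁₂ ∘ φ₁ ∘ swap₁₂) a (λ x → trans (cong (swap₁₂ ∘ assocʳ) (h x)) (lem (a x))))) ⟩
    TR C (⟪ [ a , (λ y → y) ]′ ∘ swap₁₂ ∘ φ₁ ∘ swap₁₂ ∘ inj₂ ⟫ ∙ (b ⊛ 1ₕ))
      ≋⟨ M-cong {φ′ = [ a , (λ y → y) ]′ ∘ swap₁₂ ∘ assocʳ ∘ φ ∘ map₁ inj₁}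
           (λ { (inj₁ _) → refl ; (inj₂ _) → refl }) ⟩
    _ ∎≋
    where
    φ₁ : El (D ✚ (X ✚ B)) → El (C ✚ (X ✚ A))
    φ₁ = assocʳ ∘ φ ∘ assocˡ
    swap₁₂² : ∀ {A B C : Set} (x : A ⊎ B ⊎ C) → swap₁₂ (swap₁₂ x) ≡ x
    swap₁₂² (inj₁ _) = refl
    swap₁₂² (inj₂ (inj₁ _)) = refl
    swap₁₂² (inj₂ (inj₂ _)) = refl
    lem : ∀ {A B C : Set} (z : A ⊎ C) → swap₁₂ (assocʳ (map⊎ {A = A} {C = A ⊎ B} inj₁ (λ y → y) z)) ≡ inj₂ z
    lem (inj₁ _) = refl
    lem (inj₂ _) = refl

  M-post : ∀ {A B B′ C D} {b : D ⇒ C} {φ : El (D ✚ B) → El (C ✚ A)} (v : El B′ → El B) →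
           M {A} {B} b φ ∙ ⟪_⟫ {B} {B′} v ≋ M b (φ ∘ map₂ v)
  M-post {A} {B} {B′} {C} {D} {b} {φ} v =
    M b φ ∙ ⟪ v ⟫ ≋⟨ ≋-sym (≋-trans (before (⟪⟫-id′ {φ = λ x → x} (λ _ → refl))) ∙-idˡ) ⟩
    W (λ x → x) (M b φ) v ≋⟨ TR-W ⟩
    TR C (W (map₂ (λ x → x)) (⟪ φ ⟫ ∙ (b ⊛ 1ₕ)) (map₂ v))
      ≋⟨ TR-cong C (≋-trans (before (⟪⟫-id′ (λ { (inj₁ _) → refl ; (inj₂ _) → refl })))
           (≋-trans ∙-idˡ (≋-trans ∙-assoc (after (≋-trans (after (≋-sym wire-⊛ʳ)) (≋-trans (≋-sym ⊛-split)
             (≋-trans (≋-trans (⊛-cong (≋-sym ∙-idˡ) (≋-sym ∙-idʳ)) ⊛-∙) (before wire-⊛ʳ)))))))) ⟩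
    TR C (⟪ φ ⟫ ∙ ⟪ map₂ v ⟫ ∙ (b ⊛ 1ₕ)) ≋⟨ TR-cong C wires₂ ⟩
    _ ∎≋

  unit-⊛ʳ : ∀ {A B} {f : A ⇒ B} → (f ⊛ 1ₕ {fin 0}) ∙ ⟪ inj₁ ⟫ ≋ ⟪ inj₁ ⟫ ∙ f
  unit-⊛ʳ {f = f} =
    (f ⊛ 1ₕ) ∙ ⟪ inj₁ ⟫ ≋⟨ after (≋-sym ⟪⟫-∙) ⟩
    (f ⊛ 1ₕ) ∙ ⟪ swap ⟫ ∙ ⟪ inj₂ ⟫ ≋⟨ ≋-trans (merge swap-⊛) ∙-assoc ⟩
    ⟪ swap ⟫ ∙ (1ₕ ⊛ f) ∙ ⟪ inj₂ ⟫ ≋⟨ ≋-trans (after unit-⊛) wires₂ ⟩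
    ⟪ inj₁ ⟫ ∙ f ∎≋

  box : ∀ k (es : Fin k → Gen) → ⨁ k (dom ∘ es) ⇒ ⨁ k (cod ∘ es)
  box zero    es = 1ₕ
  box (suc k) es = ⌜ Term.gen (inj₁ (es zero)) ⌝ ⊛ box k (es ∘ suc)

  box-⊹ : ∀ {k l} (es : Fin k → Gen) (es′ : Fin l → Gen) →
          ⟪ ⨁-⊹ dom es es′ ⟫ ∙ (box k es ⊛ box l es′) ≋ box (k + l) (es ⊹ es′) ∙ ⟪ ⨁-⊹ cod es es′ ⟫
  box-⊹ {zero} {l} es es′ =
    ⟪ u ⟫ ∙ (1ₕ ⊛ box l es′)
      ≋⟨ after (≋-sym (≋-trans (after (≋-trans ⟪⟫-∙ (⟪⟫-id′ {φ = inj₂ ∘ ⨁-⊹ cod es es′} (λ { (inj₂ _) → refl })))) ∙-idʳ)) ⟩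
    ⟪ u ⟫ ∙ (1ₕ ⊛ box l es′) ∙ ⟪ inj₂ ⟫ ∙ ⟪ ⨁-⊹ cod es es′ ⟫
      ≋⟨ after (≋-trans (merge unit-⊛) ∙-assoc) ⟩
    ⟪ u ⟫ ∙ ⟪ inj₂ ⟫ ∙ box l es′ ∙ ⟪ ⨁-⊹ cod es es′ ⟫ ≋⟨ wires₂ ⟩
    ⟪ u ∘ inj₂ ⟫ ∙ box l es′ ∙ ⟪ ⨁-⊹ cod es es′ ⟫ ≋⟨ ≋-trans (before (⟪⟫-id′ (λ _ → refl))) ∙-idˡ ⟩
    _ ∎≋
    where
    u : El (fin 0 ✚ ⨁ l (dom ∘ es′)) → El (⨁ l (dom ∘ es′))
    u = ⨁-⊹ dom es es′
  box-⊹ {suc k} {l} es es′ =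
    ⟪ ⨁-⊹ dom es es′ ⟫ ∙ ((g ⊛ b) ⊛ box l es′) ≋⟨ before (≋-trans (⟪⟫-cong dec-⊹) (≋-sym ⟪⟫-∙)) ⟩
    (⟪ map₂ r ⟫ ∙ ⟪ assocʳ ⟫) ∙ ((g ⊛ b) ⊛ box l es′) ≋⟨ ≋-trans ∙-assoc (after assoc-nat) ⟩
    ⟪ map₂ r ⟫ ∙ (g ⊛ (b ⊛ box l es′)) ∙ ⟪ assocʳ ⟫ ≋⟨ merge (≋-trans (before (≋-sym wire-⊛ʳ))
        (≋-trans (≋-sym ⊛-∙) (≋-trans (⊛-cong (≋-trans ∙-idˡ (≋-sym ∙-idʳ)) (box-⊹ {k} (es ∘ suc) es′)) (≋-trans ⊛-∙ (after wire-⊛ʳ))))) ⟩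
    ((g ⊛ box (k + l) ((es ∘ suc) ⊹ es′)) ∙ ⟪ map₂ r′ ⟫) ∙ ⟪ assocʳ ⟫
      ≋⟨ ≋-trans ∙-assoc (after (≋-trans ⟪⟫-∙ (⟪⟫-cong (λ z → sym (cod-⊹ z))))) ⟩
    _ ∎≋
    where
    g = ⌜ Term.gen (inj₁ (es zero)) ⌝
    b = box k (es ∘ suc)
    r = ⨁-⊹ dom (es ∘ suc) es′
    r′ = ⨁-⊹ cod (es ∘ suc) es′
    dec-⊹ : ∀ z → ⨁-⊹ dom es es′ z ≡ map₂ r (assocʳ z)
    dec-⊹ (inj₁ (inj₁ _)) = refl
    dec-⊹ (inj₁ (inj₂ _)) = refl
    dec-⊹ (inj₂ _) = refl
    cod-⊹ : ∀ z → ⨁-⊹ cod es es′ z ≡ map₂ r′ (assocʳ z)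
    cod-⊹ (inj₁ (inj₁ _)) = refl
    cod-⊹ (inj₁ (inj₂ _)) = refl
    cod-⊹ (inj₂ _) = refl
    assoc-nat : ∀ {A B C A′ B′ C′} {f : A ⇒ A′} {g : B ⇒ B′} {h : C ⇒ C′} →
                ⟪ assocʳ ⟫ ∙ ((f ⊛ g) ⊛ h) ≋ (f ⊛ (g ⊛ h)) ∙ ⟪ assocʳ ⟫
    assoc-nat = ≋-sym (≋-trans (before (≋-sym assoc-⊛)) (≋-trans ∙-assoc (after (≋-trans ∙-assoc
      (≋-trans (after (≋-trans ⟪⟫-∙ (⟪⟫-id′ (λ { (inj₁ (inj₁ _)) → refl ; (inj₁ (inj₂ _)) → refl ; (inj₂ _) → refl })))) ∙-idʳ)))))

-- Normalisation of terms

map₁-inv : ∀ {A B C : Set} {f : A → B} {g : B → A} → (∀ x → g (f x) ≡ x) → ∀ (x : A ⊎ C) → map₁ g (map₁ f x) ≡ x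
map₁-inv h (inj₁ x) = cong inj₁ (h x)
map₁-inv h (inj₂ y) = refl

map₂-inv : ∀ {A B C : Set} {f : A → B} {g : B → A} → (∀ x → g (f x) ≡ x) →
           ∀ (x : C ⊎ A) → map₂ g (map₂ f x) ≡ x
map₂-inv h (inj₁ x) = refl
map₂-inv h (inj₂ y) = cong inj₂ (h y)

module Normalise {c} (S : Signature c) where

  open Free-Term S
  open Coded S
  open Wiring S
  open Closure S
  open Signature S

  transport : ∀ {A B C D C′ D′ : Set} → (D → D′) → (D′ → D) → (C → C′) →
              (D ⊎ B → C ⊎ A) → D′ ⊎ B → C′ ⊎ A
  transport P P⁻ Q φ = map₁ Q ∘ φ ∘ map₁ P⁻

  M-conj′ : ∀ {A B C D C′ D′} {b : D ⇒ C} {b′ : D′ ⇒ C′} {φ : El (D ✚ B) → El (C ✚ A)}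
            (P : El D → El D′) (P⁻ : El D′ → El D) (Q : El C → El C′) →
            (∀ x → P⁻ (P x) ≡ x) → (∀ x → P (P⁻ x) ≡ x) →
            ⟪_⟫ {D′} {D} P ∙ b ≋ b′ ∙ ⟪_⟫ {C′} {C} Q →
            M {A} {B} b φ ≋ M b′ (transport P P⁻ Q φ)
  M-conj′ {φ = φ} P P⁻ Q P⁻P PP⁻ square =
    M-conj _ P P⁻ Q P⁻P PP⁻ square (λ x → cong (map₁ Q ∘ φ) (map₁-inv P⁻P x))

  -- Hyperedges in parallel with wires U, which M turns into loops.
  loops : ∀ k (es : Fin k → Gen) U → ⨁ k (dom ∘ es) ✚ U ⇒ ⨁ k (cod ∘ es) ✚ U
  loops k es U = box k es ⊛ 1ₕ

  -- The form before closed wires are singled out: `U` collects traced wires that may be fed by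
  -- anything, which makes closure under all operations immediate bookkeeping.
  record Looped {A B} (f : A ⇒ B) : Set c where
    constructor looped
    field
      {edges} : ℕ
      label   : Fin edges → Gen
      {U}     : Ob
      φ       : El ((⨁ edges (dom ∘ label) ✚ U) ✚ B) → El ((⨁ edges (cod ∘ label) ✚ U) ✚ A)
      eq      : f ≋ M (loops edges label U) φ

  Looped-resp : ∀ {A B} {f g : A ⇒ B} → f ≋ g → Looped g → Looped f
  Looped-resp p (looped es φ eq) = looped es φ (≋-trans p eq)

  Looped-wire : ∀ {A B} (φ : El B → El A) → Looped (⟪_⟫ {A} {B} φ)
  Looped-wire φ = looped {edges = 0} (λ ()) {fin 0} _ (≋-trans (M-wire φ)
    (M-conj′ (λ ()) (λ { (inj₁ ()) ; (inj₂ ()) }) (λ ()) (λ ()) (λ { (inj₁ ()) ; (inj₂ ()) })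
      (≋-trans ∙-idʳ (≋-trans (⟪⟫-cong (λ ())) (≋-sym (≋-trans (before ⊛-id) ∙-idˡ))))))

  unit-square : ∀ {A B} {f : A ⇒ B} →
                ⟪ inj₁ ∘ inj₁ ⟫ ∙ f ≋ ((f ⊛ 1ₕ {fin 0}) ⊛ 1ₕ {fin 0}) ∙ ⟪ inj₁ ∘ inj₁ ⟫
  unit-square = ≋-sym (≋-trans (after (≋-sym ⟪⟫-∙)) (≋-trans (merge unit-⊛ʳ) (≋-trans ∙-assoc
    (≋-trans (after unit-⊛ʳ) wires₂))))

  Looped-gen : ∀ g → Looped ⌜ Term.gen (inj₁ g) ⌝
  Looped-gen g = looped {edges = 1} (λ _ → g) {fin 0} _ (≋-trans (M-gen ⌜ Term.gen (inj₁ g) ⌝)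
    (M-conj′ (inj₁ ∘ inj₁) (λ { (inj₁ (inj₁ x)) → x ; (inj₁ (inj₂ ())) ; (inj₂ ()) }) (inj₁ ∘ inj₁)
       (λ _ → refl) (λ { (inj₁ (inj₁ x)) → refl ; (inj₁ (inj₂ ())) ; (inj₂ ()) }) unit-square))

  Looped-⊛ : ∀ {A B C D} {f : A ⇒ B} {g : C ⇒ D} → Looped f → Looped g → Looped (f ⊛ g)
  Looped-⊛ (looped {k} es {U} φ p) (looped {k′} es′ {U′} φ′ p′) =
    looped (es′ ⊹ es) {U′ ✚ U} _ (≋-trans (⊛-cong p p′) (≋-trans M-⊛
      (M-conj′ (map₁ (⨁-⊹ dom es′ es) ∘ mid₄) (mid₄ ∘ map₁ (⨁-⊹⁻ dom es′ es)) (map₁ (⨁-⊹ cod es′ es) ∘ mid₄)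
        (λ x → trans (cong mid₄ (map₁-inv {f = ⨁-⊹ dom es′ es} {⨁-⊹⁻ dom es′ es} (⨁-⊹⁻-⊹ dom es′ es) (mid₄ x))) (mid₄-mid₄ x))
        (λ x → trans (cong (map₁ (⨁-⊹ dom es′ es)) (mid₄-mid₄ (map₁ (⨁-⊹⁻ dom es′ es) x))) (map₁-inv {f = ⨁-⊹⁻ dom es′ es} {⨁-⊹ dom es′ es} (⨁-⊹-⊹⁻ dom es′ es) x))
        (≋-trans (before (≋-sym (⟪⟫-∙ {φ = map₁ (⨁-⊹ dom es′ es)} {ψ = mid₄}))) (≋-trans ∙-assoc (≋-trans (after (≋-trans (after mid₄-W)
          (≋-trans wires₂ (≋-trans (before (⟪⟫-id′ mid₄-mid₄)) ∙-idˡ)))) (≋-trans (merge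
            (≋-trans (before (≋-sym wire-⊛ˡ)) (≋-trans (≋-sym ⊛-∙) (≋-trans (⊛-cong (box-⊹ es′ es) (≋-trans ∙-idˡ (≋-trans ⊛-id (≋-sym ∙-idʳ))))
              (≋-trans ⊛-∙ (after wire-⊛ˡ)))))) (≋-trans ∙-assoc (after ⟪⟫-∙)))))))))

  assoc-square : ∀ {A B U X} {b : A ⇒ B} →
                 ⟪ assocʳ ⟫ ∙ ((b ⊛ 1ₕ {U}) ⊛ 1ₕ {X}) ≋ (b ⊛ 1ₕ {U ✚ X}) ∙ ⟪ assocʳ ⟫
  assoc-square = ≋-trans (after (≋-trans assoc-W′ (after (before (⊛-cong ≋-refl ⊛-id)))))
    (≋-trans wires₂ (≋-trans (before (⟪⟫-id′ assocˡʳ)) ∙-idˡ))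

  Looped-TR : ∀ X {A B} {f : X ✚ A ⇒ X ✚ B} → Looped f → Looped (TR X f)
  Looped-TR X (looped es {U} φ p) = looped es {U ✚ X} _ (≋-trans (TR-cong X p) (≋-trans M-trace
    (M-conj′ assocʳ assocˡ assocʳ assocʳˡ assocˡʳ assoc-square)))

  Looped-W : ∀ {A A′ B B′} (u : El A′ → El A) {f : A′ ⇒ B′} (v : El B → El B′) → Looped f →
             Looped (W {A} {A′} {B} {B′} u f v)
  Looped-W u v (looped es φ p) = looped es _ (≋-trans (after (before p)) (≋-trans (after (M-post v)) (M-pre u)))

  Looped-∙ : ∀ {A B C} {f : A ⇒ B} {g : B ⇒ C} → Looped f → Looped g → Looped (f ∙ g)
  Looped-∙ {B = B} x y = Looped-resp (≋-trans (∙-TR _ _) (TR-cong B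
    (after (≋-sym (≋-trans (after (⟪⟫-id′ {φ = λ x → x} (λ _ → refl))) ∙-idʳ)))))
    (Looped-TR B (Looped-W swap (λ x → x) (Looped-⊛ x y)))

  fromTerm : ∀ {m n} → Tm m n → fin m ⇒ fin n
  fromTerm t = ⌜ t ⌝

  Looped-term : ∀ {m n} (t : Tm m n) → Looped (fromTerm t)
  Looped-term (Term.gen (inj₁ g))      = Looped-gen g
  Looped-term (Term.gen (inj₂ comul))  = Looped-resp (mk≋ (≈-trans Δ-wireᵗ (⟪⟫-fin (λ _ → zero)))) (Looped-wire {fin 1} {fin 2} (λ _ → zero))
  Looped-term (Term.gen (inj₂ counit)) = Looped-resp (mk≋ (≈-trans ε-wireᵗ (⟪⟫-fin (λ ())))) (Looped-wire {fin 1} {fin 0} (λ ()))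
  Looped-term id      = Looped-resp (mk≋ (≈-trans (≈-sym wireᵗ-id) (⟪⟫-fin _))) (Looped-wire _)
  Looped-term (t ⨾ u) = Looped-resp (mk≋ (≡⇒≈ (sym (term-∙ (fromTerm t) (fromTerm u)))))
    (Looped-∙ (Looped-term t) (Looped-term u))
  -- The tensor lives on `fin m ✚ fin p`, the term on `fin (m + p)`; recoding passes between the
  -- two.
  Looped-term (_⊗_ {m} {n} {p} {q} t u) = Looped-resp
    (≋-trans (recode⁻ {fin m ✚ fin p} {fin n ✚ fin q} (t ⊗ u))
      (after (before (mk≋ (≡⇒≈ (sym (term-⊛ (fromTerm t) (fromTerm u))))))))
    (Looped-W _ _ (Looped-⊛ (Looped-term t) (Looped-term u)))
  Looped-term (σ m n) = Looped-resp (mk≋ (≈-trans (σ-wireᵗ m n) (⟪⟫-fin _))) (Looped-wire _)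
  Looped-term (Tr x {m} {n} t) = Looped-resp (mk≋ (≡⇒≈ (sym (term-TR (fin x) {fin m} {fin n} ⌜ t ⌝))))
    (Looped-TR (fin x) (Looped-resp (recode {fin x ✚ fin m} {fin x ✚ fin n} t) (Looped-W _ _ (Looped-term t))))

  record Shape (m n : ℕ) : Set c where
    constructor shape
    field
      edges : ℕ
      label : Fin edges → Gen
      U     : Ob
      φ     : El ((⨁ edges (dom ∘ label) ✚ U) ✚ fin n) → El ((⨁ edges (cod ∘ label) ✚ U) ✚ fin m)
      fixed : ∀ u → φ (inj₁ (inj₂ u)) ≡ inj₁ (inj₂ u)

  normal : ∀ {m n} → Shape m n → fin m ⇒ fin n
  normal (shape k es U φ _) = M (loops k es U) φ

  reloop : ∀ {A B k es U U′} {φ : El ((⨁ k (dom ∘ es) ✚ U) ✚ B) → El ((⨁ k (cod ∘ es) ✚ U) ✚ A)}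
           (w : El U → El U′) (w⁻ : El U′ → El U) → (∀ x → w⁻ (w x) ≡ x) → (∀ x → w (w⁻ x) ≡ x) →
           M {A} {B} (loops k es U) φ ≋ M (loops k es U′)
             (transport (map₂ w) (map₂ w⁻) (map₂ w) φ)
  reloop w w⁻ w⁻w ww⁻ = M-conj′ _ _ _ (map₂-inv w⁻w) (map₂-inv ww⁻)
    (≋-trans (before (≋-sym wire-⊛ʳ)) (≋-trans (≋-sym ⊛-∙) (≋-trans
      (⊛-cong (≋-trans ∙-idˡ (≋-sym ∙-idʳ)) (≋-trans ∙-idʳ (≋-sym ∙-idˡ))) (≋-trans ⊛-∙ (after wire-⊛ʳ)))))

  unroll : ∀ {V : Set} {u} → V ⊎ Fin (suc u) → (V ⊎ Fin u) ⊎ Fin 1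
  unroll (inj₁ v)       = inj₁ (inj₁ v)
  unroll (inj₂ zero)    = inj₂ zero
  unroll (inj₂ (suc i)) = inj₁ (inj₂ i)

  unroll⁻ : ∀ {V : Set} {u} → (V ⊎ Fin u) ⊎ Fin 1 → V ⊎ Fin (suc u)
  unroll⁻ (inj₁ (inj₁ v)) = inj₁ v
  unroll⁻ (inj₁ (inj₂ i)) = inj₂ (suc i)
  unroll⁻ (inj₂ zero)     = inj₂ zero

  -- The loops in V are wires closed on themselves; the others are still arbitrary.
  -- A loop closed on itself is moved to V, any other one is eliminated.
  straighten : ∀ {m n} u {k es V} {f : fin m ⇒ fin n}
               (φ : El ((⨁ k (dom ∘ es) ✚ (V ✚ fin u)) ✚ fin n) → El ((⨁ k (cod ∘ es) ✚ (V ✚ fin u)) ✚ fin m)) →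
               (∀ v → φ (inj₁ (inj₂ (inj₁ v))) ≡ inj₁ (inj₂ (inj₁ v))) →
               f ≋ M (loops k es (V ✚ fin u)) φ → Σ[ s ∈ Shape m n ] f ≋ normal s
  straighten zero {k} {es} {V} φ fix eq = shape k es V
    (transport (map₂ w) (map₂ inj₁) (map₂ w) φ)
    (λ v → cong (map₁ (map₂ w)) (fix v)) ,
    ≋-trans eq (reloop w inj₁ (λ { (inj₁ _) → refl }) (λ _ → refl))
    where
    w : El V ⊎ Fin 0 → El V
    w (inj₁ v) = v
  straighten {m} {n} (suc u) {k} {es} {V} {f} φ fix eq = go (φ₁ (inj₁ (inj₂ (inj₂ zero)))) refl
    where
    D = ⨁ k (dom ∘ es)
    C = ⨁ k (cod ∘ es)
    φ₁ : El ((D ✚ ((V ✚ fin u) ✚ fin 1)) ✚ fin n) → El ((C ✚ ((V ✚ fin u) ✚ fin 1)) ✚ fin m)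
    φ₁ = transport (map₂ unroll) (map₂ unroll⁻) (map₂ unroll) φ
    eq₁ : f ≋ M (loops k es ((V ✚ fin u) ✚ fin 1)) φ₁
    eq₁ = ≋-trans eq (reloop unroll unroll⁻
      (λ { (inj₁ _) → refl ; (inj₂ zero) → refl ; (inj₂ (suc _)) → refl })
      (λ { (inj₁ (inj₁ _)) → refl ; (inj₁ (inj₂ _)) → refl ; (inj₂ zero) → refl }))
    fix₁ : ∀ v → φ₁ (inj₁ (inj₂ (inj₁ (inj₁ v)))) ≡ inj₁ (inj₂ (inj₁ (inj₁ v)))
    fix₁ v = cong (map₁ (map₂ unroll)) (fix v)
    φ₂ : El (((D ✚ (V ✚ fin u)) ✚ fin 1) ✚ fin n) → El (((C ✚ (V ✚ fin u)) ✚ fin 1) ✚ fin m)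
    φ₂ = transport assocˡ assocʳ assocˡ φ₁
    eq₂ : f ≋ M (loops k es (V ✚ fin u) ⊛ 1ₕ) φ₂
    eq₂ = ≋-trans eq₁ (M-conj′ assocˡ assocʳ assocˡ assocˡʳ assocʳˡ
      (≋-trans (after (≋-trans (⊛-cong ≋-refl (≋-sym ⊛-id)) (≋-sym assoc-W))) (≋-trans wires₂
        (≋-trans (before (⟪⟫-id′ assocʳˡ)) ∙-idˡ))))
    eliminate : (a : El (fin 1) → El ((C ✚ (V ✚ fin u)) ✚ fin m)) →
                (∀ x → φ₂ (inj₁ (inj₂ x)) ≡ map₁ inj₁ (a x)) → Σ[ s ∈ Shape m n ] f ≋ normal s
    -- Substitution leaves `V` closed: each of its wires is fed by itself, hence not by the wire
    -- removed. Other wires may become closed by it; that is decided when their turn comes.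
    eliminate a h = straighten u _
      (λ v → cong ([ a , (λ y → y) ]′ ∘ swap₁₂ ∘ assocʳ ∘ map₁ assocˡ) (fix₁ v))
      (≋-trans eq₂ (M-elim a h))
    go : ∀ z → φ₁ (inj₁ (inj₂ (inj₂ zero))) ≡ z → Σ[ s ∈ Shape m n ] f ≋ normal s
    go (inj₁ (inj₁ x))                h = eliminate (λ _ → inj₁ (inj₁ x)) (λ { zero → cong (map₁ assocˡ) h })
    go (inj₁ (inj₂ (inj₁ y)))         h = eliminate (λ _ → inj₁ (inj₂ y)) (λ { zero → cong (map₁ assocˡ) h })
    go (inj₂ x)                       h = eliminate (λ _ → inj₂ x) (λ { zero → cong (map₁ assocˡ) h })
    go (inj₁ (inj₂ (inj₂ zero)))      h = straighten u {V = V ✚ fin 1} _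
      (λ { (inj₁ v) → cong (map₁ (map₂ r)) (fix₁ v)
         ; (inj₂ zero) → cong (map₁ (map₂ r)) h })
      (≋-trans eq₁ (reloop r r
        (λ { (inj₁ (inj₁ _)) → refl ; (inj₁ (inj₂ _)) → refl ; (inj₂ _) → refl })
        (λ { (inj₁ (inj₁ _)) → refl ; (inj₁ (inj₂ _)) → refl ; (inj₂ _) → refl })))
      where
      r : ∀ {A B C : Set} → (A ⊎ B) ⊎ C → (A ⊎ C) ⊎ B
      r (inj₁ (inj₁ v)) = inj₁ (inj₁ v)
      r (inj₁ (inj₂ i)) = inj₂ i
      r (inj₂ x)        = inj₁ (inj₂ x)

  normalise : ∀ {m n} (t : Tm m n) → Σ[ s ∈ Shape m n ] fromTerm t ≋ normal s
  normalise {m} {n} t with Looped-term t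
  ... | looped {k} es {U} φ eq = straighten (size U) {V = fin 0} _ (λ ())
    (≋-trans eq (reloop {U′ = fin 0 ✚ fin (size U)} (inj₂ ∘ enc U) (λ { (inj₂ i) → dec U i })
      (dec-enc U) (λ { (inj₂ i) → cong inj₂ (enc-dec U i) })))

-- Renumbering of hyperedges

pos : ∀ {k} (f : Fin k → ℕ) (i : Fin k) → Fin (f i) → El (⨁ k f)
pos {suc k} f zero    x = inj₁ x
pos {suc k} f (suc i) x = inj₂ (pos (f ∘ suc) i x)

pos⁻ : ∀ {k} (f : Fin k → ℕ) → El (⨁ k f) → Σ[ i ∈ Fin k ] Fin (f i)
pos⁻ {suc k} f (inj₁ x) = zero , x
pos⁻ {suc k} f (inj₂ z) = suc (proj₁ (pos⁻ (f ∘ suc) z)) , proj₂ (pos⁻ (f ∘ suc) z)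

pos-pos⁻ : ∀ {k} (f : Fin k → ℕ) z → pos f (proj₁ (pos⁻ f z)) (proj₂ (pos⁻ f z)) ≡ z
pos-pos⁻ {suc k} f (inj₁ x) = refl
pos-pos⁻ {suc k} f (inj₂ z) = cong inj₂ (pos-pos⁻ (f ∘ suc) z)

pos⁻-pos : ∀ {k} (f : Fin k → ℕ) i x → pos⁻ f (pos f i x) ≡ (i , x)
pos⁻-pos {suc k} f zero    x = refl
pos⁻-pos {suc k} f (suc i) x = cong (λ p → suc (proj₁ p) , proj₂ p) (pos⁻-pos (f ∘ suc) i x)

pos-ind : ∀ {k ℓ} (f : Fin k → ℕ) (P : El (⨁ k f) → Set ℓ) → (∀ i x → P (pos f i x)) → ∀ z → P z
pos-ind f P h z = subst P (pos-pos⁻ f z) (h _ _)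

pos-cong : ∀ {k} (f : Fin k → ℕ) {i j} {x : Fin (f i)} {y : Fin (f j)} →
           i ≡ j → toℕ x ≡ toℕ y → pos f i x ≡ pos f j y
pos-cong f refl p = cong (pos f _) (toℕ-injective p)

-- Block `j` stands first in the domain and in its proper place in the codomain. Such moves generate
-- all rearrangements of blocks, by `permute-suc`.
insert : ∀ {k} (f : Fin (suc k) → ℕ) (j : Fin (suc k)) →
         Fin (f j) ⊎ El (⨁ k (f ∘ punchIn j)) → El (⨁ (suc k) f)
insert f zero z = z
insert {suc k} f (suc j) (inj₁ x)        = inj₂ (insert (f ∘ suc) j (inj₁ x))
insert {suc k} f (suc j) (inj₂ (inj₁ y)) = inj₁ y
insert {suc k} f (suc j) (inj₂ (inj₂ z)) = inj₂ (insert (f ∘ suc) j (inj₂ z))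

insert-pos₁ : ∀ {k} (f : Fin (suc k) → ℕ) j x → insert f j (inj₁ x) ≡ pos f j x
insert-pos₁ f zero x = refl
insert-pos₁ {suc k} f (suc j) x = cong inj₂ (insert-pos₁ (f ∘ suc) j x)

insert-pos₂ : ∀ {k} (f : Fin (suc k) → ℕ) j i x →
              insert f j (inj₂ (pos (f ∘ punchIn j) i x)) ≡ pos f (punchIn j i) x
insert-pos₂ f zero i x = refl
insert-pos₂ {suc k} f (suc j) zero x = refl
insert-pos₂ {suc k} f (suc j) (suc i) x = cong inj₂ (insert-pos₂ (f ∘ suc) j i x)

-- The equality of arities is irrelevant, so different proofs of it yield the same function.
permute : ∀ {k k′} (f : Fin k → ℕ) (f′ : Fin k′ → ℕ) (β : Fin k → Fin k′) →
          .(∀ i → f i ≡ f′ (β i)) → El (⨁ k f) → El (⨁ k′ f′)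
permute f f′ β h z = pos f′ (β (proj₁ (pos⁻ f z))) (cast (h _) (proj₂ (pos⁻ f z)))

permute-pos : ∀ {k k′} (f : Fin k → ℕ) (f′ : Fin k′ → ℕ) (β : Fin k → Fin k′) .(h : ∀ i → f i ≡ f′ (β i)) i x →
              permute f f′ β h (pos f i x) ≡ pos f′ (β i) (cast (h i) x)
permute-pos f f′ β h i x = cong (λ p → pos f′ (β (proj₁ p)) (cast (h _) (proj₂ p))) (pos⁻-pos f i x)

permute-inv : ∀ {k k′} (f : Fin k → ℕ) (f′ : Fin k′ → ℕ) (β : Fin k → Fin k′) .(h : ∀ i → f i ≡ f′ (β i))
              (β⁻ : Fin k′ → Fin k) .(h⁻ : ∀ i → f′ i ≡ f (β⁻ i)) → (∀ i → β⁻ (β i) ≡ i) →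
              ∀ z → permute f′ f β⁻ h⁻ (permute f f′ β h z) ≡ z
permute-inv f f′ β h β⁻ h⁻ inv = pos-ind f _ (λ i x →
  trans (cong (permute f′ f β⁻ h⁻) (permute-pos f f′ β h i x)) (trans (permute-pos f′ f β⁻ h⁻ (β i) (cast (h i) x))
    (pos-cong f (inv i) (trans (toℕ-cast _ (cast (h i) x)) (toℕ-cast _ x)))))

-- The first block goes to its place and the others follow the permutation with that entry removed.
-- This recursion matches the one that defines `box`.
permute-suc : ∀ {k k′} (f : Fin (suc k) → ℕ) (f′ : Fin (suc k′) → ℕ) (π : Permutation (suc k) (suc k′))
              .(h : ∀ i → f i ≡ f′ (π ⟨$⟩ʳ i)) .(h′ : ∀ i → f (suc i) ≡ f′ (punchIn (π ⟨$⟩ʳ zero) (remove zero π ⟨$⟩ʳ i))) z →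
              permute f f′ (π ⟨$⟩ʳ_) h z ≡ insert f′ (π ⟨$⟩ʳ zero)
                (map⊎ (cast (h zero)) (permute (f ∘ suc) (f′ ∘ punchIn (π ⟨$⟩ʳ zero)) (remove zero π ⟨$⟩ʳ_) h′) z)
permute-suc f f′ π h h′ (inj₁ x) = sym (insert-pos₁ f′ (π ⟨$⟩ʳ zero) (cast (h zero) x))
permute-suc {k} f f′ π h h′ (inj₂ z) = pos-ind (f ∘ suc)
  (λ z → permute f f′ (π ⟨$⟩ʳ_) h (inj₂ z) ≡ insert f′ (π ⟨$⟩ʳ zero) (inj₂ (permute (f ∘ suc) f″ β h′ z)))
  (λ i x → trans (permute-pos f f′ (π ⟨$⟩ʳ_) h (suc i) x)
    (trans (pos-cong f′ (punchIn-permute π zero i) (trans (toℕ-cast (h (suc i)) x) (sym (toℕ-cast (h′ i) x))))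
      (trans (sym (insert-pos₂ f′ (π ⟨$⟩ʳ zero) (β i) (cast (h′ i) x)))
        (cong (insert f′ (π ⟨$⟩ʳ zero) ∘ inj₂) (sym (permute-pos (f ∘ suc) f″ β h′ i x)))))) z
  where
  β : Fin k → _
  β = remove zero π ⟨$⟩ʳ_
  f″ : _ → ℕ
  f″ = f′ ∘ punchIn (π ⟨$⟩ʳ zero)

module Reordering {c} (S : Signature c) where

  open Free-Term S
  open Coded S
  open Wiring S
  open Closure S
  open Normalise S
  open Signature S

  box₁ : (g : Gen) → fin (dom g) ⇒ fin (cod g)
  box₁ g = ⌜ Term.gen (inj₁ g) ⌝

  box-insert : ∀ {k} (es : Fin (suc k) → Gen) j →
               ⟪ insert (dom ∘ es) j ⟫ ∙ (box₁ (es j) ⊛ box k (es ∘ punchIn j))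
                 ≋ box (suc k) es ∙ ⟪ insert (cod ∘ es) j ⟫
  box-insert es zero = ≋-trans (before (⟪⟫-id′ (λ _ → refl)))
    (≋-trans (≋-trans ∙-idˡ (≋-sym ∙-idʳ)) (after (≋-sym (⟪⟫-id′ (λ _ → refl)))))
  box-insert {suc k} es (suc j) =
    ⟪ insert (dom ∘ es) (suc j) ⟫ ∙ (gⱼ ⊛ (g₀ ⊛ b)) ≋⟨ ∙-cong (⟪⟫-cong {ψ = map₂ r ∘ swap₁₂}
          (λ { (inj₁ _) → refl ; (inj₂ (inj₁ _)) → refl ; (inj₂ (inj₂ _)) → refl })) swap₁₂-W ⟩
    ⟪ map₂ r ∘ swap₁₂ ⟫ ∙ ⟪ swap₁₂ ⟫ ∙ (g₀ ⊛ (gⱼ ⊛ b)) ∙ ⟪ swap₁₂ ⟫ ≋⟨ wires₂ ⟩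
    ⟪ map₂ r ∘ swap₁₂ ∘ swap₁₂ ⟫ ∙ (g₀ ⊛ (gⱼ ⊛ b)) ∙ ⟪ swap₁₂ ⟫
      ≋⟨ before (≋-trans (⟪⟫-cong {ψ = map₂ r}
           (λ { (inj₁ _) → refl ; (inj₂ (inj₁ _)) → refl ; (inj₂ (inj₂ _)) → refl })) (≋-sym wire-⊛ʳ)) ⟩
    (1ₕ ⊛ ⟪ r ⟫) ∙ (g₀ ⊛ (gⱼ ⊛ b)) ∙ ⟪ swap₁₂ ⟫
      ≋⟨ merge (≋-trans (≋-sym ⊛-∙) (≋-trans (⊛-cong (≋-trans ∙-idˡ (≋-sym ∙-idʳ)) (box-insert (es ∘ suc) j))
           (≋-trans ⊛-∙ (after wire-⊛ʳ)))) ⟩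
    (box (suc (suc k)) es ∙ ⟪ map₂ r′ ⟫) ∙ ⟪ swap₁₂ ⟫
      ≋⟨ ≋-trans ∙-assoc (after (≋-trans ⟪⟫-∙ (⟪⟫-cong {ψ = insert (cod ∘ es) (suc j)}
           (λ { (inj₁ _) → refl ; (inj₂ (inj₁ _)) → refl ; (inj₂ (inj₂ _)) → refl })))) ⟩
    _ ∎≋
    where
    g₀ = box₁ (es zero)
    gⱼ = box₁ (es (suc j))
    b  = box k (es ∘ suc ∘ punchIn j)
    r  = insert (dom ∘ es ∘ suc) j
    r′ = insert (cod ∘ es ∘ suc) j

  box₁-cast : ∀ {g g′} (h : g ≡ g′) →
              ⟪_⟫ {fin (dom g′)} {fin (dom g)} (cast (cong dom h)) ∙ box₁ g ≋ box₁ g′ ∙ ⟪ cast (cong cod h) ⟫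
  box₁-cast refl = ≋-trans (before (⟪⟫-id′ (cast-id refl))) (≋-trans (≋-trans ∙-idˡ (≋-sym ∙-idʳ))
    (after (≋-sym (⟪⟫-id′ (cast-id refl)))))

  -- Induction along `permute-suc`: `box-insert` moves the first generator to its place by
  -- symmetries, and the permutation of the remaining ones is covered by the hypothesis.
  box-permute : ∀ {k k′} (es : Fin k → Gen) (es′ : Fin k′ → Gen) (π : Permutation k k′)
                (h : ∀ i → es i ≡ es′ (π ⟨$⟩ʳ i)) →
                ⟪ permute (dom ∘ es) (dom ∘ es′) (π ⟨$⟩ʳ_) (λ i → cong dom (h i)) ⟫ ∙ box k es
                  ≋ box k′ es′ ∙ ⟪ permute (cod ∘ es) (cod ∘ es′) (π ⟨$⟩ʳ_) (λ i → cong cod (h i)) ⟫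
  box-permute {zero} {zero} es es′ π h = ≋-trans ∙-idʳ (≋-trans (⟪⟫-cong (λ ())) (≋-sym ∙-idˡ))
  box-permute {zero} {suc k′} es es′ π h with π ⟨$⟩ˡ zero
  ... | ()
  box-permute {suc k} {zero} es es′ π h with π ⟨$⟩ʳ zero
  ... | ()
  box-permute {suc k} {suc k′} es es′ π h =
    ⟪ permute (dom ∘ es) (dom ∘ es′) (π ⟨$⟩ʳ_) (λ i → cong dom (h i)) ⟫ ∙ (box₁ (es zero) ⊛ box k (es ∘ suc))
      ≋⟨ before (≋-trans (⟪⟫-cong (permute-suc (dom ∘ es) (dom ∘ es′) π (λ i → cong dom (h i)) (λ i → cong dom (h′ i))))
           (≋-trans (≋-sym ⟪⟫-∙) (after (≋-sym ⟪⟫-⊛)))) ⟩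
    (⟪ insert (dom ∘ es′) j ⟫ ∙ (⟪ cast (cong dom (h zero)) ⟫ ⊛ ⟪ permute (dom ∘ es ∘ suc) (dom ∘ es″) (ρ ⟨$⟩ʳ_) (λ i → cong dom (h′ i)) ⟫))
      ∙ (box₁ (es zero) ⊛ box k (es ∘ suc))
      ≋⟨ ≋-trans ∙-assoc (after (≋-trans (≋-sym ⊛-∙) (≋-trans (⊛-cong (box₁-cast (h zero)) (box-permute (es ∘ suc) es″ ρ h′)) ⊛-∙))) ⟩
    ⟪ insert (dom ∘ es′) j ⟫ ∙ (box₁ (es′ j) ⊛ box k′ es″) ∙ (⟪ cast (cong cod (h zero)) ⟫ ⊛ ⟪ permute (cod ∘ es ∘ suc) (cod ∘ es″) (ρ ⟨$⟩ʳ_) (λ i → cong cod (h′ i)) ⟫)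
      ≋⟨ ≋-trans (merge (box-insert es′ j)) ∙-assoc ⟩
    box (suc k′) es′ ∙ ⟪ insert (cod ∘ es′) j ⟫ ∙ (⟪ cast (cong cod (h zero)) ⟫ ⊛ ⟪ permute (cod ∘ es ∘ suc) (cod ∘ es″) (ρ ⟨$⟩ʳ_) (λ i → cong cod (h′ i)) ⟫)
      ≋⟨ after (≋-trans (after ⟪⟫-⊛) (≋-trans ⟪⟫-∙ (⟪⟫-cong (λ z →
           sym (permute-suc (cod ∘ es) (cod ∘ es′) π (λ i → cong cod (h i)) (λ i → cong cod (h′ i)) z))))) ⟩
    _ ∎≋
    where
    j = π ⟨$⟩ʳ zero
    ρ = remove zero π
    es″ = es′ ∘ punchIn j
    h′ : ∀ i → es (suc i) ≡ es″ (ρ ⟨$⟩ʳ i)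
    h′ i = trans (h (suc i)) (cong es′ (punchIn-permute π zero i))

  -- An isomorphism of shapes, given by its action on hyperedges and closed wires, is a square for
  -- `M-conj`; the last hypothesis says that the wirings correspond under it.
  normal-cong : ∀ {m n} (s s′ : Shape m n) → let open Shape in
    (π : Permutation (edges s) (edges s′)) (h : ∀ i → label s i ≡ label s′ (π ⟨$⟩ʳ i))
    (w : El (U s) → El (U s′)) (w⁻ : El (U s′) → El (U s)) → (∀ u → w⁻ (w u) ≡ u) → (∀ u → w (w⁻ u) ≡ u) →
    (∀ x → φ s′ (map₁ (map⊎ (permute _ _ (π ⟨$⟩ʳ_) (λ i → cong dom (h i))) w) x)
             ≡ map₁ (map⊎ (permute _ _ (π ⟨$⟩ʳ_) (λ i → cong cod (h i))) w) (φ s x)) →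
    normal s ≋ normal s′
  normal-cong (shape k es U φ _) (shape k′ es′ U′ φ′ _) π h w w⁻ w⁻w ww⁻ eq =
    M-conj φ′ (map⊎ P w) (map⊎ P⁻ w⁻) (map⊎ Q w)
      (λ { (inj₁ x) → cong inj₁ (P⁻P x) ; (inj₂ u) → cong inj₂ (w⁻w u) })
      (λ { (inj₁ x) → cong inj₁ (PP⁻ x) ; (inj₂ u) → cong inj₂ (ww⁻ u) })
      (≋-trans (before (≋-sym ⟪⟫-⊛)) (≋-trans (≋-sym ⊛-∙) (≋-trans
        (⊛-cong (box-permute es es′ π h) (≋-trans ∙-idʳ (≋-sym ∙-idˡ))) (≋-trans ⊛-∙ (after ⟪⟫-⊛)))))
      eq
    where
    h⁻ : ∀ i → es′ i ≡ es (π ⟨$⟩ˡ i)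
    h⁻ i = sym (trans (h _) (cong es′ (inverseʳ π)))
    P = permute (dom ∘ es) (dom ∘ es′) (π ⟨$⟩ʳ_) (λ i → cong dom (h i))
    Q = permute (cod ∘ es) (cod ∘ es′) (π ⟨$⟩ʳ_) (λ i → cong cod (h i))
    P⁻ = permute (dom ∘ es′) (dom ∘ es) (π ⟨$⟩ˡ_) (λ i → cong dom (h⁻ i))
    P⁻P : ∀ x → P⁻ (P x) ≡ x
    P⁻P = permute-inv (dom ∘ es) (dom ∘ es′) (π ⟨$⟩ʳ_) (λ i → cong dom (h i)) (π ⟨$⟩ˡ_) (λ i → cong dom (h⁻ i)) (λ i → inverseˡ π)
    PP⁻ : ∀ x → P (P⁻ x) ≡ x
    PP⁻ = permute-inv (dom ∘ es′) (dom ∘ es) (π ⟨$⟩ˡ_) (λ i → cong dom (h⁻ i)) (π ⟨$⟩ʳ_) (λ i → cong dom (h i)) (λ i → inverseʳ π)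

-- Presentations of cospans and the trace axioms

-- A cospan whose vertices are only presented, as the quotient of V by the
-- equivalence relation that R generates.
record Precospan {c} (S : Signature c) (m n : ℕ) : Set (lsuc 0ℓ ⊔ c) where
  field
    V     : Set
    E     : ℕ → ℕ → Set
    src   : ∀ {k l} → E k l → Fin k → V
    tgt   : ∀ {k l} → E k l → Fin l → V
    label : ∀ {k l} → E k l → Signature.Gen S
    R     : V → V → Set
    left  : Fin m → V
    right : Fin n → V

module Precospans {c} (S : Signature c) where

  open Precospan

  Pre : ℕ → ℕ → Set (lsuc 0ℓ ⊔ c)
  Pre = Precospan S

  -- The generated equivalence, encoded by the maps that respect R, which is
  -- the form in which `Coequaliser.respects` provides it.
  record Eq {m n} (P : Pre m n) (v w : V P) : Set₁ where
    constructor mkEq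
    field run : ∀ {X : Set} (h : V P → X) → (∀ a b → R P a b → h a ≡ h b) → h v ≡ h w
  open Eq public

  module _ {m n} {P : Pre m n} where

    gen≡ : ∀ {v w} → R P v w → Eq P v w
    gen≡ r = mkEq (λ h resp → resp _ _ r)

    ≡⇒Eq : ∀ {v w} → v ≡ w → Eq P v w
    ≡⇒Eq p = mkEq (λ h _ → cong h p)

    Eq-refl : ∀ {v} → Eq P v v
    Eq-refl = ≡⇒Eq refl

    Eq-sym : ∀ {v w} → Eq P v w → Eq P w v
    Eq-sym (mkEq p) = mkEq (λ h resp → sym (p h resp))

    infixr 4 _▹_
    _▹_ : ∀ {u v w} → Eq P u v → Eq P v w → Eq P u w
    mkEq p ▹ mkEq q = mkEq (λ h resp → trans (p h resp) (q h resp))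

  Eq-map : ∀ {m n m′ n′} {P : Pre m n} {Q : Pre m′ n′} (θ : V P → V Q) →
           (∀ a b → R P a b → Eq Q (θ a) (θ b)) → ∀ {v w} → Eq P v w → Eq Q (θ v) (θ w)
  Eq-map θ θR (mkEq p) = mkEq (λ h resp → p (h ∘ θ) (λ a b r → run (θR a b r) h resp))

  infix 4 _⟶_ _~_

  -- Incidence and legs are kept only up to the generated equivalence, because a vertex may be named
  -- by any representative. Hyperedges carry no relation and are compared strictly.
  record _⟶_ {m n} (P Q : Pre m n) : Set (lsuc 0ℓ ⊔ c) where
    field
      to     : V P → V Q
      to-R   : ∀ a b → R P a b → Eq Q (to a) (to b)
      toE    : ∀ {k l} → E P k l → E Q k l
      to-src : ∀ {k l} (e : E P k l) i → Eq Q (to (src P e i)) (src Q (toE e) i)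
      to-tgt : ∀ {k l} (e : E P k l) i → Eq Q (to (tgt P e i)) (tgt Q (toE e) i)
      to-label : ∀ {k l} (e : E P k l) → label Q (toE e) ≡ label P e
      to-left  : ∀ x → Eq Q (to (left P x)) (left Q x)
      to-right : ∀ x → Eq Q (to (right P x)) (right Q x)

    to-Eq : ∀ {v w} → Eq P v w → Eq Q (to v) (to w)
    to-Eq = Eq-map to to-R
  open _⟶_ public

  record _~_ {m n} (P Q : Pre m n) : Set (lsuc 0ℓ ⊔ c) where
    field
      fwd   : P ⟶ Q
      bwd   : Q ⟶ P
      inv₁  : ∀ v → Eq P (to bwd (to fwd v)) v
      inv₂  : ∀ v → Eq Q (to fwd (to bwd v)) v
      invE₁ : ∀ {k l} (e : E P k l) → toE bwd (toE fwd e) ≡ e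
      invE₂ : ∀ {k l} (e : E Q k l) → toE fwd (toE bwd e) ≡ e
  open _~_ public

  -- That the backward map preserves sources, targets, labels and legs follows from the same facts
  -- about `f` and the inverse laws.
  mk~ : ∀ {m n} {P Q : Pre m n} (f : P ⟶ Q) (from : V Q → V P) →
        (∀ a b → R Q a b → Eq P (from a) (from b)) →
        (∀ v → Eq P (from (to f v)) v) → (∀ v → Eq Q (to f (from v)) v) →
        (fromE : ∀ {k l} → E Q k l → E P k l) →
        (∀ {k l} (e : E P k l) → fromE (toE f e) ≡ e) → (∀ {k l} (e : E Q k l) → toE f (fromE e) ≡ e) →
        P ~ Q
  mk~ {P = P} {Q} f from from-R i₁ i₂ fromE e₁ e₂ = record
    { fwd = f
    ; bwd = record
      { to = from ; to-R = from-R ; toE = fromE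
      ; to-src = λ e i → subst (λ e′ → Eq P (from (src Q e′ i)) (src P (fromE e) i)) (e₂ e)
          (from-Eq (Eq-sym (to-src f (fromE e) i)) ▹ i₁ _)
      ; to-tgt = λ e i → subst (λ e′ → Eq P (from (tgt Q e′ i)) (tgt P (fromE e) i)) (e₂ e)
          (from-Eq (Eq-sym (to-tgt f (fromE e) i)) ▹ i₁ _)
      ; to-label = λ e → trans (sym (to-label f (fromE e))) (cong (label Q) (e₂ e))
      ; to-left = λ x → from-Eq (Eq-sym (to-left f x)) ▹ i₁ _
      ; to-right = λ x → from-Eq (Eq-sym (to-right f x)) ▹ i₁ _
      }
    ; inv₁ = i₁ ; inv₂ = i₂ ; invE₁ = e₁ ; invE₂ = e₂ }
    where
    from-Eq : ∀ {v w} → Eq Q v w → Eq P (from v) (from w)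
    from-Eq = Eq-map from from-R

  ~-sym : ∀ {m n} {P Q : Pre m n} → P ~ Q → Q ~ P
  ~-sym p = record { fwd = bwd p ; bwd = fwd p ; inv₁ = inv₂ p ; inv₂ = inv₁ p ; invE₁ = invE₂ p ; invE₂ = invE₁ p }

  ⟶-trans : ∀ {m n} {P Q T : Pre m n} → P ⟶ Q → Q ⟶ T → P ⟶ T
  ⟶-trans f g = record
    { to = to g ∘ to f ; to-R = λ a b r → to-Eq g (to-R f a b r) ; toE = toE g ∘ toE f
    ; to-src = λ e i → to-Eq g (to-src f e i) ▹ to-src g _ i
    ; to-tgt = λ e i → to-Eq g (to-tgt f e i) ▹ to-tgt g _ i
    ; to-label = λ e → trans (to-label g _) (to-label f e)
    ; to-left = λ x → to-Eq g (to-left f x) ▹ to-left g x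
    ; to-right = λ x → to-Eq g (to-right f x) ▹ to-right g x }

  ~-trans : ∀ {m n} {P Q T : Pre m n} → P ~ Q → Q ~ T → P ~ T
  ~-trans p q = record
    { fwd = ⟶-trans (fwd p) (fwd q) ; bwd = ⟶-trans (bwd q) (bwd p)
    ; inv₁ = λ v → to-Eq (bwd p) (inv₁ q _) ▹ inv₁ p v
    ; inv₂ = λ v → to-Eq (fwd q) (inv₂ p _) ▹ inv₂ q v
    ; invE₁ = λ e → trans (cong (toE (bwd p)) (invE₁ q _)) (invE₁ p e)
    ; invE₂ = λ e → trans (cong (toE (fwd q)) (invE₂ p _)) (invE₂ q e) }

  same-graph : ∀ {m n} {V : Set} {E : ℕ → ℕ → Set} {s s′ : ∀ {k l} → E k l → Fin k → V} {t t′ : ∀ {k l} → E k l → Fin l → V}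
               {label : ∀ {k l} → E k l → Signature.Gen S} {R R′ : V → V → Set} {l l′ : Fin m → V} {r r′ : Fin n → V} →
               let P = record { V = V ; E = E ; src = s ; tgt = t ; label = label ; R = R ; left = l ; right = r }
                   Q = record { V = V ; E = E ; src = s′ ; tgt = t′ ; label = label ; R = R′ ; left = l′ ; right = r′ } in
               (∀ a b → R a b → Eq Q a b) → (∀ a b → R′ a b → Eq P a b) →
               (∀ {k l} (e : E k l) i → s e i ≡ s′ e i) → (∀ {k l} (e : E k l) i → t e i ≡ t′ e i) →
               (∀ i → l i ≡ l′ i) → (∀ i → r i ≡ r′ i) → P ~ Q
  same-graph f g s t p q = mk~ (record { to = λ v → v ; to-R = f ; toE = λ e → e
      ; to-src = λ e i → ≡⇒Eq (s e i) ; to-tgt = λ e i → ≡⇒Eq (t e i) ; to-label = λ _ → refl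
      ; to-left = λ i → ≡⇒Eq (p i) ; to-right = λ i → ≡⇒Eq (q i) })
    (λ v → v) g (λ _ → Eq-refl) (λ _ → Eq-refl) (λ e → e) (λ _ → refl) (λ _ → refl)

  ~-refl : ∀ {m n} {P : Pre m n} → P ~ P
  ~-refl = same-graph (λ _ _ → gen≡) (λ _ _ → gen≡) (λ _ _ → refl) (λ _ _ → refl) (λ _ → refl) (λ _ → refl)

  module _ {m n m′ n′} (P : Pre m n) (Q : Pre m′ n′) where

    data R⊗ : V P ⊎ V Q → V P ⊎ V Q → Set where
      inl : ∀ {a b} → R P a b → R⊗ (inj₁ a) (inj₁ b)
      inr : ∀ {a b} → R Q a b → R⊗ (inj₂ a) (inj₂ b)

    src⊎ : ∀ {k l} → E P k l ⊎ E Q k l → Fin k → V P ⊎ V Q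
    src⊎ (inj₁ e) i = inj₁ (src P e i)
    src⊎ (inj₂ e) i = inj₂ (src Q e i)

    tgt⊎ : ∀ {k l} → E P k l ⊎ E Q k l → Fin l → V P ⊎ V Q
    tgt⊎ (inj₁ e) i = inj₁ (tgt P e i)
    tgt⊎ (inj₂ e) i = inj₂ (tgt Q e i)

    label⊎ : ∀ {k l} → E P k l ⊎ E Q k l → Signature.Gen S
    label⊎ = [ label P , label Q ]′

  module _ {m n p} (P : Pre m n) (Q : Pre n p) where

    data R⨾ : V P ⊎ V Q → V P ⊎ V Q → Set where
      par  : ∀ {a b} → R⊗ P Q a b → R⨾ a b
      glued : ∀ i → R⨾ (inj₁ (right P i)) (inj₂ (left Q i))

  infixl 6 _⨾ᵖ_
  infixl 7 _⊗ᵖ_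

  -- Nothing is quotiented: composing adds the glued pairs of legs to the relation, as `Trᵖ` adds
  -- the looped pairs. The axioms then compare relations instead of coequalisers.
  _⨾ᵖ_ : ∀ {m n p} → Pre m n → Pre n p → Pre m p
  P ⨾ᵖ Q = record
    { V = V P ⊎ V Q ; E = λ k l → E P k l ⊎ E Q k l
    ; src = src⊎ P Q ; tgt = tgt⊎ P Q ; label = label⊎ P Q
    ; R = R⨾ P Q
    ; left = inj₁ ∘ left P ; right = inj₂ ∘ right Q }

  _⊗ᵖ_ : ∀ {m n m′ n′} → Pre m n → Pre m′ n′ → Pre (m + m′) (n + n′)
  P ⊗ᵖ Q = record
    { V = V P ⊎ V Q ; E = λ k l → E P k l ⊎ E Q k l
    ; src = src⊎ P Q ; tgt = tgt⊎ P Q ; label = label⊎ P Q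
    ; R = R⊗ P Q
    ; left = left P ⊞ left Q ; right = right P ⊞ right Q }

  wireᵖ : ∀ {m n} → (Fin n → Fin m) → Pre m n
  wireᵖ {m} ρ = record
    { V = Fin m ; E = λ _ _ → ⊥ ; src = λ () ; tgt = λ () ; label = λ ()
    ; R = λ _ _ → ⊥ ; left = λ i → i ; right = ρ }

  idᵖ : ∀ {m} → Pre m m
  idᵖ = wireᵖ (λ i → i)

  castᵖ : ∀ {m m′ n n′} → .(m ≡ m′) → .(n ≡ n′) → Pre m n → Pre m′ n′
  castᵖ p q P = record
    { V = V P ; E = E P ; src = src P ; tgt = tgt P ; label = label P ; R = R P
    ; left = left P ∘ cast (sym p) ; right = right P ∘ cast (sym q) }

  data RTr x {m n} (P : Pre (x + m) (x + n)) : V P → V P → Set where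
    base : ∀ {a b} → R P a b → RTr x P a b
    loop : ∀ i → RTr x P (left P (i ↑ˡ m)) (right P (i ↑ˡ n))

  Trᵖ : ∀ x {m n} → Pre (x + m) (x + n) → Pre m n
  Trᵖ x {m} {n} P = record
    { V = V P ; E = E P ; src = src P ; tgt = tgt P ; label = label P ; R = RTr x P
    ; left = left P ∘ (x ↑ʳ_) ; right = right P ∘ (x ↑ʳ_) }

  module _ {m n p} {P : Pre m n} {Q : Pre n p} where
    ⨾-inl : ∀ {a b} → Eq P a b → Eq (P ⨾ᵖ Q) (inj₁ a) (inj₁ b)
    ⨾-inl = Eq-map inj₁ (λ _ _ r → gen≡ (par (inl r)))
    ⨾-inr : ∀ {a b} → Eq Q a b → Eq (P ⨾ᵖ Q) (inj₂ a) (inj₂ b)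
    ⨾-inr = Eq-map inj₂ (λ _ _ r → gen≡ (par (inr r)))
    ⨾-glue : ∀ i {a b} → right P i ≡ a → left Q i ≡ b → Eq (P ⨾ᵖ Q) (inj₁ a) (inj₂ b)
    ⨾-glue i refl refl = gen≡ (glued i)

  module _ {m n m′ n′} {P : Pre m n} {Q : Pre m′ n′} where
    ⊗-inl : ∀ {a b} → Eq P a b → Eq (P ⊗ᵖ Q) (inj₁ a) (inj₁ b)
    ⊗-inl = Eq-map inj₁ (λ _ _ r → gen≡ (inl r))
    ⊗-inr : ∀ {a b} → Eq Q a b → Eq (P ⊗ᵖ Q) (inj₂ a) (inj₂ b)
    ⊗-inr = Eq-map inj₂ (λ _ _ r → gen≡ (inr r))

  module _ {x m n} {P : Pre (x + m) (x + n)} where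
    Tr-base : ∀ {a b} → Eq P a b → Eq (Trᵖ x P) a b
    Tr-base = Eq-map (λ v → v) (λ _ _ r → gen≡ (base r))
    Tr-loop : ∀ i {a b} → left P (i ↑ˡ m) ≡ a → right P (i ↑ˡ n) ≡ b → Eq (Trᵖ x P) a b
    Tr-loop i refl refl = gen≡ (loop i)

  module _ {m n p} {P P′ : Pre m n} {Q Q′ : Pre n p} where

    ⨾-⟶ : P ⟶ P′ → Q ⟶ Q′ → P ⨾ᵖ Q ⟶ P′ ⨾ᵖ Q′
    ⨾-⟶ f g = record
      { to = map⊎ (to f) (to g)
      ; to-R = λ { _ _ (par (inl r)) → ⨾-inl (to-R f _ _ r) ; _ _ (par (inr r)) → ⨾-inr (to-R g _ _ r)
                 ; _ _ (glued i) → ⨾-inl (to-right f i) ▹ ⨾-glue i refl refl ▹ ⨾-inr (Eq-sym (to-left g i)) }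
      ; toE = map⊎ (toE f) (toE g)
      ; to-src = λ { (inj₁ e) i → ⨾-inl (to-src f e i) ; (inj₂ e) i → ⨾-inr (to-src g e i) }
      ; to-tgt = λ { (inj₁ e) i → ⨾-inl (to-tgt f e i) ; (inj₂ e) i → ⨾-inr (to-tgt g e i) }
      ; to-label = λ { (inj₁ e) → to-label f e ; (inj₂ e) → to-label g e }
      ; to-left = λ x → ⨾-inl (to-left f x)
      ; to-right = λ x → ⨾-inr (to-right g x) }

  ⨾ᵖ-cong : ∀ {m n p} {P P′ : Pre m n} {Q Q′ : Pre n p} → P ~ P′ → Q ~ Q′ → P ⨾ᵖ Q ~ P′ ⨾ᵖ Q′
  ⨾ᵖ-cong p q = record
    { fwd = ⨾-⟶ (fwd p) (fwd q) ; bwd = ⨾-⟶ (bwd p) (bwd q)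
    ; inv₁ = λ { (inj₁ v) → ⨾-inl (inv₁ p v) ; (inj₂ v) → ⨾-inr (inv₁ q v) }
    ; inv₂ = λ { (inj₁ v) → ⨾-inl (inv₂ p v) ; (inj₂ v) → ⨾-inr (inv₂ q v) }
    ; invE₁ = λ { (inj₁ e) → cong inj₁ (invE₁ p e) ; (inj₂ e) → cong inj₂ (invE₁ q e) }
    ; invE₂ = λ { (inj₁ e) → cong inj₁ (invE₂ p e) ; (inj₂ e) → cong inj₂ (invE₂ q e) } }

  ⊞-Eq : ∀ {m n m′ n′} {P : Pre m n} {Q : Pre m′ n′} {k l} {A B : Set} (f : A → V P) (g : B → V Q)
         {a : Fin k → A} {b : Fin l → B} {a′ : Fin k → V P} {b′ : Fin l → V Q} →
         (∀ i → Eq P (f (a i)) (a′ i)) → (∀ j → Eq Q (g (b j)) (b′ j)) →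
         ∀ x → Eq (P ⊗ᵖ Q) (map⊎ f g ((a ⊞ b) x)) ((a′ ⊞ b′) x)
  ⊞-Eq {k = k} f g p q x with splitAt k x
  ... | inj₁ i = ⊗-inl (p i)
  ... | inj₂ j = ⊗-inr (q j)

  module _ {m n m′ n′} {P P′ : Pre m n} {Q Q′ : Pre m′ n′} where

    ⊗-⟶ : P ⟶ P′ → Q ⟶ Q′ → P ⊗ᵖ Q ⟶ P′ ⊗ᵖ Q′
    ⊗-⟶ f g = record
      { to = map⊎ (to f) (to g)
      ; to-R = λ { _ _ (inl r) → ⊗-inl (to-R f _ _ r) ; _ _ (inr r) → ⊗-inr (to-R g _ _ r) }
      ; toE = map⊎ (toE f) (toE g)
      ; to-src = λ { (inj₁ e) i → ⊗-inl (to-src f e i) ; (inj₂ e) i → ⊗-inr (to-src g e i) }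
      ; to-tgt = λ { (inj₁ e) i → ⊗-inl (to-tgt f e i) ; (inj₂ e) i → ⊗-inr (to-tgt g e i) }
      ; to-label = λ { (inj₁ e) → to-label f e ; (inj₂ e) → to-label g e }
      ; to-left = ⊞-Eq (to f) (to g) (to-left f) (to-left g)
      ; to-right = ⊞-Eq (to f) (to g) (to-right f) (to-right g) }

  ⊗ᵖ-cong : ∀ {m n m′ n′} {P P′ : Pre m n} {Q Q′ : Pre m′ n′} → P ~ P′ → Q ~ Q′ → P ⊗ᵖ Q ~ P′ ⊗ᵖ Q′
  ⊗ᵖ-cong p q = record
    { fwd = ⊗-⟶ (fwd p) (fwd q) ; bwd = ⊗-⟶ (bwd p) (bwd q)
    ; inv₁ = λ { (inj₁ v) → ⊗-inl (inv₁ p v) ; (inj₂ v) → ⊗-inr (inv₁ q v) }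
    ; inv₂ = λ { (inj₁ v) → ⊗-inl (inv₂ p v) ; (inj₂ v) → ⊗-inr (inv₂ q v) }
    ; invE₁ = λ { (inj₁ e) → cong inj₁ (invE₁ p e) ; (inj₂ e) → cong inj₂ (invE₁ q e) }
    ; invE₂ = λ { (inj₁ e) → cong inj₁ (invE₂ p e) ; (inj₂ e) → cong inj₂ (invE₂ q e) } }

  Tr-⟶ : ∀ x {m n} {P P′ : Pre (x + m) (x + n)} → P ⟶ P′ → Trᵖ x P ⟶ Trᵖ x P′
  Tr-⟶ x f = record
    { to = to f
    ; to-R = λ { _ _ (base r) → Tr-base (to-R f _ _ r)
               ; _ _ (loop i) → Tr-base (to-left f _) ▹ Tr-loop i refl refl ▹ Tr-base (Eq-sym (to-right f _)) }
    ; toE = toE f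
    ; to-src = λ e i → Tr-base (to-src f e i)
    ; to-tgt = λ e i → Tr-base (to-tgt f e i)
    ; to-label = to-label f
    ; to-left = λ i → Tr-base (to-left f _)
    ; to-right = λ i → Tr-base (to-right f _) }

  Trᵖ-cong : ∀ x {m n} {P P′ : Pre (x + m) (x + n)} → P ~ P′ → Trᵖ x P ~ Trᵖ x P′
  Trᵖ-cong x p = record
    { fwd = Tr-⟶ x (fwd p) ; bwd = Tr-⟶ x (bwd p)
    ; inv₁ = λ v → Tr-base (inv₁ p v) ; inv₂ = λ v → Tr-base (inv₂ p v)
    ; invE₁ = invE₁ p ; invE₂ = invE₂ p }

  castᵖ-refl : ∀ {m n} (P : Pre m n) → castᵖ refl refl P ~ P
  castᵖ-refl P = same-graph (λ _ _ → gen≡) (λ _ _ → gen≡) (λ _ _ → refl) (λ _ _ → refl)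
    (λ x → cong (left P) (cast-id refl x)) (λ x → cong (right P) (cast-id refl x))

  castᵖ-cong : ∀ {m m′ n n′} (p : m ≡ m′) (q : n ≡ n′) {P P′ : Pre m n} → P ~ P′ → castᵖ p q P ~ castᵖ p q P′
  castᵖ-cong refl refl {P} {P′} h = ~-trans (castᵖ-refl P) (~-trans h (~-sym (castᵖ-refl P′)))

  -- The vertices on the two identity strands are glued to legs of `f`, and `t` sends them there.
  -- The loop through the strands thereby becomes the loop of `f`.
  Trᵖ-tightening : ∀ x {m n m′ n′} (g : Pre m′ m) (f : Pre (x + m) (x + n)) (h : Pre n n′) →
                   Trᵖ x ((idᵖ {x} ⊗ᵖ g) ⨾ᵖ f ⨾ᵖ (idᵖ {x} ⊗ᵖ h)) ~ g ⨾ᵖ Trᵖ x f ⨾ᵖ h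
  Trᵖ-tightening x {m} {n} {m′} {n′} g f h = mk~ fw from from-R i₁ i₂ fromE e₁ e₂
    where
    A = (idᵖ {x} ⊗ᵖ g) ⨾ᵖ f ⨾ᵖ (idᵖ {x} ⊗ᵖ h)
    B = g ⨾ᵖ Trᵖ x f ⨾ᵖ h
    idx : Fin x → Fin x
    idx i = i
    t : V A → V B
    t (inj₁ (inj₁ (inj₁ i))) = inj₁ (inj₂ (left f (i ↑ˡ m)))
    t (inj₁ (inj₁ (inj₂ v))) = inj₁ (inj₁ v)
    t (inj₁ (inj₂ v))        = inj₁ (inj₂ v)
    t (inj₂ (inj₁ i))        = inj₁ (inj₂ (right f (i ↑ˡ n)))
    t (inj₂ (inj₂ v))        = inj₂ v
    t-glue₁ : ∀ j → Eq B (t (inj₁ (inj₁ ((idx ⊞ right g) j)))) (inj₁ (inj₂ (left f j)))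
    t-glue₁ = split-ind x _ (λ i → ≡⇒Eq (cong (t ∘ inj₁ ∘ inj₁) (⊞-ˡ idx (right g) i)))
      (λ j → ≡⇒Eq (cong (t ∘ inj₁ ∘ inj₁) (⊞-ʳ idx (right g) j)) ▹ ⨾-inl (⨾-glue j refl refl))
    t-glue₂ : ∀ j → Eq B (inj₁ (inj₂ (right f j))) (t (inj₂ ((idx ⊞ left h) j)))
    t-glue₂ = split-ind x _ (λ i → ≡⇒Eq (sym (cong (t ∘ inj₂) (⊞-ˡ idx (left h) i))))
      (λ j → ⨾-glue j refl refl ▹ ≡⇒Eq (sym (cong (t ∘ inj₂) (⊞-ʳ idx (left h) j))))
    t-R : ∀ a b → RTr x A a b → Eq B (t a) (t b)
    t-R _ _ (base (par (inl (par (inl (inr r)))))) = ⨾-inl (⨾-inl (gen≡ r))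
    t-R _ _ (base (par (inl (par (inr r)))))       = ⨾-inl (⨾-inr (gen≡ (base r)))
    t-R _ _ (base (par (inl (glued j))))           = t-glue₁ j
    t-R _ _ (base (par (inr (inr r))))             = ⨾-inr (gen≡ r)
    t-R _ _ (base (glued j))                       = t-glue₂ j
    t-R _ _ (loop i) = ≡⇒Eq (cong (t ∘ inj₁ ∘ inj₁) (⊞-ˡ idx (left g) i)) ▹ ⨾-inl (⨾-inr (Tr-loop i refl refl))
                       ▹ ≡⇒Eq (sym (cong (t ∘ inj₂) (⊞-ˡ idx (right h) i)))
    fw : Trᵖ x A ⟶ B
    fw = record
      { to = t ; to-R = t-R
      ; toE = λ { (inj₁ (inj₁ (inj₂ e))) → inj₁ (inj₁ e) ; (inj₁ (inj₂ e)) → inj₁ (inj₂ e) ; (inj₂ (inj₂ e)) → inj₂ e }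
      ; to-src = λ { (inj₁ (inj₁ (inj₂ e))) _ → Eq-refl ; (inj₁ (inj₂ e)) _ → Eq-refl ; (inj₂ (inj₂ e)) _ → Eq-refl }
      ; to-tgt = λ { (inj₁ (inj₁ (inj₂ e))) _ → Eq-refl ; (inj₁ (inj₂ e)) _ → Eq-refl ; (inj₂ (inj₂ e)) _ → Eq-refl }
      ; to-label = λ { (inj₁ (inj₁ (inj₂ e))) → refl ; (inj₁ (inj₂ e)) → refl ; (inj₂ (inj₂ e)) → refl }
      ; to-left = λ i → ≡⇒Eq (cong (t ∘ inj₁ ∘ inj₁) (⊞-ʳ idx (left g) i))
      ; to-right = λ i → ≡⇒Eq (cong (t ∘ inj₂) (⊞-ʳ idx (right h) i)) }
    from : V B → V A
    from (inj₁ (inj₁ v)) = inj₁ (inj₁ (inj₂ v))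
    from (inj₁ (inj₂ v)) = inj₁ (inj₂ v)
    from (inj₂ v)        = inj₂ (inj₂ v)
    glue₁ : ∀ i → Eq (Trᵖ x A) (inj₁ (inj₁ (inj₁ i))) (inj₁ (inj₂ (left f (i ↑ˡ m))))
    glue₁ i = Tr-base (⨾-inl (⨾-glue (i ↑ˡ m) (⊞-ˡ idx (right g) i) refl))
    glue₂ : ∀ i → Eq (Trᵖ x A) (inj₁ (inj₂ (right f (i ↑ˡ n)))) (inj₂ (inj₁ i))
    glue₂ i = Tr-base (⨾-glue (i ↑ˡ n) refl (⊞-ˡ idx (left h) i))
    from-R : ∀ a b → R B a b → Eq (Trᵖ x A) (from a) (from b)
    from-R _ _ (par (inl (par (inl r))))        = Tr-base (⨾-inl (⨾-inl (⊗-inr (gen≡ r))))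
    from-R _ _ (par (inl (par (inr (base r))))) = Tr-base (⨾-inl (⨾-inr (gen≡ r)))
    from-R _ _ (par (inl (par (inr (loop i))))) = Eq-sym (glue₁ i) ▹
      Tr-loop i (cong (inj₁ ∘ inj₁) (⊞-ˡ idx (left g) i)) (cong inj₂ (⊞-ˡ idx (right h) i)) ▹ Eq-sym (glue₂ i)
    from-R _ _ (par (inl (glued j))) = Tr-base (⨾-inl (⨾-glue (x ↑ʳ j) (⊞-ʳ idx (right g) j) refl))
    from-R _ _ (par (inr r))         = Tr-base (⨾-inr (⊗-inr (gen≡ r)))
    from-R _ _ (glued j)             = Tr-base (⨾-glue (x ↑ʳ j) refl (⊞-ʳ idx (left h) j))
    i₁ : ∀ v → Eq (Trᵖ x A) (from (t v)) v
    i₁ (inj₁ (inj₁ (inj₁ i))) = Eq-sym (glue₁ i)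
    i₁ (inj₁ (inj₁ (inj₂ v))) = Eq-refl
    i₁ (inj₁ (inj₂ v))        = Eq-refl
    i₁ (inj₂ (inj₁ i))        = glue₂ i
    i₁ (inj₂ (inj₂ v))        = Eq-refl
    i₂ : ∀ v → Eq B (t (from v)) v
    i₂ (inj₁ (inj₁ v)) = Eq-refl
    i₂ (inj₁ (inj₂ v)) = Eq-refl
    i₂ (inj₂ v)        = Eq-refl
    fromE : ∀ {k l} → E B k l → E A k l
    fromE (inj₁ (inj₁ e)) = inj₁ (inj₁ (inj₂ e))
    fromE (inj₁ (inj₂ e)) = inj₁ (inj₂ e)
    fromE (inj₂ e)        = inj₂ (inj₂ e)
    e₁ : ∀ {k l} (e : E A k l) → fromE (toE fw e) ≡ e
    e₁ (inj₁ (inj₁ (inj₂ e))) = refl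
    e₁ (inj₁ (inj₂ e))        = refl
    e₁ (inj₂ (inj₂ e))        = refl
    e₂ : ∀ {k l} (e : E B k l) → toE fw (fromE e) ≡ e
    e₂ (inj₁ (inj₁ e)) = refl
    e₂ (inj₁ (inj₂ e)) = refl
    e₂ (inj₂ e)        = refl

  -- Gluing and looping exchange roles: the interface `y` is glued on one side and looped on the
  -- other, and conversely for `x`. The vertices of the identity strand are represented by the legs
  -- of `f` that they are glued to.
  Trᵖ-sliding : ∀ x y {m n} (f : Pre (x + m) (y + n)) (g : Pre y x) →
                Trᵖ x (f ⨾ᵖ (g ⊗ᵖ idᵖ {n})) ~ Trᵖ y ((g ⊗ᵖ idᵖ {m}) ⨾ᵖ f)
  Trᵖ-sliding x y {m} {n} f g = mk~ fw from from-R i₁ i₂ fromE e₁ e₂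
    where
    idᶠ : ∀ {k} → Fin k → Fin k
    idᶠ i = i
    A = f ⨾ᵖ (g ⊗ᵖ idᵖ {n})
    B = (g ⊗ᵖ idᵖ {m}) ⨾ᵖ f
    t : V A → V B
    t (inj₁ v)        = inj₂ v
    t (inj₂ (inj₁ w)) = inj₁ (inj₁ w)
    t (inj₂ (inj₂ j)) = inj₂ (right f (y ↑ʳ j))
    loopB : ∀ i → Eq (Trᵖ y B) (inj₁ (inj₁ (left g i))) (inj₂ (right f (i ↑ˡ n)))
    loopB i = Tr-loop i (cong inj₁ (⊞-ˡ (left g) idᶠ i)) refl
    t-glue : ∀ j → Eq (Trᵖ y B) (inj₂ (right f j)) (t (inj₂ ((left g ⊞ idᶠ) j)))
    t-glue = split-ind y _ (λ i → Eq-sym (loopB i) ▹ ≡⇒Eq (sym (cong (t ∘ inj₂) (⊞-ˡ (left g) idᶠ i))))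
      (λ j → ≡⇒Eq (sym (cong (t ∘ inj₂) (⊞-ʳ (left g) idᶠ j))))
    t-R : ∀ a b → RTr x A a b → Eq (Trᵖ y B) (t a) (t b)
    t-R _ _ (base (par (inl r)))       = Tr-base (⨾-inr (gen≡ r))
    t-R _ _ (base (par (inr (inl r)))) = Tr-base (⨾-inl (⊗-inl (gen≡ r)))
    t-R _ _ (base (glued j))           = t-glue j
    t-R _ _ (loop i) = Tr-base (Eq-sym (⨾-glue (i ↑ˡ m) (⊞-ˡ (right g) idᶠ i) refl)) ▹
      ≡⇒Eq (sym (cong (t ∘ inj₂) (⊞-ˡ (right g) idᶠ i)))
    fw : Trᵖ x A ⟶ Trᵖ y B
    fw = record
      { to = t ; to-R = t-R
      ; toE = λ { (inj₁ e) → inj₂ e ; (inj₂ (inj₁ e)) → inj₁ (inj₁ e) }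
      ; to-src = λ { (inj₁ e) _ → Eq-refl ; (inj₂ (inj₁ e)) _ → Eq-refl }
      ; to-tgt = λ { (inj₁ e) _ → Eq-refl ; (inj₂ (inj₁ e)) _ → Eq-refl }
      ; to-label = λ { (inj₁ e) → refl ; (inj₂ (inj₁ e)) → refl }
      ; to-left = λ j → Tr-base (Eq-sym (⨾-glue (x ↑ʳ j) (⊞-ʳ (right g) idᶠ j) refl)) ▹
          ≡⇒Eq (cong inj₁ (sym (⊞-ʳ (left g) idᶠ j)))
      ; to-right = λ j → ≡⇒Eq (cong (t ∘ inj₂) (⊞-ʳ (right g) idᶠ j)) }
    from : V B → V A
    from (inj₁ (inj₁ w)) = inj₂ (inj₁ w)
    from (inj₁ (inj₂ j)) = inj₁ (left f (x ↑ʳ j))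
    from (inj₂ v)        = inj₁ v
    loopA : ∀ i → Eq (Trᵖ x A) (inj₁ (left f (i ↑ˡ m))) (inj₂ (inj₁ (right g i)))
    loopA i = Tr-loop i refl (cong inj₂ (⊞-ˡ (right g) idᶠ i))
    from-glue : ∀ j → Eq (Trᵖ x A) (from (inj₁ ((right g ⊞ idᶠ) j))) (inj₁ (left f j))
    from-glue = split-ind x _ (λ i → ≡⇒Eq (cong (from ∘ inj₁) (⊞-ˡ (right g) idᶠ i)) ▹ Eq-sym (loopA i))
      (λ j → ≡⇒Eq (cong (from ∘ inj₁) (⊞-ʳ (right g) idᶠ j)))
    from-R : ∀ a b → R (Trᵖ y B) a b → Eq (Trᵖ x A) (from a) (from b)
    from-R _ _ (base (par (inl (inl r)))) = Tr-base (⨾-inr (⊗-inl (gen≡ r)))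
    from-R _ _ (base (par (inr r)))       = Tr-base (⨾-inl (gen≡ r))
    from-R _ _ (base (glued j))           = from-glue j
    from-R _ _ (loop i) = ≡⇒Eq (cong (from ∘ inj₁) (⊞-ˡ (left g) idᶠ i)) ▹
      Tr-base (Eq-sym (⨾-glue (i ↑ˡ n) refl (⊞-ˡ (left g) idᶠ i)))
    i₁ : ∀ v → Eq (Trᵖ x A) (from (t v)) v
    i₁ (inj₁ v)        = Eq-refl
    i₁ (inj₂ (inj₁ w)) = Eq-refl
    i₁ (inj₂ (inj₂ j)) = Tr-base (⨾-glue (y ↑ʳ j) refl (⊞-ʳ (left g) idᶠ j))
    i₂ : ∀ v → Eq (Trᵖ y B) (t (from v)) v
    i₂ (inj₁ (inj₁ w)) = Eq-refl
    i₂ (inj₁ (inj₂ j)) = Tr-base (Eq-sym (⨾-glue (x ↑ʳ j) (⊞-ʳ (right g) idᶠ j) refl))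
    i₂ (inj₂ v)        = Eq-refl
    fromE : ∀ {k l} → E B k l → E A k l
    fromE (inj₁ (inj₁ e)) = inj₂ (inj₁ e)
    fromE (inj₂ e)        = inj₁ e
    e₁ : ∀ {k l} (e : E A k l) → fromE (toE fw e) ≡ e
    e₁ (inj₁ e)        = refl
    e₁ (inj₂ (inj₁ e)) = refl
    e₂ : ∀ {k l} (e : E B k l) → toE fw (fromE e) ≡ e
    e₂ (inj₁ (inj₁ e)) = refl
    e₂ (inj₂ e)        = refl

  Trᵖ-vanishing₀ : ∀ {m n} (f : Pre m n) → Trᵖ 0 f ~ f
  Trᵖ-vanishing₀ f = same-graph (λ { _ _ (base r) → gen≡ r }) (λ _ _ r → gen≡ (base r))
    (λ _ _ → refl) (λ _ _ → refl) (λ _ → refl) (λ _ → refl)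

  -- Vertices and hyperedges are the same on both sides; only the list of looped pairs is split in
  -- two.
  Trᵖ-vanishing₊ : ∀ x y {m n} (f : Pre ((x + y) + m) ((x + y) + n)) →
                   Trᵖ (x + y) f ~ Trᵖ y (Trᵖ x (castᵖ (+-assoc x y m) (+-assoc x y n) f))
  Trᵖ-vanishing₊ x y {m} {n} f = same-graph
    (λ { _ _ (base r) → Tr-base (Tr-base (gen≡ r)) ; _ _ (loop k) → loops k })
    (λ { _ _ (base (base r)) → Tr-base (gen≡ r)
       ; _ _ (base (loop i)) → Tr-loop (i ↑ˡ y) (cong (left f) (sym (cast-₁ {x} {y} {m} a i))) (cong (right f) (sym (cast-₁ {x} {y} {n} b i)))
       ; _ _ (loop j) → Tr-loop (x ↑ʳ j) (cong (left f) (sym (cast-₂ {x} {y} {m} a j))) (cong (right f) (sym (cast-₂ {x} {y} {n} b j))) })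
    (λ _ _ → refl) (λ _ _ → refl) (λ k → cong (left f) (sym (cast-₃ {x} {y} {m} a k))) (λ k → cong (right f) (sym (cast-₃ {x} {y} {n} b k)))
    where
    a = sym (+-assoc x y m)
    b = sym (+-assoc x y n)
    loops : ∀ k → Eq (Trᵖ y (Trᵖ x (castᵖ (+-assoc x y m) (+-assoc x y n) f))) (left f (k ↑ˡ m)) (right f (k ↑ˡ n))
    loops = split-ind x _
      (λ i → Tr-base (Tr-loop i (cong (left f) (cast-₁ {x} {y} {m} a i)) (cong (right f) (cast-₁ {x} {y} {n} b i))))
      (λ j → Tr-loop j (cong (left f) (cast-₂ {x} {y} {m} a j)) (cong (right f) (cast-₂ {x} {y} {n} b j)))

  Trᵖ-superposing : ∀ x {m n p q} (f : Pre (x + m) (x + n)) (g : Pre p q) →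
                    Trᵖ x (castᵖ (+-assoc x m p) (+-assoc x n q) (f ⊗ᵖ g)) ~ Trᵖ x f ⊗ᵖ g
  Trᵖ-superposing x {m} {n} {p} {q} f g = same-graph t-R from-R
    (λ { (inj₁ _) _ → refl ; (inj₂ _) _ → refl }) (λ { (inj₁ _) _ → refl ; (inj₂ _) _ → refl })
    (leg (left f) (left g)) (leg (right f) (right g))
    where
    leg₁ : ∀ {m p} (l : Fin (x + m) → V f) (r : Fin p → V g) i → (l ⊞ r) (cast (sym (+-assoc x m p)) (i ↑ˡ (m + p))) ≡ inj₁ (l (i ↑ˡ m))
    leg₁ {m} {p} l r i = trans (cong (l ⊞ r) (cast-₁ {x} {m} {p} (sym (+-assoc x m p)) i)) (⊞-ˡ l r (i ↑ˡ m))
    leg : ∀ {m p} (l : Fin (x + m) → V f) (r : Fin p → V g) i → (l ⊞ r) (cast (sym (+-assoc x m p)) (x ↑ʳ i)) ≡ ((l ∘ (x ↑ʳ_)) ⊞ r) i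
    leg {m} {p} l r = split-ind m _
      (λ i → trans (cong (l ⊞ r) (cast-₂ {x} {m} {p} (sym (+-assoc x m p)) i)) (trans (⊞-ˡ l r (x ↑ʳ i)) (sym (⊞-ˡ (l ∘ (x ↑ʳ_)) r i))))
      (λ j → trans (cong (l ⊞ r) (cast-₃ {x} {m} {p} (sym (+-assoc x m p)) j)) (trans (⊞-ʳ l r j) (sym (⊞-ʳ (l ∘ (x ↑ʳ_)) r j))))
    t-R : ∀ a b → _ → Eq (Trᵖ x f ⊗ᵖ g) a b
    t-R _ _ (base (inl r)) = ⊗-inl (Tr-base (gen≡ r))
    t-R _ _ (base (inr r)) = ⊗-inr (gen≡ r)
    t-R _ _ (loop i) = ≡⇒Eq (leg₁ (left f) (left g) i) ▹ ⊗-inl (Tr-loop i refl refl) ▹ ≡⇒Eq (sym (leg₁ (right f) (right g) i))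
    from-R : ∀ a b → _ → Eq (Trᵖ x (castᵖ (+-assoc x m p) (+-assoc x n q) (f ⊗ᵖ g))) a b
    from-R _ _ (inl (base r)) = Tr-base (gen≡ (inl r))
    from-R _ _ (inl (loop i)) = Tr-loop i (leg₁ (left f) (left g) i) (leg₁ (right f) (right g) i)
    from-R _ _ (inr r) = Tr-base (gen≡ (inr r))

  -- The loop identifies the two halves of the vertices, and `t` folds them together.
  Trᵖ-yanking : ∀ x → Trᵖ x (wireᵖ (swapFin x x)) ~ idᵖ
  Trᵖ-yanking x = mk~ (record
      { to = t ; to-R = λ { _ _ (loop i) → ≡⇒Eq (trans (tˡ i) (sym (trans (cong t (swap-ˡ x x i)) (tʳ i)))) }
      ; toE = λ e → e ; to-src = λ () ; to-tgt = λ () ; to-label = λ ()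
      ; to-left = λ i → ≡⇒Eq (tʳ i) ; to-right = λ i → ≡⇒Eq (trans (cong t (swap-ʳ x x i)) (tˡ i)) })
    (x ↑ʳ_) (λ _ _ ()) (split-ind x _ (λ i → ≡⇒Eq (cong (x ↑ʳ_) (tˡ i)) ▹ Eq-sym (Tr-loop i refl (swap-ˡ x x i)))
      (λ i → ≡⇒Eq (cong (x ↑ʳ_) (tʳ i)))) (λ i → ≡⇒Eq (tʳ i)) (λ e → e) (λ ()) (λ ())
    where
    t : Fin (x + x) → Fin x
    t = [ (λ i → i) , (λ i → i) ]′ ∘ splitAt x
    tˡ : ∀ i → t (i ↑ˡ x) ≡ i
    tˡ i = cong [ (λ i → i) , (λ i → i) ]′ (splitAt-↑ˡ x i x)
    tʳ : ∀ i → t (x ↑ʳ i) ≡ i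
    tʳ i = cong [ (λ i → i) , (λ i → i) ]′ (splitAt-↑ʳ x x i)

lookup-ext : ∀ {A : Set} {n} (xs ys : Vec A n) → (∀ i → lookup xs i ≡ lookup ys i) → xs ≡ ys
lookup-ext [] [] h = refl
lookup-ext (x ∷ xs) (y ∷ ys) h with h zero | lookup-ext xs ys (h ∘ suc)
... | refl | refl = refl

-- The trace of cospans

module Semantics {c} (S : Signature c) where

  open Precospans S
  open Signature S
  open Congruence (S ⊎ₛ comonoidSignature) (ComonoidEquation S)
  private
    module H = LabelledHypergraph
    module C = Cospan
    Csp′ : ℕ → ℕ → Set _
    Csp′ = Cospan S

  quotient : ∀ (F : LabelledHypergraph S) {n} → (H.V F → Fin n) → LabelledHypergraph S
  quotient F q = record
    { hypergraph = record { V = Fin _ ; E = H.E F ; src = map q ∘ H.src F ; tgt = map q ∘ H.tgt F }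
    ; V-finite = Finite-Fin _ ; Edge-finite = H.Edge-finite F
    ; label = H.label F ; label-dom = H.label-dom F ; label-cod = H.label-cod F }

  module Loop x {m n} (f : Csp′ (x + m) (x + n)) =
    Coequaliser (coequalise (H.V-finite (C.apex f))
      (λ (i : Fin x) → HypHom.vmap (C.left f) (i ↑ˡ m)) (λ i → HypHom.vmap (C.right f) (i ↑ˡ n)))

  Trᶜ : ∀ x {m n} → Csp′ (x + m) (x + n) → Csp′ m n
  Trᶜ x f = record
    { apex = quotient (C.apex f) Q.proj
    ; left = fromDiscrete (λ i → Q.proj (HypHom.vmap (C.left f) (x ↑ʳ i)))
    ; right = fromDiscrete (λ i → Q.proj (HypHom.vmap (C.right f) (x ↑ʳ i))) }
    where module Q = Loop x f

  -- With an empty relation the generated equivalence is equality, so `reflect` turns an equivalence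
  -- of presentations back into an isomorphism of cospans.
  ⌈_⌉ : ∀ {m n} → Csp′ m n → Pre m n
  ⌈ f ⌉ = record
    { V = H.V F ; E = H.E F
    ; src = λ e → lookup (H.src F e) ; tgt = λ e → lookup (H.tgt F e) ; label = H.label F
    ; R = λ _ _ → ⊥
    ; left = HypHom.vmap (C.left f) ; right = HypHom.vmap (C.right f) }
    where
        F = C.apex f

  ⌈⌉-Eq : ∀ {m n} {f : Csp′ m n} {v w} → Eq ⌈ f ⌉ v w → v ≡ w
  ⌈⌉-Eq p = run p (λ v → v) (λ _ _ ())

  hom : ∀ {m n} {f g : Csp′ m n} → ⌈ f ⌉ ⟶ ⌈ g ⌉ → HypHom (C.apex f) (C.apex g)
  hom {f = f} {g} p = record
    { vmap = to p ; emap = toE p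
    ; src-pres = λ e → lookup-ext _ _ (λ i → trans (lookup-map i (to p) (H.src (C.apex f) e)) (⌈⌉-Eq {f = g} (to-src p e i)))
    ; tgt-pres = λ e → lookup-ext _ _ (λ i → trans (lookup-map i (to p) (H.tgt (C.apex f) e)) (⌈⌉-Eq {f = g} (to-tgt p e i)))
    ; label-pres = to-label p }

  reflect : ∀ {m n} {f g : Csp′ m n} → ⌈ f ⌉ ~ ⌈ g ⌉ → f ≈ᶜ g
  reflect {f = f} {g} p = record
    { iso = record
      { to = hom {f = f} {g} (fwd p) ; from = hom {f = g} {f} (bwd p)
      ; from-to = mk≐ (λ v → ⌈⌉-Eq {f = f} (inv₁ p v)) (invE₁ p) ; to-from = mk≐ (λ v → ⌈⌉-Eq {f = g} (inv₂ p v)) (invE₂ p) }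
    ; left-comm = discrete-≐ (λ x → ⌈⌉-Eq {f = g} (to-left (fwd p) x))
    ; right-comm = discrete-≐ (λ x → ⌈⌉-Eq {f = g} (to-right (fwd p) x)) }

  reify : ∀ {m n} {f g : Csp′ m n} → f ≈ᶜ g → ⌈ f ⌉ ~ ⌈ g ⌉
  reify {f = f} {g} p = mk~
    (record { to = HypHom.vmap t ; to-R = λ _ _ () ; toE = HypHom.emap t
            ; to-src = λ e i → ≡⇒Eq (trans (sym (lookup-map i _ (H.src (C.apex f) e))) (cong (λ xs → lookup xs i) (HypHom.src-pres t e)))
            ; to-tgt = λ e i → ≡⇒Eq (trans (sym (lookup-map i _ (H.tgt (C.apex f) e))) (cong (λ xs → lookup xs i) (HypHom.tgt-pres t e)))
            ; to-label = HypHom.label-pres t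
            ; to-left = λ x → ≡⇒Eq (_≐_.V≐ (_≈ᶜ_.left-comm p) x)
            ; to-right = λ x → ≡⇒Eq (_≐_.V≐ (_≈ᶜ_.right-comm p) x) })
    (HypHom.vmap (_≈ᶜ_.from p)) (λ _ _ ())
    (λ v → ≡⇒Eq (_≐_.V≐ (_≈ᶜ_.from-to p) v)) (λ v → ≡⇒Eq (_≐_.V≐ (_≈ᶜ_.to-from p) v))
    (HypHom.emap (_≈ᶜ_.from p)) (λ e → _≐_.E≐ (_≈ᶜ_.from-to p) e) (λ e → _≐_.E≐ (_≈ᶜ_.to-from p) e)
    where
    t : HypHom (C.apex f) (C.apex g)
    t = _≈ᶜ_.to p

  ⌈wire⌉ : ∀ {m n} (ρ : Fin n → Fin m) → ⌈ wire ρ ⌉ ~ wireᵖ ρ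
  ⌈wire⌉ ρ = same-graph (λ _ _ ()) (λ _ _ ()) (λ ()) (λ ()) (λ _ → refl) (λ _ → refl)

  ⌈⊗⌉ : ∀ {m n p q} (f : Csp′ m n) (g : Csp′ p q) → ⌈ f ⊗ᶜ g ⌉ ~ ⌈ f ⌉ ⊗ᵖ ⌈ g ⌉
  ⌈⊗⌉ f g = same-graph (λ _ _ ()) (λ { _ _ (inl ()) ; _ _ (inr ()) })
    (λ { (inj₁ e) i → lookup-map i inj₁ (H.src F e) ; (inj₂ e) i → lookup-map i inj₂ (H.src G e) })
    (λ { (inj₁ e) i → lookup-map i inj₁ (H.tgt F e) ; (inj₂ e) i → lookup-map i inj₂ (H.tgt G e) })
    (λ _ → refl) (λ _ → refl)
    where
    F = C.apex f
    G = C.apex g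

  -- `section` picks a representative of each class of the pushout. `Coequaliser.respects` says
  -- precisely that it is related to the original vertex by gluing.
  ⌈⨾⌉ : ∀ {m n p} (f : Csp′ m n) (g : Csp′ n p) → ⌈ f ⨾ᶜ g ⌉ ~ ⌈ f ⌉ ⨾ᵖ ⌈ g ⌉
  ⌈⨾⌉ f g = mk~
    (record { to = Q.section ; to-R = λ _ _ () ; toE = λ e → e
            ; to-src = λ { (inj₁ e) i → ≡⇒Eq (cong Q.section (lookup-map i (Q.proj ∘ inj₁) (H.src F e))) ▹ section-proj _
                         ; (inj₂ e) i → ≡⇒Eq (cong Q.section (lookup-map i (Q.proj ∘ inj₂) (H.src G e))) ▹ section-proj _ }
            ; to-tgt = λ { (inj₁ e) i → ≡⇒Eq (cong Q.section (lookup-map i (Q.proj ∘ inj₁) (H.tgt F e))) ▹ section-proj _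
                         ; (inj₂ e) i → ≡⇒Eq (cong Q.section (lookup-map i (Q.proj ∘ inj₂) (H.tgt G e))) ▹ section-proj _ }
            ; to-label = λ { (inj₁ _) → refl ; (inj₂ _) → refl }
            ; to-left = λ _ → section-proj _ ; to-right = λ _ → section-proj _ })
    Q.proj (λ { _ _ (par (inl ())) ; _ _ (par (inr ())) ; _ _ (glued i) → ≡⇒Eq (Q.proj-eq i) })
    (λ v → ≡⇒Eq (Q.proj-section v)) section-proj (λ e → e) (λ _ → refl) (λ _ → refl)
    where
    F = C.apex f
    G = C.apex g
    module Q = Pushout.C (C.right f) (C.left g)
    section-proj : ∀ a → Eq (⌈ f ⌉ ⨾ᵖ ⌈ g ⌉) (Q.section (Q.proj a)) a
    section-proj a = mkEq (λ h resp → Q.respects h (λ i → resp _ _ (glued i)) a)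

  ⌈Tr⌉ : ∀ x {m n} (f : Csp′ (x + m) (x + n)) → ⌈ Trᶜ x f ⌉ ~ Trᵖ x ⌈ f ⌉
  ⌈Tr⌉ x f = mk~
    (record { to = Q.section ; to-R = λ _ _ () ; toE = λ e → e
            ; to-src = λ e i → ≡⇒Eq (cong Q.section (lookup-map i Q.proj (H.src (C.apex f) e))) ▹ section-proj _
            ; to-tgt = λ e i → ≡⇒Eq (cong Q.section (lookup-map i Q.proj (H.tgt (C.apex f) e))) ▹ section-proj _
            ; to-label = λ _ → refl ; to-left = λ _ → section-proj _ ; to-right = λ _ → section-proj _ })
    Q.proj (λ { _ _ (base ()) ; _ _ (loop i) → ≡⇒Eq (Q.proj-eq i) })
    (λ v → ≡⇒Eq (Q.proj-section v)) section-proj (λ e → e) (λ _ → refl) (λ _ → refl)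
    where
    module Q = Loop x f
    section-proj : ∀ a → Eq (Trᵖ x ⌈ f ⌉) (Q.section (Q.proj a)) a
    section-proj a = mkEq (λ h resp → Q.respects h (λ i → resp _ _ (loop i)) a)

  ⌈cast⌉ : ∀ {m m′ n n′} (p : m ≡ m′) (q : n ≡ n′) (f : Csp′ m n) →
           ⌈ subst₂ (Cospan S) p q f ⌉ ~ castᵖ p q ⌈ f ⌉
  ⌈cast⌉ p q f = ~-trans (reify {f = subst₂ (Cospan S) p q f} (subst-≈ p q f)) (same-graph (λ _ _ ()) (λ _ _ ()) (λ _ _ → refl) (λ _ _ → refl) (λ _ → refl) (λ _ → refl))

  -- Hyperedges are sorted by arity, so a single one is given by the proofs that the arity is that
  -- of `g`; these are unique.
  genᶜ : ∀ g → Csp′ (dom g) (cod g)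
  genᶜ g = record
    { apex = record
      { hypergraph = record
        { V = Fin (dom g) ⊎ Fin (cod g) ; E = λ k l → dom g ≡ k × cod g ≡ l
        ; src = λ (p , _) → tabulate (inj₁ ∘ cast (sym p)) ; tgt = λ (_ , q) → tabulate (inj₂ ∘ cast (sym q)) }
      ; V-finite = Finite-⊎ (Finite-Fin _) (Finite-Fin _)
      ; Edge-finite = 1 , mk↔ₛ′ (λ _ → zero) (λ _ → dom g , cod g , refl , refl) (λ { zero → refl }) (λ { (_ , _ , refl , refl) → refl })
      ; label = λ _ → g ; label-dom = proj₁ ; label-cod = proj₂ }
    ; left = fromDiscrete inj₁ ; right = fromDiscrete inj₂ }

  PLM-resp : ∀ {m n} {f g : Cospan S m n} → f ≈ᶜ g → PLM f → PLM g
  PLM-resp {f = f} {g} p plm = record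
    { left-inj = λ {x} {y} e → F.left-inj (trans (sym (from-left p x)) (trans (cong (HypHom.vmap θ) e) (from-left p y)))
    ; target-inj = λ {s} {t} e → trans (sym (there-back s)) (trans (cong there (F.target-inj {back s} {back t}
        (trans (sym (at-back s)) (trans (cong (HypHom.vmap θ) e) (at-back t))))) (there-back t))
    ; disjoint = λ {t} {x} e → F.disjoint {back t} {x}
        (trans (sym (at-back t)) (trans (cong (HypHom.vmap θ) e) (from-left p x)))
    }
    where
    module F = PLM plm
    θ : HypHom (C.apex g) (C.apex f)
    θ = _≈ᶜ_.from p
    back : TargetPosition (C.apex g) → TargetPosition (C.apex f)
    back ((k , l , e) , i) = (k , l , HypHom.emap θ e) , i
    there : TargetPosition (C.apex f) → TargetPosition (C.apex g)
    there ((k , l , e) , i) = (k , l , HypHom.emap (_≈ᶜ_.to p) e) , i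
    there-back : ∀ t → there (back t) ≡ t
    there-back ((k , l , e) , i) = cong (λ e → (k , l , e) , i) (_≐_.E≐ (_≈ᶜ_.to-from p) e)
    at-back : ∀ t → HypHom.vmap θ (targetAt (C.apex g) t) ≡ targetAt (C.apex f) (back t)
    at-back ((k , l , e) , i) = trans (sym (lookup-map i (HypHom.vmap θ) (H.tgt (C.apex g) e)))
      (cong (λ xs → lookup xs i) (HypHom.tgt-pres θ e))

  -- The traced input is no hyperedge target and differs from the other inputs. `classify` replaces
  -- it by the traced output and fixes all other vertices; it factors through the quotient, which
  -- therefore keeps targets and remaining inputs apart.
  Tr₁-PLM : ∀ {m n} (f : Cospan S (1 + m) (1 + n)) → PLM f → PLM (Trᶜ 1 f)
  Tr₁-PLM {m} {n} f plm = record
    { left-inj = λ e → suc-injective (F.left-inj (separate (left≢ _) (left≢ _) e))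
    ; target-inj = λ {s} {t} e → F.target-inj {s} {t} (separate (F.disjoint {s}) (F.disjoint {t})
        (trans (sym (at s)) (trans e (at t))))
    ; disjoint = λ {t} e → F.disjoint {t} (separate (F.disjoint {t}) (left≢ _) (trans (sym (at t)) e))
    }
    where
    module F = PLM plm
    module Q = Loop 1 f
    G = C.apex f
    l : Fin (1 + m) → H.V G
    l = HypHom.vmap (C.left f)
    suc-injective : ∀ {k} {x y : Fin k} → Fin.suc x ≡ suc y → x ≡ y
    suc-injective refl = refl
    left≢ : ∀ x → l (suc x) ≢ l zero
    left≢ x e with F.left-inj e
    ... | ()
    choose : ∀ v → Dec (v ≡ l zero) → H.V G
    choose v (yes _) = HypHom.vmap (C.right f) zero
    choose v (no _)  = v
    classify : H.V G → H.V G
    classify v = choose v (Finite-≟ (H.V-finite G) v (l zero))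
    classify-≢ : ∀ {v} → v ≢ l zero → classify v ≡ v
    classify-≢ {v} ne with Finite-≟ (H.V-finite G) v (l zero)
    ... | yes p = ⊥-elim (ne p)
    ... | no _  = refl
    classify-left : classify (l zero) ≡ HypHom.vmap (C.right f) zero
    classify-left with Finite-≟ (H.V-finite G) (l zero) (l zero)
    ... | yes _ = refl
    ... | no ne = ⊥-elim (ne refl)
    classify-right : classify (HypHom.vmap (C.right f) zero) ≡ HypHom.vmap (C.right f) zero
    classify-right with Finite-≟ (H.V-finite G) (HypHom.vmap (C.right f) zero) (l zero)
    ... | yes _ = refl
    ... | no _  = refl
    separate : ∀ {v w} → v ≢ l zero → w ≢ l zero → Q.proj v ≡ Q.proj w → v ≡ w
    separate {v} {w} p q e = trans (sym (classify-≢ p)) (trans (sym (Q.respects classify resp v))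
      (trans (cong (classify ∘ Q.section) e) (trans (Q.respects classify resp w) (classify-≢ q))))
      where
      resp : (i : Fin 1) → classify (l (i ↑ˡ m)) ≡ classify (HypHom.vmap (C.right f) (i ↑ˡ n))
      resp zero = trans classify-left (sym classify-right)
    at : ∀ t → targetAt (C.apex (Trᶜ 1 f)) t ≡ Q.proj (targetAt G t)
    at ((_ , _ , e) , i) = lookup-map i Q.proj (H.tgt G e)

  gen-PLM : ∀ g → PLM (genᶜ g)
  gen-PLM g = record
    { left-inj = inj₁-injective
    ; target-inj = λ {s} {t} → inj s t
    ; disjoint = λ {t} {x} → disj t x }
    where
    at : ∀ t → Σ[ j ∈ _ ] targetAt (C.apex (genᶜ g)) t ≡ inj₂ j
    at ((_ , _ , (p , q)) , i) = _ , lookup∘tabulate (inj₂ ∘ cast (sym q)) i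
    disj : ∀ t x → targetAt (C.apex (genᶜ g)) t ≢ inj₁ x
    disj t x e with trans (sym (proj₂ (at t))) e
    ... | ()
    inj : ∀ s t → targetAt (C.apex (genᶜ g)) s ≡ targetAt (C.apex (genᶜ g)) t → s ≡ t
    inj ((_ , _ , (refl , refl)) , i) ((_ , _ , (refl , refl)) , j) e = cong ((_ , _ , (refl , refl)) ,_)
      (trans (sym (cast-id refl i)) (trans (inj₂-injective (trans (sym (lookup∘tabulate (inj₂ ∘ cast refl) i))
        (trans e (lookup∘tabulate (inj₂ ∘ cast refl) j)))) (cast-id refl j)))

  -- Abstract, because comparing unfolded coequalisers is expensive.
  infixl 6 _⨾ˢ_
  infixl 7 _⊗ˢ_
  abstract
    _⨾ˢ_ : ∀ {m n p} → Csp′ m n → Csp′ n p → Csp′ m p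
    _⨾ˢ_ = _⨾ᶜ_

    _⊗ˢ_ : ∀ {m n p q} → Csp′ m n → Csp′ p q → Csp′ (m + p) (n + q)
    _⊗ˢ_ = _⊗ᶜ_

    Trˢ : ∀ x {m n} → Csp′ (x + m) (x + n) → Csp′ m n
    Trˢ = Trᶜ

    ⨾ˢ≈⨾ᶜ : ∀ {m n p} (f : Csp′ m n) (g : Csp′ n p) → f ⨾ˢ g ≈ᶜ f ⨾ᶜ g
    ⨾ˢ≈⨾ᶜ f g = ≈ᶜ-refl

    ⊗ˢ≈⊗ᶜ : ∀ {m n p q} (f : Csp′ m n) (g : Csp′ p q) → f ⊗ˢ g ≈ᶜ f ⊗ᶜ g
    ⊗ˢ≈⊗ᶜ f g = ≈ᶜ-refl

    ⌈⨾ˢ⌉ : ∀ {m n p} (f : Csp′ m n) (g : Csp′ n p) {P : Pre m n} {Q : Pre n p} →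
           ⌈ f ⌉ ~ P → ⌈ g ⌉ ~ Q → ⌈ f ⨾ˢ g ⌉ ~ P ⨾ᵖ Q
    ⌈⨾ˢ⌉ f g p q = ~-trans (⌈⨾⌉ f g) (⨾ᵖ-cong p q)

    ⌈⊗ˢ⌉ : ∀ {m n p q} (f : Csp′ m n) (g : Csp′ p q) {P : Pre m n} {Q : Pre p q} →
           ⌈ f ⌉ ~ P → ⌈ g ⌉ ~ Q → ⌈ f ⊗ˢ g ⌉ ~ P ⊗ᵖ Q
    ⌈⊗ˢ⌉ f g p q = ~-trans (⌈⊗⌉ f g) (⊗ᵖ-cong p q)

    ⌈Trˢ⌉ : ∀ x {m n} (f : Csp′ (x + m) (x + n)) {P : Pre (x + m) (x + n)} → ⌈ f ⌉ ~ P → ⌈ Trˢ x f ⌉ ~ Trᵖ x P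
    ⌈Trˢ⌉ x f p = ~-trans (⌈Tr⌉ x f) (Trᵖ-cong x p)

    ⨾ˢ-cong : ∀ {m n p} {f f′ : Csp′ m n} {g g′ : Csp′ n p} → f ≈ᶜ f′ → g ≈ᶜ g′ → f ⨾ˢ g ≈ᶜ f′ ⨾ˢ g′
    ⨾ˢ-cong = ⨾ᶜ-cong

    ⨾ˢ-assoc : ∀ {m n p q} (f : Csp′ m n) (g : Csp′ n p) (h : Csp′ p q) → (f ⨾ˢ g) ⨾ˢ h ≈ᶜ f ⨾ˢ (g ⨾ˢ h)
    ⨾ˢ-assoc = ⨾ᶜ-assoc

    ⨾ˢ-identityˡ : ∀ {m n} (f : Csp′ m n) → idᶜ ⨾ˢ f ≈ᶜ f
    ⨾ˢ-identityˡ f = ≈ᶜ-trans (wire-⨾ (λ x → x) (λ x → x) (λ _ → refl) (λ _ → refl) f) (≈ᶜ-legs (λ _ → refl) (λ _ → refl))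

    ⨾ˢ-identityʳ : ∀ {m n} (f : Csp′ m n) → f ⨾ˢ idᶜ ≈ᶜ f
    ⨾ˢ-identityʳ f = ≈ᶜ-trans (⨾-wire f (λ x → x)) (≈ᶜ-legs (λ _ → refl) (λ _ → refl))

    ⊗ˢ-cong : ∀ {m n p q} {f f′ : Csp′ m n} {g g′ : Csp′ p q} → f ≈ᶜ f′ → g ≈ᶜ g′ → f ⊗ˢ g ≈ᶜ f′ ⊗ˢ g′
    ⊗ˢ-cong = ⊗ᶜ-cong

    ⊗ˢ-id : ∀ {m n} → idᶜ {n = m} ⊗ˢ idᶜ {n = n} ≈ᶜ idᶜ
    ⊗ˢ-id = ⊗ᶜ-id

    ⊗ˢ-⨾ : ∀ {m n p m′ n′ p′} (f : Csp′ m n) (g : Csp′ n p) (f′ : Csp′ m′ n′) (g′ : Csp′ n′ p′) →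
           (f ⨾ˢ g) ⊗ˢ (f′ ⨾ˢ g′) ≈ᶜ (f ⊗ˢ f′) ⨾ˢ (g ⊗ˢ g′)
    ⊗ˢ-⨾ = ⊗ᶜ-⨾

    ⊗ˢ-identityˡ : ∀ {m n} (f : Csp′ m n) → idᶜ {n = 0} ⊗ˢ f ≈ᶜ f
    ⊗ˢ-identityˡ = ⊗ᶜ-identityˡ

    ⊗ˢ-identityʳ : ∀ {m n} (f : Csp′ m n) → subst₂ (Cospan S) (+-identityʳ m) (+-identityʳ n) (f ⊗ˢ idᶜ {n = 0}) ≈ᶜ f
    ⊗ˢ-identityʳ = ⊗ᶜ-identityʳ

    ⊗ˢ-assoc : ∀ {m n p m′ n′ p′} (f : Csp′ m m′) (g : Csp′ n n′) (h : Csp′ p p′) →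
               subst₂ (Cospan S) (+-assoc m n p) (+-assoc m′ n′ p′) ((f ⊗ˢ g) ⊗ˢ h) ≈ᶜ f ⊗ˢ (g ⊗ˢ h)
    ⊗ˢ-assoc = ⊗ᶜ-assoc

    σˢ-natural : ∀ {m n m′ n′} (f : Csp′ m m′) (g : Csp′ n n′) → (f ⊗ˢ g) ⨾ˢ σᶜ m′ n′ ≈ᶜ σᶜ m n ⨾ˢ (g ⊗ˢ f)
    σˢ-natural = σᶜ-natural

    σˢ-involutive : ∀ m n → σᶜ m n ⨾ˢ σᶜ n m ≈ᶜ idᶜ
    σˢ-involutive = σᶜ-involutive

    σˢ-hexagon : ∀ m n p → σᶜ m (n + p)
                   ≈ᶜ subst₂ (Cospan S) (+-assoc m n p) (+-assoc n m p) (σᶜ m n ⊗ˢ idᶜ {n = p})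
                      ⨾ˢ subst₂ (Cospan S) refl (sym (+-assoc n p m)) (idᶜ {n = n} ⊗ˢ σᶜ m p)
    σˢ-hexagon = σᶜ-hexagon

    wire-⨾ˢ : ∀ {m n p} (ρ : Fin n → Fin m) (τ : Fin p → Fin n) → wire ρ ⨾ˢ wire τ ≈ᶜ wire (ρ ∘ τ)
    wire-⨾ˢ = wire-∘

    wire-⊗ˢ : ∀ {m n p q} (ρ : Fin n → Fin m) (τ : Fin q → Fin p) → wire ρ ⊗ˢ wire τ ≈ᶜ wire (_⊗ᶠ_ {S = S} ρ τ)
    wire-⊗ˢ = wire-⊗

    ⨾ˢ-PLM : ∀ {m n p} {f : Csp′ m n} {g : Csp′ n p} → PLM f → PLM g → PLM (f ⨾ˢ g)
    ⨾ˢ-PLM {f = f} {g} = ⨾-PLM {f = f} {g}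

    ⊗ˢ-PLM : ∀ {m n p q} {f : Csp′ m n} {g : Csp′ p q} → PLM f → PLM g → PLM (f ⊗ˢ g)
    ⊗ˢ-PLM {f = f} {g} = ⊗-PLM {f = f} {g}

    Trˢ₁-PLM : ∀ {m n} (f : Csp′ (1 + m) (1 + n)) → PLM f → PLM (Trˢ 1 f)
    Trˢ₁-PLM = Tr₁-PLM

  via : ∀ {m n} (f g : Csp′ m n) {P Q : Pre m n} → ⌈ f ⌉ ~ P → P ~ Q → ⌈ g ⌉ ~ Q → f ≈ᶜ g
  via f g p e q = reflect {f = f} {g} (~-trans p (~-trans e (~-sym q)))

  ⌈id⊗⌉ : ∀ x {m n} (k : Csp′ m n) → ⌈ idᶜ {n = x} ⊗ˢ k ⌉ ~ idᵖ {x} ⊗ᵖ ⌈ k ⌉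
  ⌈id⊗⌉ x k = ⌈⊗ˢ⌉ (idᶜ {n = x}) k (⌈wire⌉ (λ i → i)) ~-refl

  ⌈⊗id⌉ : ∀ x {m n} (k : Csp′ m n) → ⌈ k ⊗ˢ idᶜ {n = x} ⌉ ~ ⌈ k ⌉ ⊗ᵖ idᵖ {x}
  ⌈⊗id⌉ x k = ⌈⊗ˢ⌉ k (idᶜ {n = x}) ~-refl (⌈wire⌉ (λ i → i))

  ⌈Tr⌉₀ : ∀ x {m n} (f : Csp′ (x + m) (x + n)) → ⌈ Trˢ x f ⌉ ~ Trᵖ x ⌈ f ⌉
  ⌈Tr⌉₀ x f = ⌈Trˢ⌉ x f ~-refl

  Trˢ-cong : ∀ x {m n} {f g : Csp′ (x + m) (x + n)} → f ≈ᶜ g → Trˢ x f ≈ᶜ Trˢ x g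
  Trˢ-cong x {f = f} {g} p = via (Trˢ x f) (Trˢ x g) (⌈Tr⌉₀ x f) (Trᵖ-cong x (reify p)) (⌈Tr⌉₀ x g)

  Trˢ-tightening : ∀ x {m n m′ n′} (g : Csp′ m′ m) (f : Csp′ (x + m) (x + n)) (h : Csp′ n n′) →
                   Trˢ x ((idᶜ {n = x} ⊗ˢ g) ⨾ˢ f ⨾ˢ (idᶜ {n = x} ⊗ˢ h)) ≈ᶜ g ⨾ˢ Trˢ x f ⨾ˢ h
  Trˢ-tightening x g f h = via _ _
    (⌈Trˢ⌉ x _ (⌈⨾ˢ⌉ _ _ (⌈⨾ˢ⌉ _ f (⌈id⊗⌉ x g) ~-refl) (⌈id⊗⌉ x h)))
    (Trᵖ-tightening x ⌈ g ⌉ ⌈ f ⌉ ⌈ h ⌉)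
    (⌈⨾ˢ⌉ _ h (⌈⨾ˢ⌉ g _ ~-refl (⌈Tr⌉₀ x f)) ~-refl)

  Trˢ-sliding : ∀ x y {m n} (f : Csp′ (x + m) (y + n)) (g : Csp′ y x) →
                Trˢ x (f ⨾ˢ (g ⊗ˢ idᶜ {n = n})) ≈ᶜ Trˢ y ((g ⊗ˢ idᶜ {n = m}) ⨾ˢ f)
  Trˢ-sliding x y {m} {n} f g = via _ _ (⌈Trˢ⌉ x _ (⌈⨾ˢ⌉ f _ ~-refl (⌈⊗id⌉ n g)))
    (Trᵖ-sliding x y ⌈ f ⌉ ⌈ g ⌉) (⌈Trˢ⌉ y _ (⌈⨾ˢ⌉ _ f (⌈⊗id⌉ m g) ~-refl))

  Trˢ-vanishing₀ : ∀ {m n} (f : Csp′ m n) → Trˢ 0 f ≈ᶜ f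
  Trˢ-vanishing₀ f = via (Trˢ 0 f) f (⌈Tr⌉₀ 0 f) (Trᵖ-vanishing₀ ⌈ f ⌉) ~-refl

  Trˢ-vanishing₊ : ∀ x y {m n} (f : Csp′ ((x + y) + m) ((x + y) + n)) →
                   Trˢ (x + y) f ≈ᶜ Trˢ y (Trˢ x (subst₂ (Cospan S) (+-assoc x y m) (+-assoc x y n) f))
  Trˢ-vanishing₊ x y {m} {n} f = via _ _ (⌈Tr⌉₀ (x + y) f) (Trᵖ-vanishing₊ x y ⌈ f ⌉)
    (⌈Trˢ⌉ y _ (⌈Trˢ⌉ x _ (⌈cast⌉ (+-assoc x y m) (+-assoc x y n) f)))

  Trˢ-superposing : ∀ x {m n p q} (f : Csp′ (x + m) (x + n)) (g : Csp′ p q) →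
                    Trˢ x (subst₂ (Cospan S) (+-assoc x m p) (+-assoc x n q) (f ⊗ˢ g)) ≈ᶜ Trˢ x f ⊗ˢ g
  Trˢ-superposing x {m} {n} {p} {q} f g = via _ _
    (⌈Trˢ⌉ x _ (~-trans (⌈cast⌉ (+-assoc x m p) (+-assoc x n q) (f ⊗ˢ g))
      (castᵖ-cong (+-assoc x m p) (+-assoc x n q) (⌈⊗ˢ⌉ f g ~-refl ~-refl))))
    (Trᵖ-superposing x ⌈ f ⌉ ⌈ g ⌉) (⌈⊗ˢ⌉ _ g (⌈Tr⌉₀ x f) ~-refl)

  Trˢ-yanking : ∀ x → Trˢ x (σᶜ x x) ≈ᶜ idᶜ
  Trˢ-yanking x = via _ _ (⌈Trˢ⌉ x (σᶜ x x) (⌈wire⌉ (swapFin x x))) (Trᵖ-yanking x) (⌈wire⌉ (λ i → i))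

  -- One wire at a time, by vanishing: tracing several at once could identify vertices along chains,
  -- since a traced output may itself be another traced input.
  Trˢ-PLM : ∀ x {m n} (f : Csp′ (x + m) (x + n)) → PLM f → PLM (Trˢ x f)
  Trˢ-PLM zero    f plm = PLM-resp {f = f} {Trˢ 0 f} (≈ᶜ-sym (Trˢ-vanishing₀ f)) plm
  Trˢ-PLM (suc x) f plm = PLM-resp {f = Trˢ x (Trˢ 1 f)} {Trˢ (suc x) f} (≈ᶜ-sym (Trˢ-vanishing₊ 1 x f))
    (Trˢ-PLM x (Trˢ 1 f) (Trˢ₁-PLM f plm))

  forkᶠ : Fin 2 → Fin 1
  forkᶠ _ = zero

  noneᶠ : Fin 0 → Fin 1
  noneᶠ ()

  Tm′ : ℕ → ℕ → Set c
  Tm′ = Term (S ⊎ₛ comonoidSignature)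

  ⟦_⟧ : ∀ {m n} → Tm′ m n → Csp′ m n
  ⟦ gen (inj₁ g) ⟧      = genᶜ g
  ⟦ gen (inj₂ comul) ⟧  = wire forkᶠ
  ⟦ gen (inj₂ counit) ⟧ = wire noneᶠ
  ⟦ id ⟧                = idᶜ
  ⟦ t ⨾ u ⟧             = ⟦ t ⟧ ⨾ˢ ⟦ u ⟧
  ⟦ t ⊗ u ⟧             = ⟦ t ⟧ ⊗ˢ ⟦ u ⟧
  ⟦ σ m n ⟧             = σᶜ m n
  ⟦ Tr x t ⟧            = Trˢ x ⟦ t ⟧

  ⟦⟧-PLM : ∀ {m n} (t : Tm′ m n) → PLM ⟦ t ⟧
  ⟦⟧-PLM (gen (inj₁ g))      = gen-PLM g
  ⟦⟧-PLM (gen (inj₂ comul))  = wire-PLM forkᶠ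
  ⟦⟧-PLM (gen (inj₂ counit)) = wire-PLM noneᶠ
  ⟦⟧-PLM id                  = wire-PLM (λ i → i)
  ⟦⟧-PLM (t ⨾ u)             = ⨾ˢ-PLM {f = ⟦ t ⟧} {⟦ u ⟧} (⟦⟧-PLM t) (⟦⟧-PLM u)
  ⟦⟧-PLM (t ⊗ u)             = ⊗ˢ-PLM {f = ⟦ t ⟧} {⟦ u ⟧} (⟦⟧-PLM t) (⟦⟧-PLM u)
  ⟦⟧-PLM (σ m n)             = wire-PLM (swapFin n m)
  ⟦⟧-PLM (Tr x t)            = Trˢ-PLM x ⟦ t ⟧ (⟦⟧-PLM t)

  ⟦subst⟧ : ∀ {m m′ n n′} (p : m ≡ m′) (q : n ≡ n′) (t : Tm′ m n) →
            ⟦ subst₂ Tm′ p q t ⟧ ≡ subst₂ (Cospan S) p q ⟦ t ⟧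
  ⟦subst⟧ refl refl t = refl

  ≡⇒≈ᶜ : ∀ {m n} {f g : Csp′ m n} → f ≡ g → f ≈ᶜ g
  ≡⇒≈ᶜ refl = ≈ᶜ-refl

  -- All functions into `Fin 1` agree, and both sides of every comonoid equation denote wirings with
  -- a single input.
  fork-⨾ˢ : ∀ {n} {f : Csp′ 2 n} {ρ : Fin n → Fin 2} {θ : Fin n → Fin 1} → f ≈ᶜ wire ρ → (∀ i → θ i ≡ zero) →
            wire forkᶠ ⨾ˢ f ≈ᶜ wire θ
  fork-⨾ˢ {f = f} {ρ} p h = ≈ᶜ-trans (⨾ˢ-cong {f = wire forkᶠ} {wire forkᶠ} {f} {wire ρ} ≈ᶜ-refl p)
    (≈ᶜ-trans (wire-⨾ˢ forkᶠ ρ) (wire-cong (λ i → sym (h i))))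

  zero! : (i : Fin 1) → i ≡ zero
  zero! zero = refl

  comonoid-sound : ∀ {m n} {t u : Tm′ m n} → ComonoidEquation S t u → ⟦ t ⟧ ≈ᶜ ⟦ u ⟧
  comonoid-sound counitˡ = fork-⨾ˢ (wire-⊗ˢ noneᶠ (λ i → i)) zero!
  comonoid-sound counitʳ = fork-⨾ˢ (wire-⊗ˢ (λ i → i) noneᶠ) zero!
  comonoid-sound coassoc = ≈ᶜ-trans
    (fork-⨾ˢ {θ = λ _ → zero} (wire-⊗ˢ forkᶠ (λ i → i)) (λ _ → refl))
    (≈ᶜ-sym (fork-⨾ˢ {θ = λ _ → zero} (wire-⊗ˢ (λ i → i) forkᶠ) (λ _ → refl)))
  comonoid-sound cocomm = fork-⨾ˢ {f = σᶜ 1 1} {θ = forkᶠ} ≈ᶜ-refl (λ _ → refl)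

  sound : ∀ {m n} {t u : Tm′ m n} → t ≈ u → ⟦ t ⟧ ≈ᶜ ⟦ u ⟧
  sound (equation r)   = comonoid-sound r
  sound ≈-refl         = ≈ᶜ-refl
  sound (≈-sym p)      = ≈ᶜ-sym (sound p)
  sound (≈-trans p q)  = ≈ᶜ-trans (sound p) (sound q)
  sound (⨾-cong p q) = ⨾ˢ-cong (sound p) (sound q)
  sound (⨾-assoc f g h) = ⨾ˢ-assoc ⟦ f ⟧ ⟦ g ⟧ ⟦ h ⟧
  sound (⨾-identityˡ f) = ⨾ˢ-identityˡ ⟦ f ⟧
  sound (⨾-identityʳ f) = ⨾ˢ-identityʳ ⟦ f ⟧
  sound (⊗-cong p q) = ⊗ˢ-cong (sound p) (sound q)
  sound ⊗-id           = ⊗ˢ-id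
  sound (⊗-⨾ f g f′ g′) = ⊗ˢ-⨾ ⟦ f ⟧ ⟦ g ⟧ ⟦ f′ ⟧ ⟦ g′ ⟧
  sound (⊗-identityˡ f) = ⊗ˢ-identityˡ ⟦ f ⟧
  sound (⊗-identityʳ {m} {n} f) = ≈ᶜ-trans (≡⇒≈ᶜ (⟦subst⟧ (+-identityʳ m) (+-identityʳ n) (f ⊗ id))) (⊗ˢ-identityʳ ⟦ f ⟧)
  sound (⊗-assoc {m} {n} {p} {m′} {n′} {p′} f g h) =
    ≈ᶜ-trans (≡⇒≈ᶜ (⟦subst⟧ (+-assoc m n p) (+-assoc m′ n′ p′) ((f ⊗ g) ⊗ h))) (⊗ˢ-assoc ⟦ f ⟧ ⟦ g ⟧ ⟦ h ⟧)
  sound (σ-natural f g) = σˢ-natural ⟦ f ⟧ ⟦ g ⟧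
  sound (σ-involutive m n) = σˢ-involutive m n
  sound (σ-hexagon m n p) = ≈ᶜ-trans (σˢ-hexagon m n p) (⨾ˢ-cong
    (≡⇒≈ᶜ (sym (⟦subst⟧ (+-assoc m n p) (+-assoc n m p) (σ m n ⊗ id {n = p}))))
    (≡⇒≈ᶜ (sym (⟦subst⟧ refl (sym (+-assoc n p m)) (id {n = n} ⊗ σ m p)))))
  sound (Tr-cong x p) = Trˢ-cong x (sound p)
  sound (tightening x g f h) = Trˢ-tightening x ⟦ g ⟧ ⟦ f ⟧ ⟦ h ⟧
  sound (sliding x y f g) = Trˢ-sliding x y ⟦ f ⟧ ⟦ g ⟧
  sound (vanishing₀ f) = Trˢ-vanishing₀ ⟦ f ⟧
  sound (vanishing₊ x y {m} {n} f) = ≈ᶜ-trans (Trˢ-vanishing₊ x y ⟦ f ⟧)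
    (≡⇒≈ᶜ (cong (λ k → Trˢ y (Trˢ x k)) (sym (⟦subst⟧ (+-assoc x y m) (+-assoc x y n) f))))
  sound (superposing x {m} {n} {p} {q} f g) = ≈ᶜ-trans
    (≡⇒≈ᶜ (cong (Trˢ x) (⟦subst⟧ (+-assoc x m p) (+-assoc x n q) (f ⊗ g))))
    (Trˢ-superposing x ⟦ f ⟧ ⟦ g ⟧)
  sound (yanking x) = Trˢ-yanking x

-- The graph of a normal form

module Graphs {c} (S : Signature c) where

  open Coded S
  open Wiring S
  open Closure S
  open Normalise S
  open Reordering S
  open Precospans S
  open Semantics S
  open Signature S
  private
    module P = Precospan
    module H = LabelledHypergraph
    module C = Cospan

  ⟦wireᵗ⟧ : ∀ {p q} (φ : Fin q → Fin p) → ⟦ Free-Term.wireᵗ S φ ⟧ ≈ᶜ wire φ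
  ⟦wireᵗ⟧ {p} {zero} φ = discard p φ
    where
    discard : ∀ p (φ : Fin 0 → Fin p) → ⟦ Free-Term.discard S p ⟧ ≈ᶜ wire φ
    discard zero    φ = wire-cong (λ ())
    discard (suc p) φ = ≈ᶜ-trans (⨾ˢ-cong {f = ⟦ e ⟧} {wire suc} {⟦ Free-Term.discard S p ⟧} {wire φ′}
        (≈ᶜ-trans (wire-⊗ˢ noneᶠ (λ (i : Fin p) → i)) (wire-cong (λ _ → refl))) (discard p φ′))
      (≈ᶜ-trans (wire-⨾ˢ suc φ′) (wire-cong (λ ())))
      where
      e = Free-Term.eᵗ S {p}
      φ′ : Fin 0 → Fin p
      φ′ ()
  ⟦wireᵗ⟧ {p} {suc q} φ = ≈ᶜ-trans (⨾ˢ-cong {f = ⟦ Free-Term.copy S (φ zero) ⟧} {wire (copyᶠ (φ zero))}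
      {⟦ Free-Term.L_ S (Free-Term.wireᵗ S (φ ∘ suc)) ⟧} {wire (lift 1 (φ ∘ suc))}
      (copy (φ zero)) (L {t = Free-Term.wireᵗ S (φ ∘ suc)} (φ ∘ suc) (⟦wireᵗ⟧ (φ ∘ suc))))
    (≈ᶜ-trans (wire-⨾ˢ (copyᶠ (φ zero)) (lift 1 (φ ∘ suc))) (wire-cong (λ { zero → refl ; (suc i) → refl })))
    where
    copyᶠ : ∀ {p} → Fin p → Fin (suc p) → Fin p
    copyᶠ a zero    = a
    copyᶠ a (suc i) = i
    L : ∀ {p q} {t : Term (S ⊎ₛ comonoidSignature) p q} (φ : Fin q → Fin p) → ⟦ t ⟧ ≈ᶜ wire φ →
        ⟦ Free-Term.L_ S t ⟧ ≈ᶜ wire (lift 1 φ)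
    L {t = t} φ h = ≈ᶜ-trans (⊗ˢ-cong {f = idᶜ {n = 1}} {idᶜ} {⟦ t ⟧} {wire φ} ≈ᶜ-refl h)
      (≈ᶜ-trans (wire-⊗ˢ (λ (i : Fin 1) → i) φ) (wire-cong (λ { zero → refl ; (suc i) → refl })))
    copy : ∀ {p} (a : Fin p) → ⟦ Free-Term.copy S a ⟧ ≈ᶜ wire (copyᶠ a)
    copy {suc p} zero = ≈ᶜ-trans (wire-⊗ˢ forkᶠ (λ (i : Fin p) → i)) (wire-cong (λ { zero → refl ; (suc zero) → refl ; (suc (suc i)) → refl }))
    copy {suc p} (suc a) = ≈ᶜ-trans (⨾ˢ-cong {f = ⟦ Free-Term.L_ S (Free-Term.copy S a) ⟧} {wire (lift 1 (copyᶠ a))}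
        {⟦ Free-Term.sᵗ S ⟧} {wire s} (L {t = Free-Term.copy S a} (copyᶠ a) (copy a))
        (≈ᶜ-trans (wire-⊗ˢ (swapFin 1 1) (λ (i : Fin p) → i)) (wire-cong (λ { zero → refl ; (suc zero) → refl ; (suc (suc i)) → refl }))))
      (≈ᶜ-trans (wire-⨾ˢ (lift 1 (copyᶠ a)) s) (wire-cong (λ { zero → refl ; (suc zero) → refl ; (suc (suc i)) → refl })))
      where
      s : Fin (2 + p) → Fin (2 + p)
      s zero          = suc zero
      s (suc zero)    = zero
      s (suc (suc i)) = suc (suc i)

  -- Hypergraphs sort their hyperedges by arity; the proofs place each index at the arity of its
  -- label and nowhere else.
  record Link {k} (es : Fin k → Gen) (a b : ℕ) : Set where
    constructor link
    field
      index  : Fin k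
      dom-eq : dom (es index) ≡ a
      cod-eq : cod (es index) ≡ b

  boxᵖ : ∀ k (es : Fin k → Gen) → Pre (size (⨁ k (dom ∘ es))) (size (⨁ k (cod ∘ es)))
  boxᵖ k es = record
    { V = El D ⊎ El C ; E = Link es
    ; src = λ (link i p q) x → inj₁ (pos (dom ∘ es) i (cast (sym p) x))
    ; tgt = λ (link i p q) x → inj₂ (pos (cod ∘ es) i (cast (sym q) x))
    ; label = λ (link i _ _) → es i
    ; R = λ _ _ → ⊥
    ; left = inj₁ ∘ dec D ; right = inj₂ ∘ dec C }
    where
    D = ⨁ k (dom ∘ es)
    C = ⨁ k (cod ∘ es)

  graphᵖ : ∀ {m n} → Shape m n → Pre m n
  graphᵖ {m} {n} (shape k es U φ _) = record
    { V = El ((⨁ k (cod ∘ es) ✚ U) ✚ fin m) ; E = Link es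
    ; src = λ (link i p q) x → φ (inj₁ (inj₁ (pos (dom ∘ es) i (cast (sym p) x))))
    ; tgt = λ (link i p q) x → inj₁ (inj₁ (pos (cod ∘ es) i (cast (sym q) x)))
    ; label = λ (link i _ _) → es i
    ; R = λ _ _ → ⊥
    ; left = inj₂ ; right = φ ∘ inj₂ }

  -- The cospan of a shape: the vertices are the targets of the hyperedges, the
  -- closed wires U (which have no source), and the inputs.
  graph : ∀ {m n} → Shape m n → Cospan S m n
  graph {m} {n} s@(shape k es U φ _) = record
    { apex = record
      { hypergraph = record
        { V = P.V G ; E = P.E G
        ; src = λ e → tabulate (P.src G e) ; tgt = λ e → tabulate (P.tgt G e) }
      ; V-finite = size B , mk↔ₛ′ (enc B) (dec B) (enc-dec B) (dec-enc B)
      ; Edge-finite = k , mk↔ₛ′ (λ (_ , _ , link i _ _) → i) (λ i → _ , _ , link i refl refl) (λ _ → refl)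
          (λ { (_ , _ , link i refl refl) → refl })
      ; label = P.label G ; label-dom = Link.dom-eq ; label-cod = Link.cod-eq }
    ; left = fromDiscrete (P.left G) ; right = fromDiscrete (P.right G) }
    where
    G = graphᵖ s
    B = (⨁ k (cod ∘ es) ✚ U) ✚ fin m

  ⌈graph⌉ : ∀ {m n} (s : Shape m n) → ⌈ graph s ⌉ ~ graphᵖ s
  ⌈graph⌉ s = same-graph (λ _ _ ()) (λ _ _ ()) (λ e → lookup∘tabulate (P.src (graphᵖ s) e))
    (λ e → lookup∘tabulate (P.tgt (graphᵖ s) e)) (λ _ → refl) (λ _ → refl)

  ⌈gen⌉ : ∀ g → ⌈ genᶜ g ⌉ ~ record
    { V = Fin (dom g) ⊎ Fin (cod g) ; E = λ k l → dom g ≡ k × cod g ≡ l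
    ; src = λ (p , _) x → inj₁ (cast (sym p) x) ; tgt = λ (_ , q) x → inj₂ (cast (sym q) x)
    ; label = λ _ → g ; R = λ _ _ → ⊥ ; left = inj₁ ; right = inj₂ }
  ⌈gen⌉ g = same-graph (λ _ _ ()) (λ _ _ ()) (λ (p , _) → lookup∘tabulate (inj₁ ∘ cast (sym p)))
    (λ (_ , q) → lookup∘tabulate (inj₂ ∘ cast (sym q))) (λ _ → refl) (λ _ → refl)

  ⌈id⌉ : ∀ {n} → ⌈ idᶜ {n = n} ⌉ ~ idᵖ
  ⌈id⌉ = ⌈wire⌉ (λ i → i)

  ⌈term-1⌉ : ∀ {A} → ⌈ ⟦ term (1ₕ {A}) ⟧ ⌉ ~ idᵖ
  ⌈term-1⌉ {A} = subst (λ t → ⌈ ⟦ t ⟧ ⌉ ~ idᵖ) (sym (term-1 {A})) ⌈id⌉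

  ⌈term-∙⌉ : ∀ {A B C} {f : A ⇒ B} {g : B ⇒ C} {P Q} → ⌈ ⟦ term f ⟧ ⌉ ~ P → ⌈ ⟦ term g ⟧ ⌉ ~ Q →
             ⌈ ⟦ term (f ∙ g) ⟧ ⌉ ~ P ⨾ᵖ Q
  ⌈term-∙⌉ {f = f} {g} {P} {Q} p q = subst (λ t → ⌈ ⟦ t ⟧ ⌉ ~ P ⨾ᵖ Q) (sym (term-∙ f g)) (⌈⨾ˢ⌉ ⟦ term f ⟧ ⟦ term g ⟧ p q)

  ⌈term-⊛⌉ : ∀ {A B C D} {f : A ⇒ B} {g : C ⇒ D} {P Q} → ⌈ ⟦ term f ⟧ ⌉ ~ P → ⌈ ⟦ term g ⟧ ⌉ ~ Q →
             ⌈ ⟦ term (f ⊛ g) ⟧ ⌉ ~ P ⊗ᵖ Q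
  ⌈term-⊛⌉ {f = f} {g} {P} {Q} p q = subst (λ t → ⌈ ⟦ t ⟧ ⌉ ~ P ⊗ᵖ Q) (sym (term-⊛ f g)) (⌈⊗ˢ⌉ ⟦ term f ⟧ ⟦ term g ⟧ p q)

  ⌈term-TR⌉ : ∀ X {A B} {f : X ✚ A ⇒ X ✚ B} {P} → ⌈ ⟦ term f ⟧ ⌉ ~ P → ⌈ ⟦ term (TR X f) ⟧ ⌉ ~ Trᵖ (size X) P
  ⌈term-TR⌉ X {f = f} {P} p = subst (λ t → ⌈ ⟦ t ⟧ ⌉ ~ Trᵖ (size X) P) (sym (term-TR X f)) (⌈Trˢ⌉ (size X) ⟦ term f ⟧ p)

  ⌈term-⟪⟫⌉ : ∀ {A B} (φ : El B → El A) → ⌈ ⟦ term (⟪_⟫ {A} {B} φ) ⟧ ⌉ ~ wireᵖ (enc A ∘ φ ∘ dec B)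
  ⌈term-⟪⟫⌉ {A} {B} φ = subst (λ t → ⌈ ⟦ t ⟧ ⌉ ~ wireᵖ (enc A ∘ φ ∘ dec B)) (sym (term-⟪⟫ φ))
    (~-trans (reify (⟦wireᵗ⟧ (enc A ∘ φ ∘ dec B))) (⌈wire⌉ (enc A ∘ φ ∘ dec B)))

  ⌈box⌉ : ∀ k (es : Fin k → Gen) → ⌈ ⟦ term (box k es) ⟧ ⌉ ~ boxᵖ k es
  ⌈box⌉ zero es = ~-trans ⌈term-1⌉ (mk~
    (record { to = λ () ; to-R = λ () ; toE = λ () ; to-src = λ () ; to-tgt = λ () ; to-label = λ () ; to-left = λ () ; to-right = λ () })
    (λ { (inj₁ ()) ; (inj₂ ()) }) (λ _ _ ()) (λ ()) (λ { (inj₁ ()) ; (inj₂ ()) }) (λ { (link () _ _) }) (λ ()) (λ { (link () _ _) }))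
  ⌈box⌉ (suc k) es = ~-trans (⌈term-⊛⌉ (⌈gen⌉ (es zero)) (⌈box⌉ k (es ∘ suc))) (mk~
    (record
      { to = mid₄ ; to-R = λ { _ _ (inl ()) ; _ _ (inr ()) }
      ; toE = λ { (inj₁ (p , q)) → link zero p q ; (inj₂ (link i p q)) → link (suc i) p q }
      ; to-src = λ { (inj₁ _) _ → Eq-refl ; (inj₂ _) _ → Eq-refl }
      ; to-tgt = λ { (inj₁ _) _ → Eq-refl ; (inj₂ _) _ → Eq-refl }
      ; to-label = λ { (inj₁ _) → refl ; (inj₂ _) → refl }
      ; to-left = λ x → ≡⇒Eq (leg₁ (splitAt (dom (es zero)) x)) ; to-right = λ x → ≡⇒Eq (leg₂ (splitAt (cod (es zero)) x)) })
    mid₄ (λ _ _ ()) (λ v → ≡⇒Eq (mid₄-mid₄ v)) (λ v → ≡⇒Eq (mid₄-mid₄ v))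
    (λ { (link zero p q) → inj₁ (p , q) ; (link (suc i) p q) → inj₂ (link i p q) })
    (λ { (inj₁ _) → refl ; (inj₂ _) → refl }) (λ { (link zero _ _) → refl ; (link (suc _) _ _) → refl }))
    where
    leg₁ : ∀ {A B C D E : Set} {f : B → C} (s : A ⊎ B) →
           mid₄ {B = D} {D = E} ([ inj₁ ∘ inj₁ , inj₂ ∘ (inj₁ ∘ f) ]′ s) ≡ inj₁ (map₂ f s)
    leg₁ (inj₁ _) = refl
    leg₁ (inj₂ _) = refl
    leg₂ : ∀ {A B C D E : Set} {f : B → C} (s : A ⊎ B) →
           mid₄ {A = D} {C = E} ([ inj₁ ∘ inj₂ , inj₂ ∘ (inj₂ ∘ f) ]′ s) ≡ inj₂ (map₂ f s)
    leg₂ (inj₁ _) = refl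
    leg₂ (inj₂ _) = refl

  -- Every input port of a box is glued to its source in the wiring and every output port is looped
  -- to an input of the wiring. The inputs of the wiring thus represent all classes, and `t`
  -- computes the representative.
  normal-graph : ∀ {m n} (s : Shape m n) → ⟦ term (normal s) ⟧ ≈ᶜ graph s
  normal-graph {m} {n} s@(shape k es U φ fixed) = reflect (~-trans
    (⌈term-TR⌉ (C ✚ U) (⌈term-∙⌉ (⌈term-⟪⟫⌉ φ) (⌈term-⊛⌉ (⌈term-⊛⌉ (⌈box⌉ k es) ⌈term-1⌉) ⌈term-1⌉)))
    (~-trans (mk~
      (record
        { to = t ; to-R = t-R
        ; toE = λ { (inj₂ (inj₁ (inj₁ e))) → e }
        ; to-src = λ { (inj₂ (inj₁ (inj₁ e))) _ → Eq-refl }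
        ; to-tgt = λ { (inj₂ (inj₁ (inj₁ e))) _ → Eq-refl }
        ; to-label = λ { (inj₂ (inj₁ (inj₁ e))) → refl }
        ; to-left = λ i → ≡⇒Eq (cong (map⊎ (dec (C ✚ U)) (λ x → x)) (splitAt-↑ʳ (size (C ✚ U)) m i))
        ; to-right = λ j → ≡⇒Eq (cong (t ∘ inj₂) (⊞-ʳ R₀ idᶠ j)) })
      (inj₁ ∘ enc B) (λ _ _ ()) i₁ (λ v → ≡⇒Eq (dec-enc B v))
      (λ e → inj₂ (inj₁ (inj₁ e))) (λ { (inj₂ (inj₁ (inj₁ e))) → refl }) (λ _ → refl))
    (~-sym (⌈graph⌉ s))))
    where
    D = ⨁ k (dom ∘ es)
    C = ⨁ k (cod ∘ es)
    B = (C ✚ U) ✚ fin m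
    idᶠ : ∀ {k} → Fin k → Fin k
    idᶠ i = i
    Boxes = (boxᵖ k es ⊗ᵖ idᵖ {size U}) ⊗ᵖ idᵖ {n}
    Wires = wireᵖ (enc B ∘ φ ∘ dec ((D ✚ U) ✚ fin n))
    Q = Wires ⨾ᵖ Boxes
    L₀ : Fin (size D + size U) → _
    L₀ = P.left (boxᵖ k es) ⊞ idᶠ
    R₀ : Fin (size C + size U) → _
    R₀ = P.right (boxᵖ k es) ⊞ idᶠ
    t : P.V Q → El B
    t (inj₁ w)                      = dec B w
    t (inj₂ (inj₁ (inj₁ (inj₁ d)))) = φ (inj₁ (inj₁ d))
    t (inj₂ (inj₁ (inj₁ (inj₂ c)))) = inj₁ (inj₁ c)
    t (inj₂ (inj₁ (inj₂ u)))        = inj₁ (inj₂ (dec U u))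
    t (inj₂ (inj₂ j))               = φ (inj₂ j)
    t-glue : ∀ j → φ (dec ((D ✚ U) ✚ fin n) j) ≡ t (inj₂ (P.left Boxes j))
    t-glue j with splitAt (size D + size U) j
    ... | inj₂ _ = refl
    ... | inj₁ y with splitAt (size D) y
    ...   | inj₁ _ = refl
    -- A wire of `U` is glued to its source and looped to itself. Sending it to itself respects the
    -- gluing because it is closed.
    ...   | inj₂ u = fixed (dec U u)
    t-loop : ∀ i → inj₁ (dec (C ✚ U) i) ≡ t (inj₂ (inj₁ (R₀ i)))
    t-loop i with splitAt (size C) i
    ... | inj₁ _ = refl
    ... | inj₂ _ = refl
    t-R : ∀ a b → RTr (size (C ✚ U)) Q a b → Eq (graphᵖ s) (t a) (t b)
    t-R _ _ (base (par (inr (inl (inl ())))))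
    t-R _ _ (base (glued j)) = ≡⇒Eq (trans (dec-enc B _) (t-glue j))
    t-R _ _ (loop i) = ≡⇒Eq (trans (cong (map⊎ (dec (C ✚ U)) (λ x → x)) (splitAt-↑ˡ (size (C ✚ U)) i m))
      (trans (t-loop i) (cong (t ∘ inj₂) (sym (⊞-ˡ R₀ idᶠ i)))))
    T = Trᵖ (size (C ✚ U)) Q
    glueAt : ∀ y {v} → P.left Boxes (enc ((D ✚ U) ✚ fin n) y) ≡ v → Eq T (inj₁ (enc B (φ y))) (inj₂ v)
    glueAt y h = Tr-base (⨾-glue (enc ((D ✚ U) ✚ fin n) y) (cong (enc B ∘ φ) (dec-enc ((D ✚ U) ✚ fin n) y)) h)
    i₁ : ∀ v → Eq T (inj₁ (enc B (t v))) v
    i₁ (inj₁ w) = ≡⇒Eq (cong inj₁ (enc-dec B w))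
    i₁ (inj₂ (inj₁ (inj₁ (inj₁ d)))) = glueAt (inj₁ (inj₁ d)) (trans (⊞-ˡ L₀ idᶠ (enc D d ↑ˡ size U))
      (cong inj₁ (trans (⊞-ˡ (P.left (boxᵖ k es)) idᶠ (enc D d)) (cong (inj₁ ∘ inj₁) (dec-enc D d)))))
    i₁ (inj₂ (inj₁ (inj₁ (inj₂ c)))) = Tr-loop (enc C c ↑ˡ size U) refl (cong inj₂ (trans (⊞-ˡ R₀ idᶠ (enc C c ↑ˡ size U))
      (cong inj₁ (trans (⊞-ˡ (P.right (boxᵖ k es)) idᶠ (enc C c)) (cong (inj₁ ∘ inj₂) (dec-enc C c))))))
    i₁ (inj₂ (inj₁ (inj₂ u))) = Tr-loop (size C ↑ʳ u) (cong (λ u → inj₁ ((size C ↑ʳ u) ↑ˡ m)) (sym (enc-dec U u)))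
      (cong inj₂ (trans (⊞-ˡ R₀ idᶠ (size C ↑ʳ u)) (cong inj₁ (⊞-ʳ (P.right (boxᵖ k es)) idᶠ u))))
    i₁ (inj₂ (inj₂ j)) = glueAt (inj₂ j) (⊞-ʳ L₀ idᶠ j)

-- Cospans as normal forms

module BoolUIP = Decidable⇒UIP Bool._≟_

module Completeness {c} (S : Signature c) where

  open Coded S
  open Normalise S
  open Reordering S
  open Precospans S
  open Semantics S
  open Graphs S
  open Signature S
  private
    module P = Precospan
    module H = LabelledHypergraph
    module C = Cospan

  module GraphMap {m n} (s s′ : Shape m n) (p : graph s ≈ᶜ graph s′) where

    open Shape s
    open Shape s′ renaming (edges to edges′; label to label′; U to U′; φ to φ′; fixed to fixed′)

    T = _≈ᶜ_.to p

    v : P.V (graphᵖ s) → P.V (graphᵖ s′)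
    v = HypHom.vmap T

    v-injective : ∀ {x y} → v x ≡ v y → x ≡ y
    v-injective {x} {y} e = trans (sym (_≐_.V≐ (_≈ᶜ_.from-to p) x))
      (trans (cong (HypHom.vmap (_≈ᶜ_.from p)) e) (_≐_.V≐ (_≈ᶜ_.from-to p) y))

    -- Evaluating at `link i refl refl` gives the image the arity of the label of `i`; other arity
    -- proofs reduce to this case by `index-irrelevant`.
    edge : ∀ i → Link label′ (dom (label i)) (cod (label i))
    edge i = HypHom.emap T (link i refl refl)

    β : Fin edges → Fin edges′
    β i = Link.index (edge i)

    label-β : ∀ i → label i ≡ label′ (β i)
    label-β i = sym (HypHom.label-pres T (link i refl refl))

    v-left : ∀ x → v (inj₂ x) ≡ inj₂ x
    v-left x = _≐_.V≐ (_≈ᶜ_.left-comm p) x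

    v-right : ∀ x → v (φ (inj₂ x)) ≡ φ′ (inj₂ x)
    v-right x = _≐_.V≐ (_≈ᶜ_.right-comm p) x

    v-tgt : ∀ i x → v (inj₁ (inj₁ (pos (cod ∘ label) i x)))
                    ≡ inj₁ (inj₁ (pos (cod ∘ label′) (β i) (cast (cong cod (label-β i)) x)))
    v-tgt i x = trans (cong (λ y → v (inj₁ (inj₁ (pos (cod ∘ label) i y)))) (sym (cast-id refl x)))
      (trans (cong v (sym (lookup∘tabulate (P.tgt (graphᵖ s) (link i refl refl)) x)))
      (trans (sym (lookup-map x v (tabulate (P.tgt (graphᵖ s) (link i refl refl)))))
      (trans (cong (λ xs → lookup xs x) (HypHom.tgt-pres T (link i refl refl)))
        (lookup∘tabulate (P.tgt (graphᵖ s′) (edge i)) x))))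

    v-src : ∀ i x → v (φ (inj₁ (inj₁ (pos (dom ∘ label) i x))))
                    ≡ φ′ (inj₁ (inj₁ (pos (dom ∘ label′) (β i) (cast (cong dom (label-β i)) x))))
    v-src i x = trans (cong (λ y → v (φ (inj₁ (inj₁ (pos (dom ∘ label) i y))))) (sym (cast-id refl x)))
      (trans (cong v (sym (lookup∘tabulate (P.src (graphᵖ s) (link i refl refl)) x)))
      (trans (sym (lookup-map x v (tabulate (P.src (graphᵖ s) (link i refl refl)))))
      (trans (cong (λ xs → lookup xs x) (HypHom.src-pres T (link i refl refl)))
        (lookup∘tabulate (P.src (graphᵖ s′) (edge i)) x))))

    Q : El (⨁ edges (cod ∘ label)) → El (⨁ edges′ (cod ∘ label′))
    Q = permute (cod ∘ label) (cod ∘ label′) β (λ i → cong cod (label-β i))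

    v-Q : ∀ x → v (inj₁ (inj₁ x)) ≡ inj₁ (inj₁ (Q x))
    v-Q = pos-ind (cod ∘ label) (λ x → v (inj₁ (inj₁ x)) ≡ inj₁ (inj₁ (Q x)))
      (λ i x → trans (v-tgt i x) (cong (inj₁ ∘ inj₁)
        (sym (permute-pos (cod ∘ label) (cod ∘ label′) β (λ i → cong cod (label-β i)) i x))))

    index-irrelevant : ∀ {k l} j (a : dom (label j) ≡ k) (b : cod (label j) ≡ l) →
                       Link.index (HypHom.emap T (link j a b)) ≡ β j
    index-irrelevant j refl refl = refl

  module _ {m n} (s s′ : Shape m n) (p : graph s ≈ᶜ graph s′) where

    private
      module A = GraphMap s s′ p
      module B = GraphMap s′ s (≈ᶜ-sym p)
    open Shape s
    open Shape s′ renaming (edges to edges′; label to label′; U to U′; φ to φ′; fixed to fixed′)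

    β⁻β : ∀ i → B.β (A.β i) ≡ i
    β⁻β i = trans (sym (B.index-irrelevant (A.β i) (Link.dom-eq (A.edge i)) (Link.cod-eq (A.edge i))))
      (cong Link.index (_≐_.E≐ (_≈ᶜ_.from-to p) (link i refl refl)))

    QQ⁻ : ∀ x → B.Q (A.Q x) ≡ x
    QQ⁻ = permute-inv (cod ∘ label) (cod ∘ label′) A.β (λ i → cong cod (A.label-β i))
      B.β (λ i → cong cod (B.label-β i)) β⁻β

    v⁻v : ∀ x → B.v (A.v x) ≡ x
    v⁻v x = _≐_.V≐ (_≈ᶜ_.from-to p) x

  -- Vertices of U are neither inputs nor targets of hyperedges, so they correspond.
  loop-image : ∀ {m n} (s s′ : Shape m n) (p : graph s ≈ᶜ graph s′) (u : El (Shape.U s)) →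
               Σ[ u′ ∈ El (Shape.U s′) ] GraphMap.v s s′ p (inj₁ (inj₂ u)) ≡ inj₁ (inj₂ u′)
  loop-image s s′ p u = go (A.v (inj₁ (inj₂ u))) refl
    where
    module A = GraphMap s s′ p
    module B = GraphMap s′ s (≈ᶜ-sym p)
    go : ∀ z → A.v (inj₁ (inj₂ u)) ≡ z → Σ[ u′ ∈ El (Shape.U s′) ] A.v (inj₁ (inj₂ u)) ≡ inj₁ (inj₂ u′)
    go (inj₁ (inj₂ u′)) e = u′ , e
    go (inj₁ (inj₁ x)) e with A.v-injective (trans e (trans
      (cong (inj₁ ∘ inj₁) (sym (QQ⁻ s′ s (≈ᶜ-sym p) x))) (sym (A.v-Q (B.Q x)))))
    ... | ()
    go (inj₂ x) e with A.v-injective (trans e (sym (A.v-left x)))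
    ... | ()

  -- On vertices the isomorphism is `Q` on targets, `w` on closed wires and the identity on inputs.
  -- Preservation of sources and of the right leg is then the compatibility of the wirings that
  -- `normal-cong` requires.
  normal-injective : ∀ {m n} (s s′ : Shape m n) → graph s ≈ᶜ graph s′ → normal s ≋ normal s′
  normal-injective s s′ p = normal-cong s s′ π A.label-β w w⁻ w⁻w ww⁻ eq
    where
    open Shape s
    open Shape s′ renaming (edges to edges′; label to label′; U to U′; φ to φ′; fixed to fixed′)
    module A = GraphMap s s′ p
    module B = GraphMap s′ s (≈ᶜ-sym p)
    π : Permutation edges edges′
    π = mk↔ₛ′ A.β B.β (β⁻β s′ s (≈ᶜ-sym p)) (β⁻β s s′ p)
    w : El U → El U′
    w u = proj₁ (loop-image s s′ p u)
    w⁻ : El U′ → El U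
    w⁻ u = proj₁ (loop-image s′ s (≈ᶜ-sym p) u)
    A-w : ∀ u → A.v (inj₁ (inj₂ u)) ≡ inj₁ (inj₂ (w u))
    A-w u = proj₂ (loop-image s s′ p u)
    B-w : ∀ u → B.v (inj₁ (inj₂ u)) ≡ inj₁ (inj₂ (w⁻ u))
    B-w u = proj₂ (loop-image s′ s (≈ᶜ-sym p) u)
    strip : ∀ {A B C : Set} {x y : B} → _≡_ {A = (A ⊎ B) ⊎ C} (inj₁ (inj₂ x)) (inj₁ (inj₂ y)) → x ≡ y
    strip refl = refl
    w⁻w : ∀ u → w⁻ (w u) ≡ u
    w⁻w u = strip (trans (sym (B-w (w u))) (trans (cong B.v (sym (A-w u))) (v⁻v s s′ p _)))
    ww⁻ : ∀ u → w (w⁻ u) ≡ u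
    ww⁻ u = strip (trans (sym (A-w (w⁻ u))) (trans (cong A.v (sym (B-w u))) (v⁻v s′ s (≈ᶜ-sym p) _)))
    A-v : ∀ x → map₁ (map⊎ A.Q w) x ≡ A.v x
    A-v (inj₁ (inj₁ x)) = sym (A.v-Q x)
    A-v (inj₁ (inj₂ u)) = sym (A-w u)
    A-v (inj₂ x)        = sym (A.v-left x)
    P : El (⨁ edges (dom ∘ label)) → El (⨁ edges′ (dom ∘ label′))
    P = permute (dom ∘ label) (dom ∘ label′) A.β (λ i → cong dom (A.label-β i))
    eq-dom : ∀ x → φ′ (inj₁ (inj₁ (P x))) ≡ A.v (φ (inj₁ (inj₁ x)))
    eq-dom = pos-ind (dom ∘ label) (λ x → φ′ (inj₁ (inj₁ (P x))) ≡ A.v (φ (inj₁ (inj₁ x))))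
      (λ i x → trans (cong (φ′ ∘ inj₁ ∘ inj₁) (permute-pos (dom ∘ label) (dom ∘ label′) A.β (λ i → cong dom (A.label-β i)) i x))
        (sym (A.v-src i x)))
    eq : ∀ x → φ′ (map₁ (map⊎ P w) x) ≡ map₁ (map⊎ A.Q w) (φ x)
    eq (inj₁ (inj₁ x)) = trans (eq-dom x) (sym (A-v _))
    eq (inj₁ (inj₂ u)) = trans (fixed′ (w u)) (sym (cong (map₁ (map⊎ A.Q w)) (fixed u)))
    eq (inj₂ x)        = trans (sym (A.v-right x)) (sym (A-v _))

  module Decompose {m n} (f : Cospan S m n) (plm : PLM f) where

    open PLM plm
    F = C.apex f
    V = H.V F
    k = proj₁ (H.Edge-finite F)
    module η = Inverse (proj₂ (H.Edge-finite F))

    edge : Fin k → H.Edge F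
    edge = η.from

    edge-of : ∀ {a b} → H.E F a b → Fin k
    edge-of e = η.to (_ , _ , e)

    labelOf : H.Edge F → Gen
    labelOf (_ , _ , e) = H.label F e

    es : Fin k → Gen
    es i = labelOf (edge i)

    srcOf : (e : H.Edge F) → Fin (dom (labelOf e)) → V
    srcOf (_ , _ , e) x = lookup (H.src F e) (cast (H.label-dom F e) x)

    tgtOf : (e : H.Edge F) → Fin (cod (labelOf e)) → V
    tgtOf (_ , _ , e) x = lookup (H.tgt F e) (cast (H.label-cod F e) x)

    src-≡ : ∀ {a b} (e : H.E F a b) {e′} → e′ ≡ (a , b , e) → ∀ x (y : Fin (dom (labelOf e′))) → toℕ x ≡ toℕ y →
            srcOf e′ y ≡ lookup (H.src F e) x
    src-≡ e refl x y h = cong (lookup (H.src F e)) (toℕ-injective (trans (toℕ-cast _ y) (sym h)))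

    tgt-≡ : ∀ {a b} (e : H.E F a b) {e′} → e′ ≡ (a , b , e) → ∀ x (y : Fin (cod (labelOf e′))) → toℕ x ≡ toℕ y →
            tgtOf e′ y ≡ lookup (H.tgt F e) x
    tgt-≡ e refl x y h = cong (lookup (H.tgt F e)) (toℕ-injective (trans (toℕ-cast _ y) (sym h)))

    position : (e : H.Edge F) → Fin (cod (labelOf e)) → TargetPosition F
    position e x = e , cast (H.label-cod F (proj₂ (proj₂ e))) x

    l : Fin m → V
    l = HypHom.vmap (C.left f)

    target : El (⨁ k (cod ∘ es)) → V
    target z = tgtOf (edge (proj₁ (pos⁻ (cod ∘ es) z))) (proj₂ (pos⁻ (cod ∘ es) z))

    target-pos : ∀ i x → target (pos (cod ∘ es) i x) ≡ tgtOf (edge i) x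
    target-pos i x = cong (λ p → tgtOf (edge (proj₁ p)) (proj₂ p)) (pos⁻-pos (cod ∘ es) i x)

    position-injective : ∀ {e e′} (i : e ≡ e′) {x y} → _≡_ {A = TargetPosition F} (position e x) (position e′ y) → toℕ x ≡ toℕ y
    position-injective {e} refl {x} {y} h = trans (sym (toℕ-cast _ x)) (trans (lem h) (toℕ-cast _ y))
      where
      lem : ∀ {e : H.Edge F} {i j : Fin (proj₁ (proj₂ e))} → _≡_ {A = TargetPosition F} (e , i) (e , j) → toℕ i ≡ toℕ j
      lem refl = refl

    edge-injective : ∀ {i j} → edge i ≡ edge j → i ≡ j
    edge-injective {i} {j} h = trans (sym (η.strictlyInverseˡ i)) (trans (cong η.to h) (η.strictlyInverseˡ j))

    target-injective : ∀ {y z} → target y ≡ target z → y ≡ z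
    target-injective {y} {z} h = trans (sym (pos-pos⁻ (cod ∘ es) y)) (trans
      (pos-cong (cod ∘ es) (edge-injective (cong proj₁ same)) (position-injective (cong proj₁ same) same))
      (pos-pos⁻ (cod ∘ es) z))
      where
      same : position (edge (proj₁ (pos⁻ (cod ∘ es) y))) (proj₂ (pos⁻ (cod ∘ es) y))
             ≡ position (edge (proj₁ (pos⁻ (cod ∘ es) z))) (proj₂ (pos⁻ (cod ∘ es) z))
      same = target-inj h

    target? : ∀ v → Dec (Σ[ i ∈ Fin k ] Σ[ x ∈ Fin (cod (es i)) ] tgtOf (edge i) x ≡ v)
    target? v = any? (λ i → any? (λ x → Finite-≟ (H.V-finite F) (tgtOf (edge i) x) v))

    sourced : V → Bool
    sourced v = does (imageDec (C.left f) v) ∨ does (target? v)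

    -- Stated with a Boolean, so that the proof component is irrelevant.
    Unsourced : Set
    Unsourced = Σ[ v ∈ V ] sourced v ≡ false

    Unsourced-finite : Finite Unsourced
    Unsourced-finite = Finite-Σ (H.V-finite F) (λ v → Finite-Dec (sourced v Bool.≟ false) BoolUIP.≡-irrelevant)

    module ω = Inverse (proj₂ Unsourced-finite)
    u = proj₁ Unsourced-finite

    Unsourced-≡ : {a b : Unsourced} → proj₁ a ≡ proj₁ b → a ≡ b
    Unsourced-≡ {v , p} {.v , q} refl = cong (v ,_) (BoolUIP.≡-irrelevant p q)

    sourced-left : ∀ x → sourced (l x) ≢ false
    sourced-left x h with imageDec (C.left f) (l x)
    sourced-left x () | yes _
    ... | no ¬p = ¬p (x , refl)

    sourced-target : ∀ z → sourced (target z) ≢ false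
    sourced-target z h with imageDec (C.left f) (target z) | target? (target z)
    sourced-target z () | yes _ | _
    sourced-target z () | no _ | yes _
    ... | no _ | no ¬p = ¬p (_ , _ , refl)

    Loc : Set
    Loc = (El (⨁ k (cod ∘ es)) ⊎ Fin u) ⊎ Fin m

    ν : Loc → V
    ν (inj₁ (inj₁ z)) = target z
    ν (inj₁ (inj₂ i)) = proj₁ (ω.from i)
    ν (inj₂ x)        = l x

    -- Each part of `PLM` settles its own cases: `target-inj` two targets, `left-inj` two inputs,
    -- `disjoint` one of each. The unsourced vertices differ from both by choice.
    ν-injective : ∀ a b → ν a ≡ ν b → a ≡ b
    ν-injective (inj₁ (inj₁ y)) (inj₁ (inj₁ z)) h = cong (inj₁ ∘ inj₁) (target-injective h)
    ν-injective (inj₁ (inj₁ y)) (inj₁ (inj₂ i)) h = ⊥-elim (sourced-target y (trans (cong sourced h) (proj₂ (ω.from i))))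
    ν-injective (inj₁ (inj₁ y)) (inj₂ x) h = ⊥-elim (disjoint h)
    ν-injective (inj₁ (inj₂ i)) (inj₁ (inj₁ z)) h = ⊥-elim (sourced-target z (trans (cong sourced (sym h)) (proj₂ (ω.from i))))
    ν-injective (inj₁ (inj₂ i)) (inj₁ (inj₂ j)) h = cong (inj₁ ∘ inj₂) (trans (sym (ω.strictlyInverseˡ i))
      (trans (cong ω.to (Unsourced-≡ h)) (ω.strictlyInverseˡ j)))
    ν-injective (inj₁ (inj₂ i)) (inj₂ x) h = ⊥-elim (sourced-left x (trans (cong sourced (sym h)) (proj₂ (ω.from i))))
    ν-injective (inj₂ x) (inj₁ (inj₁ z)) h = ⊥-elim (disjoint (sym h))
    ν-injective (inj₂ x) (inj₁ (inj₂ i)) h = ⊥-elim (sourced-left x (trans (cong sourced h) (proj₂ (ω.from i))))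
    ν-injective (inj₂ x) (inj₂ y) h = cong inj₂ (left-inj h)

    ν-surjective : ∀ v → Σ[ a ∈ Loc ] ν a ≡ v
    ν-surjective v with sourced v in eq
    ... | false = inj₁ (inj₂ (ω.to (v , eq))) , cong proj₁ (ω.strictlyInverseʳ (v , eq))
    ... | true with imageDec (C.left f) v | target? v
    ...   | yes (x , h) | _ = inj₂ x , h
    ...   | no _ | yes (i , x , h) = inj₁ (inj₁ (pos (cod ∘ es) i x)) , trans (target-pos i x) h
    ν-surjective v | true | no _ | no _ with eq
    ... | ()

    loc : V → Loc
    loc v = proj₁ (ν-surjective v)

    ν-loc : ∀ v → ν (loc v) ≡ v
    ν-loc v = proj₂ (ν-surjective v)

    loc-ν : ∀ a → loc (ν a) ≡ a
    loc-ν a = ν-injective _ _ (ν-loc (ν a))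

    source : El (⨁ k (dom ∘ es)) → V
    source z = srcOf (edge (proj₁ (pos⁻ (dom ∘ es) z))) (proj₂ (pos⁻ (dom ∘ es) z))

    source-pos : ∀ i x → source (pos (dom ∘ es) i x) ≡ srcOf (edge i) x
    source-pos i x = cong (λ p → srcOf (edge (proj₁ p)) (proj₂ p)) (pos⁻-pos (dom ∘ es) i x)

    φ : (El (⨁ k (dom ∘ es)) ⊎ Fin u) ⊎ Fin n → Loc
    φ (inj₁ (inj₁ z)) = loc (source z)
    φ (inj₁ (inj₂ i)) = inj₁ (inj₂ i)
    φ (inj₂ y)        = loc (HypHom.vmap (C.right f) y)

    shapeOf : Shape m n
    shapeOf = shape k es (fin u) φ (λ _ → refl)

    -- A hyperedge has the arity of its label only up to `label-dom` and `label-cod`; this moves it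
    -- to the arity that a `Link` records.
    retype : ∀ (e : H.Edge F) {a b} → dom (labelOf e) ≡ a → cod (labelOf e) ≡ b → H.E F a b
    retype (a , b , e) p q = subst₂ (H.E F) (trans (sym (H.label-dom F e)) p) (trans (sym (H.label-cod F e)) q) e

    retype-≡ : ∀ (e : H.Edge F) {a b} (p : dom (labelOf e) ≡ a) (q : cod (labelOf e) ≡ b) →
               _≡_ {A = H.Edge F} (a , b , retype e p q) e
    retype-≡ (a , b , e) p q = lem (trans (sym (H.label-dom F e)) p) (trans (sym (H.label-cod F e)) q)
      where
      lem : ∀ {a′ b′} (p : a ≡ a′) (q : b ≡ b′) → _≡_ {A = H.Edge F} (a′ , b′ , subst₂ (H.E F) p q e) (a , b , e)
      lem refl refl = refl

    Edge-injective : ∀ {a b} {e e′ : H.E F a b} → _≡_ {A = H.Edge F} (a , b , e) (a , b , e′) → e ≡ e′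
    Edge-injective refl = refl

    Link-≡ : ∀ {a b} {x y : Link es a b} → Link.index x ≡ Link.index y → x ≡ y
    Link-≡ {x = link i p q} {link .i p′ q′} refl with ≡-irrelevant p p′ | ≡-irrelevant q q′
    ... | refl | refl = refl

    dom-label : ∀ {a b} {e : H.E F a b} {e′} → e′ ≡ (a , b , e) → dom (labelOf e′) ≡ a
    dom-label {e = e} refl = H.label-dom F e

    cod-label : ∀ {a b} {e : H.E F a b} {e′} → e′ ≡ (a , b , e) → cod (labelOf e′) ≡ b
    cod-label {e = e} refl = H.label-cod F e

    toLink : ∀ {a b} → H.E F a b → Link es a b
    toLink e = link (edge-of e) (dom-label (η.strictlyInverseʳ _)) (cod-label (η.strictlyInverseʳ _))

    fromLink : ∀ {a b} → Link es a b → H.E F a b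
    fromLink (link i p q) = retype (edge i) p q

    decomposition : f ≈ᶜ graph shapeOf
    decomposition = reflect (~-trans (mk~
      (record
        { to = loc ; to-R = λ _ _ () ; toE = toLink
        ; to-src = λ e i → ≡⇒Eq (cong loc (sym (trans (source-pos (edge-of e) _)
            (src-≡ e (η.strictlyInverseʳ _) i _ (sym (toℕ-cast _ i))))))
        ; to-tgt = λ e i → ≡⇒Eq (trans (cong loc (sym (trans (target-pos (edge-of e) _)
            (tgt-≡ e (η.strictlyInverseʳ _) i _ (sym (toℕ-cast _ i)))))) (loc-ν _))
        ; to-label = λ e → cong labelOf (η.strictlyInverseʳ (_ , _ , e))
        ; to-left = λ x → ≡⇒Eq (loc-ν (inj₂ x)) ; to-right = λ _ → Eq-refl })
      ν (λ _ _ ()) (λ v → ≡⇒Eq (ν-loc v)) (λ a → ≡⇒Eq (loc-ν a))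
      fromLink
      (λ e → Edge-injective (trans (retype-≡ (edge (edge-of e)) _ _) (η.strictlyInverseʳ (_ , _ , e))))
      (λ { (link i p q) → Link-≡ (trans (cong η.to (retype-≡ (edge i) p q)) (η.strictlyInverseˡ i)) }))
      (~-sym (⌈graph⌉ shapeOf)))

  open Free-Term S using (_≈_; ≈-refl; ≈-sym; ≈-trans)

  -- By soundness each term has the cospan of its normal form, which is a graph by `normal-graph`.
  -- Equal cospans give isomorphic graphs, hence equal normal forms by `normal-injective`.
  complete : ∀ {m n} (t t′ : Tm′ m n) → ⟦ t ⟧ ≈ᶜ ⟦ t′ ⟧ → t ≈ t′
  complete t t′ h with normalise t | normalise t′
  ... | s , p | s′ , p′ = ≈-trans (un≋ p) (≈-trans (un≋ (normal-injective s s′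
      (≈ᶜ-trans (≈ᶜ-sym (normal-graph s)) (≈ᶜ-trans (≈ᶜ-sym (sound (un≋ p))) (≈ᶜ-trans h
        (≈ᶜ-trans (sound (un≋ p′)) (normal-graph s′))))))) (≈-sym (un≋ p′)))

  abstract
    termOf : ∀ {m n} → PROP.Hom (PLMCsp S) m n → Tm′ m n
    termOf (f , plm) = term (normal (Decompose.shapeOf f (toPLM plm)))

    ⟦termOf⟧ : ∀ {m n} (f : PROP.Hom (PLMCsp S) m n) → ⟦ termOf f ⟧ ≈ᶜ proj₁ f
    ⟦termOf⟧ (f , plm) = ≈ᶜ-trans (normal-graph (Decompose.shapeOf f (toPLM plm)))
      (≈ᶜ-sym (Decompose.decomposition f (toPLM plm)))

  -- Recognises `termOf f` by its denotation alone. Functoriality of the inverse and one of the two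
  -- inverse laws are instances.
  termOf-unique : ∀ {m n} (f : PROP.Hom (PLMCsp S) m n) (t : Tm′ m n) → proj₁ f ≈ᶜ ⟦ t ⟧ → termOf f ≈ t
  termOf-unique f t p = complete (termOf f) t (≈ᶜ-trans (⟦termOf⟧ f) p)

-- The isomorphism of PROPs

module _ {c} (S : Signature c) where

  open Semantics S
  open Completeness S
  private
    module T = PROP (TracedPROP.prop (T+CComon S))
    module Q = PROP (PLMCsp S)

  denotation : ∀ {m n} → T.Hom m n → Q.Hom m n
  denotation t = ⟦ t ⟧ , fromPLM (⟦⟧-PLM t)

  denotation-⨾ : ∀ {m n p} (t : T.Hom m n) (u : T.Hom n p) → denotation (t T.⨾ u) Q.≈ denotation t Q.⨾ denotation u
  denotation-⨾ t u = ⨾ˢ≈⨾ᶜ ⟦ t ⟧ ⟦ u ⟧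

  denotation-⊗ : ∀ {m n p q} (t : T.Hom m n) (u : T.Hom p q) → denotation (t T.⊗ u) Q.≈ denotation t Q.⊗ denotation u
  denotation-⊗ t u = ⊗ˢ≈⊗ᶜ ⟦ t ⟧ ⟦ u ⟧

  termOf-cong : ∀ {m n} {f g : Q.Hom m n} → f Q.≈ g → termOf f T.≈ termOf g
  termOf-cong {f = f} {g} p = termOf-unique f (termOf g) (≈ᶜ-trans p (≈ᶜ-sym (⟦termOf⟧ g)))

  termOf-⨾ : ∀ {m n p} (f : Q.Hom m n) (g : Q.Hom n p) → termOf (f Q.⨾ g) T.≈ termOf f T.⨾ termOf g
  termOf-⨾ f g = termOf-unique (f Q.⨾ g) (termOf f T.⨾ termOf g)
    (≈ᶜ-sym (≈ᶜ-trans (⨾ˢ-cong (⟦termOf⟧ f) (⟦termOf⟧ g)) (⨾ˢ≈⨾ᶜ (proj₁ f) (proj₁ g))))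

  termOf-⊗ : ∀ {m n p q} (f : Q.Hom m n) (g : Q.Hom p q) → termOf (f Q.⊗ g) T.≈ termOf f T.⊗ termOf g
  termOf-⊗ f g = termOf-unique (f Q.⊗ g) (termOf f T.⊗ termOf g)
    (≈ᶜ-sym (≈ᶜ-trans (⊗ˢ-cong (⟦termOf⟧ f) (⟦termOf⟧ g)) (⊗ˢ≈⊗ᶜ (proj₁ f) (proj₁ g))))

  denotation-morphism : PROPMorphism (TracedPROP.prop (T+CComon S)) (PLMCsp S)
  denotation-morphism = record
    { F = denotation ; F-cong = sound ; F-id = ≈ᶜ-refl
    ; F-⨾ = denotation-⨾ ; F-⊗ = denotation-⊗ ; F-σ = λ _ _ → ≈ᶜ-refl }

  termOf-morphism : PROPMorphism (PLMCsp S) (TracedPROP.prop (T+CComon S))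
  termOf-morphism = record
    { F = termOf ; F-cong = λ {_} {_} {f} {g} → termOf-cong {f = f} {g}
    ; F-id = λ {n} → termOf-unique (Q.id {n}) id ≈ᶜ-refl
    ; F-⨾ = termOf-⨾ ; F-⊗ = termOf-⊗
    ; F-σ = λ m n → termOf-unique (Q.σ m n) (σ m n) ≈ᶜ-refl }

corollary8p139 : ∀ {c} (S : Signature c) → TracedPROP.prop (T+CComon S) ≅ PLMCsp S
corollary8p139 S = record
  { to      = denotation-morphism S
  ; from    = termOf-morphism S
  ; from-to = λ t → termOf-unique (denotation S t) t ≈ᶜ-refl
  ; to-from = ⟦termOf⟧
  }
  where
  open Semantics S
  open Completeness S
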